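{- Two fine symbols represent isometric lattices if and only if one can be obtained from the other by a finite sequence of sign walking, giver permutation and giver conversion operations.
   Context: $\mathbb{Z}_2$ denotes the $2$-adic integers and $\mathbb{Q}_2$ its fraction field. A lattice is a finitely generated free $\mathbb{Z}_2$-module with a nondegenerate symmetric bilinear form valued in $\mathbb{Q}_2$; $\langle a_1,\dots,a_n\rangle$ is the lattice with diagonal Gram matrix $\mathrm{diag}(a_1,\dots,a_n)$. For $q$ a power of $2$ (possibly with negative exponent) define the following "terms" with scale $q$: $q^{+2}_{\rm II}$ is the lattice with Gram matrix $q\begin{pmatrix}0&1\\1&0\end{pmatrix}$ and $q^{ -2}_{\rm II}$ the lattice with Gram matrix $q\begin{pmatrix}2&1\\1&2\end{pmatrix}$ (type II); $q^{+}_G=\langle q\rangle$, $q^-_G=\langle -3q\rangle$ (givers), $q^+_R=\langle -q\rangle$, $q^-_R=\langle 3q\rangle$ (receivers); givers and receivers have type I. The superscript $\pm$ is the sign of the term; the subscript $G$ or $R$ is its label. A fine symbol is an unordered list of such terms such that a term $q^{\pm2}_{\rm II}$ occurs only if every term of scale $q$ has type II; it represents the orthogonal direct sum of its terms. A compartment of a fine symbol is a maximal set of its type I terms whose set of scales is of the form $\{2^a,2^{a+1},\dots,2^b\}$. The operations are: Sign walking: choose two terms satisfying one of (0) same scale; (1) scales differ by a factor $2$ and one has type I, the other type II; (2) scales differ by a factor $2$ and both are givers or both are receivers; (3) scales differ by a factor $4$ and both have type I; then negate the signs of both terms (keeping scales), and in case (2) also change both from givers to receivers or vice versa (in the other cases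 keeping the labels). Giver permutation: within one compartment, permute the labels $G,R$ among its terms, keeping scales and signs. Giver conversion: within one compartment, change four terms labelled $G$ to label $R$, or four terms labelled $R$ to label $G$, keeping scales and signs. -}

module Defs where

open import Data.Nat as ℕ using (ℕ; zero; suc; _⊔_)
open import Data.Integer as ℤ using (ℤ; +_; -[1+_]; _-_; _*_; _≤_; -_)
open import Data.Integer.Divisibility using (_∣_)
open import Data.Fin using (Fin; zero; suc; splitAt)
open import Data.Sum using (_⊎_; inj₁; inj₂)
open import Data.Product using (Σ; ∃; ∃-syntax; _×_; _,_)
open import Data.List using (List; []; _∷_; _++_; map)
open import Data.List.Relation.Unary.All using (All)
open import Data.List.Relation.Unary.Any using (Any)
open import Data.List.Membership.Propositional using (_∈_)
open import Data.List.Relation.Binary.Pointwise using (Pointwise)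
open import Data.List.Relation.Binary.Permutation.Propositional using (_↭_)
open import Relation.Binary.PropositionalEquality using (_≡_)
open import Relation.Nullary using (¬_)

-- 2-adic integers, as coherent sequences of integer representatives:
-- x = lim seq k with seq (k+1) ≡ seq k (mod 2^k).  Ring operations on
-- ℤ₂ are computed levelwise on representatives, and x = y in ℤ₂ iff
-- seq x k ≡ seq y k (mod 2^k) for all k.

pow2ℕ : ℕ → ℤ
pow2ℕ k = + (2 ℕ.^ k)

record ℤ₂ : Set where
  field
    seq : ℕ → ℤ
    coh : ∀ k → pow2ℕ k ∣ (seq (suc k) - seq k)
open ℤ₂ public

IMat : ℕ → ℕ → Set
IMat n m = Fin n → Fin m → ℤ

sumFin : ∀ {n} → (Fin n → ℤ) → ℤ
sumFin {zero}  f = + 0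
sumFin {suc n} f = f zero ℤ.+ sumFin (λ i → f (suc i))

_·_ : ∀ {n m l} → IMat n m → IMat m l → IMat n l
(A · B) i j = sumFin (λ r → A i r * B r j)

transpose : ∀ {n m} → IMat n m → IMat m n
transpose A i j = A j i

idMat : ∀ {n} → IMat n n
idMat zero    zero    = + 1
idMat zero    (suc j) = + 0
idMat (suc i) zero    = + 0
idMat (suc i) (suc j) = idMat i j

CongMat : ∀ {n m} → ℕ → IMat n m → IMat n m → Set
CongMat k X Y = ∀ i j → pow2ℕ k ∣ (X i j - Y i j)

Mat₂ : ℕ → ℕ → Set
Mat₂ n m = Fin n → Fin m → ℤ₂

atLevel : ∀ {n m} → Mat₂ n m → ℕ → IMat n m
atLevel P k i j = seq (P i j) k

-- Two lattices with Gram matrices A (n×n) and B (m×m) are isometric over ℤ₂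
-- iff there are P ∈ M_{n×m}(ℤ₂), Q ∈ M_{m×n}(ℤ₂) with PQ = 1, QP = 1 and
-- Pᵀ A P = B  (equalities in ℤ₂, checked modulo every 2^k).
IsometricGram : ∀ {n m} → IMat n n → IMat m m → Set
IsometricGram {n} {m} A B =
  Σ (Mat₂ n m) λ P → Σ (Mat₂ m n) λ Q → ∀ k →
    CongMat k (atLevel P k · atLevel Q k) idMat ×
    CongMat k (atLevel Q k · atLevel P k) idMat ×
    CongMat k ((transpose (atLevel P k) · A) · atLevel P k) B

-- Terms and fine symbols.  A term of scale q = 2^e is recorded by e : ℤ.

data Sign : Set where
  plus minus : Sign

data Label : Set where
  G R : Label

-- type II, or type I with a label (giver G / receiver R)
data Kind : Set where
  II : Kind
  I  : Label → Kind

record Term : Set where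
  constructor term
  field
    scale : ℤ      -- exponent e, the scale is 2^e
    sign  : Sign
    kind  : Kind
open Term public

FineSymbol : Set
FineSymbol = List Term

rankK : Kind → ℕ
rankK II    = 2
rankK (I _) = 1

-- Gram matrix of a term divided by its scale q
baseGram : Sign → (k : Kind) → IMat (rankK k) (rankK k)
baseGram plus  II zero zero = + 0
baseGram plus  II zero (suc zero) = + 1
baseGram plus  II (suc zero) zero = + 1
baseGram plus  II (suc zero) (suc zero) = + 0
baseGram minus II zero zero = + 2
baseGram minus II zero (suc zero) = + 1
baseGram minus II (suc zero) zero = + 1
baseGram minus II (suc zero) (suc zero) = + 2
baseGram plus  (I G) zero zero = + 1
baseGram minus (I G) zero zero = - + 3
baseGram plus  (I R) zero zero = - + 1
baseGram minus (I R) zero zero = + 3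

rank : FineSymbol → ℕ
rank []      = 0
rank (t ∷ S) = rankK (kind t) ℕ.+ rank S

negPart : ℤ → ℕ
negPart (+ n)    = 0
negPart -[1+ n ] = suc n

-- a shift N such that 2^N · (Gram matrix) is integral
shift : FineSymbol → ℕ
shift []      = 0
shift (t ∷ S) = negPart (scale t) ⊔ shift S

-- 2^e for e ≥ 0 (only ever applied to nonnegative exponents below)
pow2ℤ : ℤ → ℤ
pow2ℤ (+ n)    = pow2ℕ n
pow2ℤ -[1+ n ] = + 0

blockDiag : ∀ {n m} → IMat n n → IMat m m → IMat (n ℕ.+ m) (n ℕ.+ m)
blockDiag {n} A B i j with splitAt n i | splitAt n j
... | inj₁ i' | inj₁ j' = A i' j'
... | inj₂ i' | inj₂ j' = B i' j'
... | inj₁ _  | inj₂ _  = + 0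
... | inj₂ _  | inj₁ _  = + 0

-- 2^N times the Gram matrix of the orthogonal sum of the terms
-- (requires N ≥ shift S to be integral-valued; used with such N only)
scaledGram : (N : ℕ) → (S : FineSymbol) → IMat (rank S) (rank S)
scaledGram N []      = λ ()
scaledGram N (t ∷ S) =
  blockDiag (λ i j → pow2ℤ (scale t ℤ.+ + N) * baseGram (sign t) (kind t) i j)
            (scaledGram N S)

Isometric : FineSymbol → FineSymbol → Set
Isometric S T = IsometricGram (scaledGram N S) (scaledGram N T)
  where N = shift S ⊔ shift T

IsFine : FineSymbol → Set
IsFine S = ∀ {t t'} → t ∈ S → t' ∈ S → kind t ≡ II → scale t' ≡ scale t → kind t' ≡ II

IsTypeI : Term → Set
IsTypeI t = ∃[ l ] (kind t ≡ I l)

flipS : Sign → Sign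
flipS plus  = minus
flipS minus = plus

flipL : Label → Label
flipL G = R
flipL R = G

negT : Term → Term
negT (term e s k) = term e (flipS s) k

swapT : Term → Term
swapT (term e s II)    = term e s II
swapT (term e s (I l)) = term e s (I (flipL l))

setLabel : Label → Term → Term
setLabel l (term e s k) = term e s (I l)

Differ : ℕ → ℤ → ℤ → Set
Differ d e e' = (e' ≡ e ℤ.+ + d) ⊎ (e ≡ e' ℤ.+ + d)

data Walk : Term → Term → Term → Term → Set where
  walk0 : ∀ {t u} → scale t ≡ scale u → Walk t u (negT t) (negT u)
  walk1 : ∀ {t u} → Differ 1 (scale t) (scale u) →
          (IsTypeI t × kind u ≡ II) ⊎ (kind t ≡ II × IsTypeI u) →
          Walk t u (negT t) (negT u)
  walk2 : ∀ {t u l} → Differ 1 (scale t) (scale u) →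
          kind t ≡ I l → kind u ≡ I l →
          Walk t u (negT (swapT t)) (negT (swapT u))
  walk3 : ∀ {t u} → Differ 2 (scale t) (scale u) →
          IsTypeI t → IsTypeI u → Walk t u (negT t) (negT u)

InRange : ℤ → ℤ → Term → Set
InRange a b t = IsTypeI t × a ≤ scale t × scale t ≤ b

CompartmentRange : FineSymbol → ℤ → ℤ → Set
CompartmentRange S a b =
  a ≤ b ×
  (∀ e → a ≤ e → e ≤ b → Any (λ t → IsTypeI t × scale t ≡ e) S) ×
  ¬ Any (λ t → IsTypeI t × scale t ℤ.+ + 1 ≡ a) S ×
  ¬ Any (λ t → IsTypeI t × scale t ≡ b ℤ.+ + 1) S

SameButLabel : Term → Term → Set
SameButLabel t t' = scale t ≡ scale t' × sign t ≡ sign t' × IsTypeI t × IsTypeI t'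

-- One elementary step between fine symbols (unordered lists: reordering
-- is a step that does not change the symbol).
data Step : FineSymbol → FineSymbol → Set where
  reorder : ∀ {S T} → S ↭ T → Step S T
  signWalk : ∀ {t u t' u' rest} → Walk t u t' u' →
             Step (t ∷ u ∷ rest) (t' ∷ u' ∷ rest)
  giverPerm : ∀ {C C' rest a b} →
             CompartmentRange (C ++ rest) a b →
             All (InRange a b) C → All (λ t → ¬ InRange a b t) rest →
             Pointwise SameButLabel C C' → map kind C' ↭ map kind C →
             Step (C ++ rest) (C' ++ rest)
  giverConv : ∀ {t₁ t₂ t₃ t₄ rest a b l} →
             CompartmentRange (t₁ ∷ t₂ ∷ t₃ ∷ t₄ ∷ rest) a b →
             InRange a b t₁ → InRange a b t₂ → InRange a b t₃ → InRange a b t₄ →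
             kind t₁ ≡ I l → kind t₂ ≡ I l → kind t₃ ≡ I l → kind t₄ ≡ I l →
             Step (t₁ ∷ t₂ ∷ t₃ ∷ t₄ ∷ rest)
                  (setLabel (flipL l) t₁ ∷ setLabel (flipL l) t₂ ∷
                   setLabel (flipL l) t₃ ∷ setLabel (flipL l) t₄ ∷ rest)

{-# OPTIONS --safe #-}
-- Soundness.  Every operation is a composite of moves on two or four terms that make no reference to
-- compartments, and each such move is an isometry given by an explicit integral matrix of odd
-- determinant followed by rescaling with 2-adic square roots of units ≡ 1 mod 8.
--
-- Completeness.  The number of x mod 2^k with A x ≡ 0 shows that the rank of each scale is an isometry
-- invariant.  The Gauss sum of exp (2 π i (x, x) / 2^(k+1)) over x mod 2^(k+1) vanishes exactly when
-- there is a type I term of scale 2^k; otherwise it is θ^h, θ a primitive eighth root of unity, up to a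
-- factor depending only on ranks and types, where h is the sum over the terms of scale 2^e, e < k, of:
-- the unit mod 8 (type I, k - e even), 6 per receiver (type I, k - e odd), 4 per minus sign (type II,
-- k - e odd).  So h mod 8 is an invariant.  The sums are taken in ℤ modulo the Fermat number
-- 2^(2^k) + 1, where 2 is a root of unity of order 2^(k+1).  Two symbols with the same ranks, types and
-- exponents h are compared from the lowest scale upwards: if the first terms cannot be made equal by
-- moves, the invariant h at a scale just above them gives a contradiction; and once they are equal they
-- can be dropped, because the exponents h of what remains still agree.
module Submission where

open import Defs
open import Data.Nat as ℕ using (ℕ; zero; suc; NonZero; z≤n; s≤s)
import Data.Nat.Properties as ℕₚ
import Data.Nat.Divisibility as ℕD
import Data.Nat.DivMod as DM
open import Data.Integer as ℤ using (ℤ; +_; -[1+_]; _+_; _*_; _-_; -_; ∣_∣; _^_)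
import Data.Integer.Properties as ℤₚ
import Data.Integer.Divisibility as ℤD
import Data.Integer.Divisibility.Signed as ℤS
import Data.Integer.DivMod as ℤDM
open import Data.Integer.Tactic.RingSolver using (solve-∀)
open import Data.Bool using (if_then_else_)
open import Data.Empty using (⊥; ⊥-elim)
open import Data.Unit using (⊤; tt)
open import Data.Sum using (_⊎_; inj₁; inj₂; [_,_])
open import Data.Product using (∃-syntax; _×_; _,_; proj₁; proj₂)
open import Data.Fin as Fin using (Fin; zero; suc; splitAt; _↑ˡ_; _↑ʳ_)
import Data.Fin.Properties as Finₚ
open import Data.List using (List; []; _∷_; _++_; map; length; zipWith)
import Data.List.Properties as Lₚ
open import Data.List.Relation.Unary.All as All using (All; []; _∷_)
import Data.List.Relation.Unary.All.Properties as Allₚ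
open import Data.List.Relation.Unary.Any as Any using (Any; here; there)
import Data.List.Relation.Unary.Any.Properties as Anyₚ
open import Data.List.Membership.Propositional using (_∈_)
import Data.List.Membership.Propositional.Properties as Memₚ
open import Data.List.Relation.Binary.Pointwise as PW using (Pointwise; []; _∷_)
open import Data.List.Relation.Binary.Permutation.Propositional as Perm using (_↭_; ↭-refl; ↭-sym; ↭-trans)
import Data.List.Relation.Binary.Permutation.Propositional.Properties as Permₚ
open import Function using (_∘_)
open import Function.Bundles using (_⇔_; mk⇔)
open import Relation.Binary.Construct.Closure.ReflexiveTransitive using (Star; ε; _◅_; _◅◅_)
open import Relation.Binary.Definitions using (tri<; tri≈; tri>)
open import Relation.Binary.PropositionalEquality using (_≡_; _≢_; refl; sym; trans; cong; cong₂; subst; subst₂; module ≡-Reasoning)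
open import Relation.Nullary using (¬_; Dec; yes; no)
open import Relation.Nullary.Decidable using (map′; _×-dec_; from-yes; True; toWitness; does; toSum; ¬?)

-- Congruences

-- Orthogonal summands do not in general cancel from isometries of 2-adic lattices, so the induction
-- on the lowest term does not carry the isometry. It carries the congruences between the exponents
-- h, which are sums over terms and do cancel. The price is that h is missing at scales with type I
-- terms. One scale above its own, a type I term shows only its label; two scales above, its whole
-- unit mod 8. Hence labels are matched before signs. The contributions 0 and 6 of the two labels
-- differ by a multiple of 8 over four terms, which is giver conversion, and by 4 mod 8 over two
-- terms, which is the effect of one sign. Residues modulo a Fermat number replace cyclotomic
-- numbers because a Gauss sum is needed only as an invertible factor times a power of θ. For this
-- it suffices that 2 is invertible, that 1 and 0 are distinct, and that the character takes the
-- value -1 at half its period; neither primality nor absolute values enter.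

infix 3 _by_
infix 4 _≡_⟦_⟧
-- With the quotient stored, matching on the equation leaves polynomial identities for the ring
-- solver. Modulus 0 is equality, so exact counts and sums modulo a Fermat number share one set of
-- lemmas.
record _≡_⟦_⟧ (x y m : ℤ) : Set where
  constructor _by_
  field
    quotient : ℤ
    equation : x ≡ y + quotient * m
open _≡_⟦_⟧

≡⇒≡ᵐ : ∀ {x y m} → x ≡ y → x ≡ y ⟦ m ⟧
≡⇒≡ᵐ {x} {m = m} refl = + 0 by sym (ℤₚ.+-identityʳ x)

reflᵐ : ∀ {x m} → x ≡ x ⟦ m ⟧
reflᵐ = ≡⇒≡ᵐ refl

symᵐ : ∀ {x y m} → x ≡ y ⟦ m ⟧ → y ≡ x ⟦ m ⟧
symᵐ {y = y} {m} (q by refl) = - q by lem y q m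
  where
  lem : ∀ y q m → y ≡ (y + q * m) + (- q) * m
  lem = solve-∀

transᵐ : ∀ {x y z m} → x ≡ y ⟦ m ⟧ → y ≡ z ⟦ m ⟧ → x ≡ z ⟦ m ⟧
transᵐ {z = z} {m} (p by refl) (q by refl) = q + p by lem z p q m
  where
  lem : ∀ z p q m → (z + q * m) + p * m ≡ z + (q + p) * m
  lem = solve-∀

+-congᵐ : ∀ {x y u v m} → x ≡ y ⟦ m ⟧ → u ≡ v ⟦ m ⟧ → x + u ≡ y + v ⟦ m ⟧
+-congᵐ {y = y} {v = v} {m} (p by refl) (q by refl) = p + q by lem y v p q m
  where
  lem : ∀ y v p q m → (y + p * m) + (v + q * m) ≡ (y + v) + (p + q) * m
  lem = solve-∀

*-congᵐ : ∀ {x y u v m} → x ≡ y ⟦ m ⟧ → u ≡ v ⟦ m ⟧ → x * u ≡ y * v ⟦ m ⟧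
*-congᵐ {y = y} {v = v} {m} (p by refl) (q by refl) = p * v + y * q + p * q * m by lem y v p q m
  where
  lem : ∀ y v p q m → (y + p * m) * (v + q * m) ≡ (y * v) + (p * v + y * q + p * q * m) * m
  lem = solve-∀

-‿congᵐ : ∀ {x y m} → x ≡ y ⟦ m ⟧ → - x ≡ - y ⟦ m ⟧
-‿congᵐ {y = y} {m} (p by refl) = - p by lem y p m
  where
  lem : ∀ y p m → - (y + p * m) ≡ - y + (- p) * m
  lem = solve-∀

weakenᵐ : ∀ m {x y n} → x ≡ y ⟦ m * n ⟧ → x ≡ y ⟦ n ⟧
weakenᵐ m {y = y} {n} (q by refl) = q * m by cong (λ z → y + z) (sym (ℤₚ.*-assoc q m n))

scaleᵐ : ∀ c {x y m} → x ≡ y ⟦ m ⟧ → c * x ≡ c * y ⟦ c * m ⟧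
scaleᵐ c {y = y} {m} (q by refl) = q by lem c y q m
  where
  lem : ∀ c y q m → c * (y + q * m) ≡ c * y + q * (c * m)
  lem = solve-∀

mod0 : ∀ {x y} → x ≡ y ⟦ + 0 ⟧ → x ≡ y
mod0 {y = y} (q by refl) = trans (cong (λ z → y + z) (ℤₚ.*-zeroʳ q)) (ℤₚ.+-identityʳ y)

∣⇒≡ᵐ : ∀ {x y m} → m ℤD.∣ (x - y) → x ≡ y ⟦ m ⟧
∣⇒≡ᵐ {x} {y} {m} d with ℤS.∣ᵤ⇒∣ d
... | ℤS.divides q eq = q by trans (lem x y) (cong (λ z → y + z) eq)
  where
  lem : ∀ x y → x ≡ y + (x - y)
  lem = solve-∀

≡ᵐ⇒∣ : ∀ {x y m} → x ≡ y ⟦ m ⟧ → m ℤD.∣ (x - y)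
≡ᵐ⇒∣ {y = y} {m} (q by refl) = ℤS.∣⇒∣ᵤ (ℤS.divides q (lem y (q * m)))
  where
  lem : ∀ y z → (y + z) - y ≡ z
  lem = solve-∀

pow2ℕ-+ : ∀ a b → pow2ℕ (a ℕ.+ b) ≡ pow2ℕ a * pow2ℕ b
pow2ℕ-+ a b = trans (cong +_ (ℕₚ.^-distribˡ-+-* 2 a b)) (ℤₚ.pos-* (2 ℕ.^ a) (2 ℕ.^ b))

pow2ℕ-suc : ∀ a → pow2ℕ (suc a) ≡ + 2 * pow2ℕ a
pow2ℕ-suc a = ℤₚ.pos-* 2 (2 ℕ.^ a)


*-congˡᵐ : ∀ c {x y m} → x ≡ y ⟦ m ⟧ → c * x ≡ c * y ⟦ m ⟧
*-congˡᵐ c e = *-congᵐ (reflᵐ {c}) e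

*-congʳᵐ : ∀ {x y m} → x ≡ y ⟦ m ⟧ → ∀ c → x * c ≡ y * c ⟦ m ⟧
*-congʳᵐ e c = *-congᵐ e (reflᵐ {c})

-- Matrices and isometries

-- Index sets of block matrices: blocks are indexed by disjoint unions rather than by intervals of naturals.
infixr 6 _⊕_
data U : Set where
  𝟘 𝟙 : U
  _⊕_ : U → U → U

El : U → Set
El 𝟘       = ⊥
El 𝟙       = ⊤
El (u ⊕ v) = El u ⊎ El v

∑ : ∀ u → (El u → ℤ) → ℤ
∑ 𝟘       f = + 0
∑ 𝟙       f = f tt
∑ (u ⊕ v) f = ∑ u (f ∘ inj₁) + ∑ v (f ∘ inj₂)

∑-congᵐ : ∀ {m} u {f g} → (∀ i → f i ≡ g i ⟦ m ⟧) → ∑ u f ≡ ∑ u g ⟦ m ⟧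
∑-congᵐ 𝟘       e = reflᵐ
∑-congᵐ 𝟙       e = e tt
∑-congᵐ (u ⊕ v) e = +-congᵐ (∑-congᵐ u (λ i → e (inj₁ i))) (∑-congᵐ v (λ i → e (inj₂ i)))

∑-cong : ∀ u {f g} → (∀ i → f i ≡ g i) → ∑ u f ≡ ∑ u g
∑-cong 𝟘       e = refl
∑-cong 𝟙       e = e tt
∑-cong (u ⊕ v) e = cong₂ _+_ (∑-cong u (λ i → e (inj₁ i))) (∑-cong v (λ i → e (inj₂ i)))

∑-zero : ∀ u → ∑ u (λ _ → + 0) ≡ + 0
∑-zero 𝟘       = refl
∑-zero 𝟙       = refl
∑-zero (u ⊕ v) = cong₂ _+_ (∑-zero u) (∑-zero v)

∑-+ : ∀ u (f g : El u → ℤ) → ∑ u (λ i → f i + g i) ≡ ∑ u f + ∑ u g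
∑-+ 𝟘       f g = refl
∑-+ 𝟙       f g = refl
∑-+ (u ⊕ v) f g = trans (cong₂ _+_ (∑-+ u _ _) (∑-+ v _ _)) (lem (∑ u (f ∘ inj₁)) (∑ u (g ∘ inj₁)) (∑ v (f ∘ inj₂)) (∑ v (g ∘ inj₂)))
  where
  lem : ∀ a b c d → (a + b) + (c + d) ≡ (a + c) + (b + d)
  lem = solve-∀

∑-*ˡ : ∀ u c (f : El u → ℤ) → ∑ u (λ i → c * f i) ≡ c * ∑ u f
∑-*ˡ 𝟘       c f = sym (ℤₚ.*-zeroʳ c)
∑-*ˡ 𝟙       c f = refl
∑-*ˡ (u ⊕ v) c f = trans (cong₂ _+_ (∑-*ˡ u c _) (∑-*ˡ v c _)) (sym (ℤₚ.*-distribˡ-+ c _ _))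

∑-*ʳ : ∀ u (f : El u → ℤ) c → ∑ u (λ i → f i * c) ≡ ∑ u f * c
∑-*ʳ u f c = trans (∑-cong u (λ i → ℤₚ.*-comm (f i) c)) (trans (∑-*ˡ u c f) (ℤₚ.*-comm c _))

∑-swap : ∀ u v (f : El u → El v → ℤ) → ∑ u (λ i → ∑ v (f i)) ≡ ∑ v (λ j → ∑ u (λ i → f i j))
∑-swap 𝟘       v f = sym (∑-zero v)
∑-swap 𝟙       v f = refl
∑-swap (u ⊕ w) v f = trans (cong₂ _+_ (∑-swap u v _) (∑-swap w v _)) (sym (∑-+ v _ _))

δ : ∀ u → El u → El u → ℤ
δ 𝟙       _        _        = + 1
δ (u ⊕ v) (inj₁ i) (inj₁ j) = δ u i j
δ (u ⊕ v) (inj₁ i) (inj₂ j) = + 0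
δ (u ⊕ v) (inj₂ i) (inj₁ j) = + 0
δ (u ⊕ v) (inj₂ i) (inj₂ j) = δ v i j

δ-sym : ∀ u i j → δ u i j ≡ δ u j i
δ-sym 𝟙       _        _        = refl
δ-sym (u ⊕ v) (inj₁ i) (inj₁ j) = δ-sym u i j
δ-sym (u ⊕ v) (inj₁ i) (inj₂ j) = refl
δ-sym (u ⊕ v) (inj₂ i) (inj₁ j) = refl
δ-sym (u ⊕ v) (inj₂ i) (inj₂ j) = δ-sym v i j

∑-zero* : ∀ u (f : El u → ℤ) → ∑ u (λ i → + 0 * f i) ≡ + 0
∑-zero* u f = trans (∑-*ˡ u (+ 0) f) refl

∑-δ : ∀ u i (f : El u → ℤ) → ∑ u (λ r → δ u i r * f r) ≡ f i
∑-δ 𝟙       i        f = ℤₚ.*-identityˡ (f tt)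
∑-δ (u ⊕ v) (inj₁ i) f = trans (cong₂ _+_ (∑-δ u i _) (∑-zero* v (f ∘ inj₂))) (ℤₚ.+-identityʳ _)
∑-δ (u ⊕ v) (inj₂ i) f = trans (cong₂ _+_ (∑-zero* u (f ∘ inj₁)) (∑-δ v i _)) (ℤₚ.+-identityˡ _)

Mat : U → U → Set
Mat u v = El u → El v → ℤ

infixl 7 _⊡_
_⊡_ : ∀ {u v w} → Mat u v → Mat v w → Mat u w
_⊡_ {v = v} A B i j = ∑ v (λ r → A i r * B r j)

_ᵀ : ∀ {u v} → Mat u v → Mat v u
(A ᵀ) i j = A j i

infix 4 _≃_⟦_⟧
_≃_⟦_⟧ : ∀ {u v} → Mat u v → Mat u v → ℤ → Set
A ≃ B ⟦ m ⟧ = ∀ i j → A i j ≡ B i j ⟦ m ⟧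

≃-sym : ∀ {u v m} {A B : Mat u v} → A ≃ B ⟦ m ⟧ → B ≃ A ⟦ m ⟧
≃-sym e i j = symᵐ (e i j)

≃-trans : ∀ {u v m} {A B C : Mat u v} → A ≃ B ⟦ m ⟧ → B ≃ C ⟦ m ⟧ → A ≃ C ⟦ m ⟧
≃-trans e e' i j = transᵐ (e i j) (e' i j)

⊡-cong : ∀ {u v w m} {A B : Mat u v} {C D : Mat v w} →
  A ≃ B ⟦ m ⟧ → C ≃ D ⟦ m ⟧ → A ⊡ C ≃ B ⊡ D ⟦ m ⟧
⊡-cong {v = v} e e' i j = ∑-congᵐ v (λ r → *-congᵐ (e i r) (e' r j))

⊡-congˡ : ∀ {u v w m} (A : Mat u v) {C D : Mat v w} → C ≃ D ⟦ m ⟧ → A ⊡ C ≃ A ⊡ D ⟦ m ⟧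
⊡-congˡ A e = ⊡-cong {A = A} (λ i j → reflᵐ) e

⊡-congʳ : ∀ {u v w m} {A B : Mat u v} (C : Mat v w) → A ≃ B ⟦ m ⟧ → A ⊡ C ≃ B ⊡ C ⟦ m ⟧
⊡-congʳ C e = ⊡-cong {C = C} e (λ i j → reflᵐ)

⊡-assoc : ∀ {u v w x m} (A : Mat u v) (B : Mat v w) (C : Mat w x) →
  (A ⊡ B) ⊡ C ≃ A ⊡ (B ⊡ C) ⟦ m ⟧
⊡-assoc {v = v} {w} A B C i j = ≡⇒≡ᵐ (begin
  ∑ w (λ s → ∑ v (λ r → A i r * B r s) * C s j)   ≡⟨ ∑-cong w (λ s → sym (∑-*ʳ v _ (C s j))) ⟩
  ∑ w (λ s → ∑ v (λ r → A i r * B r s * C s j))   ≡⟨ ∑-swap w v _ ⟩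
  ∑ v (λ r → ∑ w (λ s → A i r * B r s * C s j))   ≡⟨ ∑-cong v (λ r → ∑-cong w (λ s → ℤₚ.*-assoc (A i r) _ _)) ⟩
  ∑ v (λ r → ∑ w (λ s → A i r * (B r s * C s j))) ≡⟨ ∑-cong v (λ r → ∑-*ˡ w (A i r) _) ⟩
  ∑ v (λ r → A i r * ∑ w (λ s → B r s * C s j))   ∎)
  where open ≡-Reasoning

⊡-identityˡ : ∀ {u v m} (A : Mat u v) → δ u ⊡ A ≃ A ⟦ m ⟧
⊡-identityˡ {u} A i j = ≡⇒≡ᵐ (∑-δ u i (λ r → A r j))

ᵀ-⊡ : ∀ {u v w m} (A : Mat u v) (B : Mat v w) → (A ⊡ B) ᵀ ≃ (B ᵀ) ⊡ (A ᵀ) ⟦ m ⟧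
ᵀ-⊡ {v = v} A B i j = ≡⇒≡ᵐ (∑-cong v (λ r → ℤₚ.*-comm (A j r) (B r i)))

⊡-identityʳ : ∀ {u v m} (A : Mat u v) → A ⊡ δ v ≃ A ⟦ m ⟧
⊡-identityʳ {v = v} A i j = ≡⇒≡ᵐ (trans (∑-cong v (λ r → trans (ℤₚ.*-comm (A i r) _) (cong (_* A i r) (δ-sym v r j)))) (∑-δ v j (A i)))

_⊞_ : ∀ {u v u' v'} → Mat u v → Mat u' v' → Mat (u ⊕ u') (v ⊕ v')
(A ⊞ B) (inj₁ i) (inj₁ j) = A i j
(A ⊞ B) (inj₁ i) (inj₂ j) = + 0
(A ⊞ B) (inj₂ i) (inj₁ j) = + 0
(A ⊞ B) (inj₂ i) (inj₂ j) = B i j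

⊞-cong : ∀ {u v u' v' m} {A B : Mat u v} {C D : Mat u' v'} →
  A ≃ B ⟦ m ⟧ → C ≃ D ⟦ m ⟧ → A ⊞ C ≃ B ⊞ D ⟦ m ⟧
⊞-cong e e' (inj₁ i) (inj₁ j) = e i j
⊞-cong e e' (inj₁ i) (inj₂ j) = reflᵐ
⊞-cong e e' (inj₂ i) (inj₁ j) = reflᵐ
⊞-cong e e' (inj₂ i) (inj₂ j) = e' i j

⊞-δ : ∀ {u v m} → δ u ⊞ δ v ≃ δ (u ⊕ v) ⟦ m ⟧
⊞-δ (inj₁ i) (inj₁ j) = reflᵐ
⊞-δ (inj₁ i) (inj₂ j) = reflᵐ
⊞-δ (inj₂ i) (inj₁ j) = reflᵐ
⊞-δ (inj₂ i) (inj₂ j) = reflᵐ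

⊞-ᵀ : ∀ {u v u' v' m} (A : Mat u v) (B : Mat u' v') → (A ⊞ B) ᵀ ≃ (A ᵀ) ⊞ (B ᵀ) ⟦ m ⟧
⊞-ᵀ A B (inj₁ i) (inj₁ j) = reflᵐ
⊞-ᵀ A B (inj₁ i) (inj₂ j) = reflᵐ
⊞-ᵀ A B (inj₂ i) (inj₁ j) = reflᵐ
⊞-ᵀ A B (inj₂ i) (inj₂ j) = reflᵐ

∑-*zero : ∀ u (f : El u → ℤ) → ∑ u (λ i → f i * + 0) ≡ + 0
∑-*zero u f = trans (∑-*ʳ u f (+ 0)) (ℤₚ.*-zeroʳ (∑ u f))

⊞-⊡ : ∀ {u v w u' v' w' m} (A : Mat u v) (B : Mat u' v') (C : Mat v w) (D : Mat v' w') →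
  (A ⊞ B) ⊡ (C ⊞ D) ≃ (A ⊡ C) ⊞ (B ⊡ D) ⟦ m ⟧
⊞-⊡ {v = v} {v' = v'} A B C D (inj₁ i) (inj₁ j) = ≡⇒≡ᵐ (trans (cong (λ z → (A ⊡ C) i j + z) (∑-zero v')) (ℤₚ.+-identityʳ _))
⊞-⊡ {v = v} {v' = v'} A B C D (inj₁ i) (inj₂ j) = ≡⇒≡ᵐ (cong₂ _+_ (∑-*zero v (A i)) (∑-zero* v' (λ r → D r j)))
⊞-⊡ {v = v} {v' = v'} A B C D (inj₂ i) (inj₁ j) = ≡⇒≡ᵐ (cong₂ _+_ (∑-zero* v (λ r → C r j)) (∑-*zero v' (B i)))
⊞-⊡ {v = v} {v' = v'} A B C D (inj₂ i) (inj₂ j) = ≡⇒≡ᵐ (trans (cong (_+ (B ⊡ D) i j) (∑-zero v)) (ℤₚ.+-identityˡ _))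

record IsIsometry (m : ℤ) {u v} (A : Mat u u) (B : Mat v v) (P : Mat u v) (Q : Mat v u) : Set where
  field
    PQ≃1 : P ⊡ Q ≃ δ u ⟦ m ⟧
    QP≃1 : Q ⊡ P ≃ δ v ⟦ m ⟧
    gram : ((P ᵀ) ⊡ A) ⊡ P ≃ B ⟦ m ⟧
open IsIsometry

module _ {m : ℤ} where

  cancel-middle : ∀ {u v w} (P : Mat u v) (Q : Mat v u) (X : Mat w u) (Y : Mat u w) →
    P ⊡ Q ≃ δ u ⟦ m ⟧ → (X ⊡ P) ⊡ (Q ⊡ Y) ≃ X ⊡ Y ⟦ m ⟧
  cancel-middle P Q X Y e =
    ≃-trans (⊡-assoc X P (Q ⊡ Y)) (⊡-congˡ X
      (≃-trans (≃-sym (⊡-assoc P Q Y)) (≃-trans (⊡-congʳ Y e) (⊡-identityˡ Y))))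

  isometry-trans : ∀ {u v w} {A : Mat u u} {B : Mat v v} {C : Mat w w} {P Q P' Q'} →
    IsIsometry m A B P Q → IsIsometry m B C P' Q' → IsIsometry m A C (P ⊡ P') (Q' ⊡ Q)
  PQ≃1 (isometry-trans {P = P} {Q} {P'} {Q'} φ ψ) = ≃-trans (cancel-middle P' Q' P Q (PQ≃1 ψ)) (PQ≃1 φ)
  QP≃1 (isometry-trans {P = P} {Q} {P'} {Q'} φ ψ) = ≃-trans (cancel-middle Q P Q' P' (QP≃1 φ)) (QP≃1 ψ)
  gram (isometry-trans {A = A} {B} {C} {P} {Q} {P'} {Q'} φ ψ) =
    ≃-trans (⊡-congʳ (P ⊡ P') (⊡-congʳ A (ᵀ-⊡ P P')))
    (≃-trans (⊡-congʳ (P ⊡ P') (⊡-assoc (P' ᵀ) (P ᵀ) A))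
    (≃-trans (≃-sym (⊡-assoc ((P' ᵀ) ⊡ ((P ᵀ) ⊡ A)) P P'))
    (≃-trans (⊡-congʳ P' (⊡-assoc (P' ᵀ) ((P ᵀ) ⊡ A) P))
    (≃-trans (⊡-congʳ P' (⊡-congˡ (P' ᵀ) (gram φ))) (gram ψ)))))

  -- Conjugating `B ≡ PᵀAP` by `Q` gives `(PQ)ᵀ A (PQ)`, and `PQ ≡ 1`.
  isometry-sym : ∀ {u v} {A : Mat u u} {B : Mat v v} {P Q} →
    IsIsometry m A B P Q → IsIsometry m B A Q P
  PQ≃1 (isometry-sym φ) = QP≃1 φ
  QP≃1 (isometry-sym φ) = PQ≃1 φ
  gram (isometry-sym {A = A} {B} {P} {Q} φ) =
    ≃-trans (⊡-congʳ Q (⊡-congˡ (Q ᵀ) (≃-sym (gram φ))))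
    (≃-trans (⊡-assoc (Q ᵀ) (((P ᵀ) ⊡ A) ⊡ P) Q)
    (≃-trans (⊡-congˡ (Q ᵀ) (⊡-assoc ((P ᵀ) ⊡ A) P Q))
    (≃-trans (⊡-congˡ (Q ᵀ) (≃-trans (⊡-congˡ ((P ᵀ) ⊡ A) (PQ≃1 φ)) (⊡-identityʳ ((P ᵀ) ⊡ A))))
    (≃-trans (≃-sym (⊡-assoc (Q ᵀ) (P ᵀ) A))
    (≃-trans (⊡-congʳ A (≃-trans (≃-sym (ᵀ-⊡ P Q)) (λ i j → transᵐ (PQ≃1 φ j i) (≡⇒≡ᵐ (δ-sym _ j i)))))
      (⊡-identityˡ A))))))

  isometry-⊞ : ∀ {u v u' v'} {A : Mat u u} {B : Mat v v} {A' : Mat u' u'} {B' : Mat v' v'} {P Q P' Q'} →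
    IsIsometry m A B P Q → IsIsometry m A' B' P' Q' →
    IsIsometry m (A ⊞ A') (B ⊞ B') (P ⊞ P') (Q ⊞ Q')
  PQ≃1 (isometry-⊞ {P = P} {Q} {P'} {Q'} φ ψ) = ≃-trans (⊞-⊡ P P' Q Q') (≃-trans (⊞-cong (PQ≃1 φ) (PQ≃1 ψ)) ⊞-δ)
  QP≃1 (isometry-⊞ {P = P} {Q} {P'} {Q'} φ ψ) = ≃-trans (⊞-⊡ Q Q' P P') (≃-trans (⊞-cong (QP≃1 φ) (QP≃1 ψ)) ⊞-δ)
  gram (isometry-⊞ {A = A} {A' = A'} {P = P} {P' = P'} φ ψ) =
    ≃-trans (⊡-congʳ (P ⊞ P') (≃-trans (⊡-congʳ (A ⊞ A') (⊞-ᵀ P P')) (⊞-⊡ (P ᵀ) (P' ᵀ) A A')))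
    (≃-trans (⊞-⊡ ((P ᵀ) ⊡ A) ((P' ᵀ) ⊡ A') P P') (⊞-cong (gram φ) (gram ψ)))

-- A matrix over the 2-adic integers, by its levels as in ℤ₂.
record Fam (u v : U) : Set where
  field
    at  : ℕ → Mat u v
    coh : ∀ k → at (suc k) ≃ at k ⟦ pow2ℕ k ⟧
open Fam

infix 4 _≅_
record _≅_ {u v} (A : Mat u u) (B : Mat v v) : Set where
  field
    to       : Fam u v
    from     : Fam v u
    isometry : ∀ k → IsIsometry (pow2ℕ k) A B (at to k) (at from k)
open _≅_

_⊡ᶠ_ : ∀ {u v w} → Fam u v → Fam v w → Fam u w
at (P ⊡ᶠ Q) k = at P k ⊡ at Q k
coh (P ⊡ᶠ Q) k = ⊡-cong (coh P k) (coh Q k)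

_⊞ᶠ_ : ∀ {u v u' v'} → Fam u v → Fam u' v' → Fam (u ⊕ u') (v ⊕ v')
at (P ⊞ᶠ Q) k = at P k ⊞ at Q k
coh (P ⊞ᶠ Q) k = ⊞-cong (coh P k) (coh Q k)

constᶠ : ∀ {u v} → Mat u v → Fam u v
at (constᶠ A) k = A
coh (constᶠ A) k i j = reflᵐ

≅-trans : ∀ {u v w} {A : Mat u u} {B : Mat v v} {C : Mat w w} → A ≅ B → B ≅ C → A ≅ C
to (≅-trans φ ψ) = to φ ⊡ᶠ to ψ
from (≅-trans φ ψ) = from ψ ⊡ᶠ from φ
isometry (≅-trans φ ψ) k = isometry-trans (isometry φ k) (isometry ψ k)

≅-sym : ∀ {u v} {A : Mat u u} {B : Mat v v} → A ≅ B → B ≅ A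
to (≅-sym φ) = from φ
from (≅-sym φ) = to φ
isometry (≅-sym φ) k = isometry-sym (isometry φ k)

infixr 5 _⊞-≅_
_⊞-≅_ : ∀ {u v u' v'} {A : Mat u u} {B : Mat v v} {A' : Mat u' u'} {B' : Mat v' v'} →
  A ≅ B → A' ≅ B' → A ⊞ A' ≅ B ⊞ B'
to (φ ⊞-≅ ψ) = to φ ⊞ᶠ to ψ
from (φ ⊞-≅ ψ) = from φ ⊞ᶠ from ψ
isometry (φ ⊞-≅ ψ) k = isometry-⊞ (isometry φ k) (isometry ψ k)

-- The hypothesis on δ says that f and g are adjoint as permutation matrices.
reindex : ∀ {u v} {A : Mat u u} {B : Mat v v} (f : El u → El v) (g : El v → El u) →
  (∀ i → g (f i) ≡ i) → (∀ j → f (g j) ≡ j) → (∀ i j → δ v (f i) j ≡ δ u i (g j)) →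
  (∀ i j → A (g i) (g j) ≡ B i j) → A ≅ B
to (reindex {u} {v} f g gf fg adj AB) = constᶠ (λ i j → δ v (f i) j)
from (reindex {u} {v} f g gf fg adj AB) = constᶠ (λ i j → δ u (g i) j)
isometry (reindex {u} {v} {A} {B} f g gf fg adj AB) k = record
  { PQ≃1 = λ i j → ≡⇒≡ᵐ (trans (∑-δ v (f i) _) (cong (λ r → δ u r j) (gf i)))
  ; QP≃1 = λ i j → ≡⇒≡ᵐ (trans (∑-δ u (g i) _) (cong (λ r → δ v r j) (fg i)))
  ; gram = λ i j → ≡⇒≡ᵐ (begin
      ∑ u (λ r → ∑ u (λ s → δ v (f s) i * A s r) * δ v (f r) j)
        ≡⟨ ∑-cong u (λ r → cong₂ _*_ (∑-cong u (λ s → cong (_* A s r) (lem s i))) (lem r j)) ⟩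
      ∑ u (λ r → ∑ u (λ s → δ u (g i) s * A s r) * δ u (g j) r)
        ≡⟨ ∑-cong u (λ r → trans (cong (_* δ u (g j) r) (∑-δ u (g i) (λ s → A s r))) (ℤₚ.*-comm (A (g i) r) (δ u (g j) r))) ⟩
      ∑ u (λ r → δ u (g j) r * A (g i) r)
        ≡⟨ ∑-δ u (g j) (A (g i)) ⟩
      A (g i) (g j) ≡⟨ AB i j ⟩
      B i j ∎) }
  where
  open ≡-Reasoning
  lem : ∀ s i → δ v (f s) i ≡ δ u (g i) s
  lem s i = trans (adj s i) (δ-sym u s (g i))

≅-refl : ∀ {u} {A : Mat u u} → A ≅ A
≅-refl = reindex (λ i → i) (λ i → i) (λ _ → refl) (λ _ → refl) (λ _ _ → refl) (λ _ _ → refl)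

⊞-assoc : ∀ {u v w} {A : Mat u u} {B : Mat v v} {C : Mat w w} → A ⊞ (B ⊞ C) ≅ (A ⊞ B) ⊞ C
⊞-assoc = reindex
  (λ { (inj₁ i) → inj₁ (inj₁ i) ; (inj₂ (inj₁ i)) → inj₁ (inj₂ i) ; (inj₂ (inj₂ i)) → inj₂ i })
  (λ { (inj₁ (inj₁ i)) → inj₁ i ; (inj₁ (inj₂ i)) → inj₂ (inj₁ i) ; (inj₂ i) → inj₂ (inj₂ i) })
  (λ { (inj₁ i) → refl ; (inj₂ (inj₁ i)) → refl ; (inj₂ (inj₂ i)) → refl })
  (λ { (inj₁ (inj₁ i)) → refl ; (inj₁ (inj₂ i)) → refl ; (inj₂ i) → refl })
  (λ { (inj₁ i) (inj₁ (inj₁ j)) → refl ; (inj₁ i) (inj₁ (inj₂ j)) → refl ; (inj₁ i) (inj₂ j) → refl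
     ; (inj₂ (inj₁ i)) (inj₁ (inj₁ j)) → refl ; (inj₂ (inj₁ i)) (inj₁ (inj₂ j)) → refl ; (inj₂ (inj₁ i)) (inj₂ j) → refl
     ; (inj₂ (inj₂ i)) (inj₁ (inj₁ j)) → refl ; (inj₂ (inj₂ i)) (inj₁ (inj₂ j)) → refl ; (inj₂ (inj₂ i)) (inj₂ j) → refl })
  (λ { (inj₁ (inj₁ i)) (inj₁ (inj₁ j)) → refl ; (inj₁ (inj₁ i)) (inj₁ (inj₂ j)) → refl ; (inj₁ (inj₁ i)) (inj₂ j) → refl
     ; (inj₁ (inj₂ i)) (inj₁ (inj₁ j)) → refl ; (inj₁ (inj₂ i)) (inj₁ (inj₂ j)) → refl ; (inj₁ (inj₂ i)) (inj₂ j) → refl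
     ; (inj₂ i) (inj₁ (inj₁ j)) → refl ; (inj₂ i) (inj₁ (inj₂ j)) → refl ; (inj₂ i) (inj₂ j) → refl })

⊞-comm : ∀ {u v} {A : Mat u u} {B : Mat v v} → A ⊞ B ≅ B ⊞ A
⊞-comm = reindex
  (λ { (inj₁ i) → inj₂ i ; (inj₂ i) → inj₁ i })
  (λ { (inj₁ i) → inj₂ i ; (inj₂ i) → inj₁ i })
  (λ { (inj₁ i) → refl ; (inj₂ i) → refl })
  (λ { (inj₁ i) → refl ; (inj₂ i) → refl })
  (λ { (inj₁ i) (inj₁ j) → refl ; (inj₁ i) (inj₂ j) → refl ; (inj₂ i) (inj₁ j) → refl ; (inj₂ i) (inj₂ j) → refl })
  (λ { (inj₁ i) (inj₁ j) → refl ; (inj₁ i) (inj₂ j) → refl ; (inj₂ i) (inj₁ j) → refl ; (inj₂ i) (inj₂ j) → refl })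

infixl 7 _∙_
infixr 5 _⊞_
_∙_ : ∀ {u v} → ℤ → Mat u v → Mat u v
(c ∙ A) i j = c * A i j

≅-scale : ∀ {u v} {A : Mat u u} {B : Mat v v} c → A ≅ B → c ∙ A ≅ c ∙ B
to (≅-scale c φ) = to φ
from (≅-scale c φ) = from φ
PQ≃1 (isometry (≅-scale c φ) k) = PQ≃1 (isometry φ k)
QP≃1 (isometry (≅-scale c φ) k) = QP≃1 (isometry φ k)
gram (isometry (≅-scale {u} {v} {A} {B} c φ) k) i j =
  transᵐ (≡⇒≡ᵐ eq) (*-congˡᵐ c (gram (isometry φ k) i j))
  where
  open ≡-Reasoning
  P = at (to φ) k
  lem : ∀ p c a → p * (c * a) ≡ c * (p * a)
  lem = solve-∀
  eq : ∑ u (λ r → ∑ u (λ s → P s i * (c * A s r)) * P r j) ≡ c * ∑ u (λ r → ∑ u (λ s → P s i * A s r) * P r j)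
  eq = begin
    ∑ u (λ r → ∑ u (λ s → P s i * (c * A s r)) * P r j)
      ≡⟨ ∑-cong u (λ r → cong (_* P r j) (trans (∑-cong u (λ s → lem (P s i) c (A s r))) (∑-*ˡ u c _))) ⟩
    ∑ u (λ r → c * ∑ u (λ s → P s i * A s r) * P r j)
      ≡⟨ trans (∑-cong u (λ r → ℤₚ.*-assoc c (∑ u (λ s → P s i * A s r)) (P r j))) (∑-*ˡ u c _) ⟩
    c * ∑ u (λ r → ∑ u (λ s → P s i * A s r) * P r j) ∎

≅-≡ : ∀ {u} {A B : Mat u u} → (∀ i j → A i j ≡ B i j) → A ≅ B
≅-≡ e = reindex (λ i → i) (λ i → i) (λ _ → refl) (λ _ → refl) (λ _ _ → refl) e

-- Explicit isometries

-- Newton's iteration for the inverse square root of u = 1 - 8 m₀: if u y² = 1 - 8 c m, then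
-- y' = y (1 + 4 c m) satisfies u y'² = 1 - 16 c m' with m' = 3 c m² + 8 c² m³.
module InverseSquareRoot (m₀ : ℤ) where

  approx err : ℕ → ℤ
  approx zero    = + 1
  approx (suc k) = approx k * (+ 1 + + 4 * pow2ℕ k * err k)
  err zero    = m₀
  err (suc k) = + 3 * pow2ℕ k * err k * err k + + 8 * pow2ℕ k * pow2ℕ k * err k * err k * err k

  u : ℤ
  u = + 1 - + 8 * m₀

  approx-err : ∀ k → u * (approx k * approx k) ≡ + 1 - + 8 * pow2ℕ k * err k
  approx-err zero = lem m₀
    where
    lem : ∀ m → (+ 1 - + 8 * m) * (+ 1 * + 1) ≡ + 1 - + 8 * + 1 * m
    lem = solve-∀
  approx-err (suc k) = begin
    u * (y * f * (y * f))         ≡⟨ lem₁ u y f ⟩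
    u * (y * y) * (f * f)         ≡⟨ cong (_* (f * f)) (approx-err k) ⟩
    (+ 1 - + 8 * c * m) * (f * f) ≡⟨ lem₂ c m ⟩
    + 1 - + 8 * (+ 2 * c) * err (suc k) ≡⟨ cong (λ z → + 1 - + 8 * z * err (suc k)) (sym (pow2ℕ-suc k)) ⟩
    + 1 - + 8 * pow2ℕ (suc k) * err (suc k) ∎
    where
    open ≡-Reasoning
    c = pow2ℕ k
    y = approx k
    m = err k
    f = + 1 + + 4 * c * m
    lem₁ : ∀ u y f → u * (y * f * (y * f)) ≡ u * (y * y) * (f * f)
    lem₁ = solve-∀
    lem₂ : ∀ c m → (+ 1 - + 8 * c * m) * ((+ 1 + + 4 * c * m) * (+ 1 + + 4 * c * m)) ≡
      + 1 - + 8 * (+ 2 * c) * (+ 3 * c * m * m + + 8 * c * c * m * m * m)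
    lem₂ = solve-∀

  approx-coh : ∀ k → approx (suc k) ≡ approx k ⟦ pow2ℕ k ⟧
  approx-coh k = approx k * + 4 * err k by lem (approx k) (pow2ℕ k) (err k)
    where
    lem : ∀ y c m → y * (+ 1 + + 4 * c * m) ≡ y + y * + 4 * m * c
    lem = solve-∀

  approx-inverts : ∀ k → u * (approx k * approx k) ≡ + 1 ⟦ pow2ℕ k ⟧
  approx-inverts k = - (+ 8 * err k) by trans (approx-err k) (lem (pow2ℕ k) (err k))
    where
    lem : ∀ c m → + 1 - + 8 * c * m ≡ + 1 + (- (+ 8 * m)) * c
    lem = solve-∀

-- A 2-adic y with v w y² = 1.
record Unit (v w : ℤ) : Set where
  field
    root     : ℕ → ℤ
    root-coh : ∀ k → root (suc k) ≡ root k ⟦ pow2ℕ k ⟧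
    root-inv : ∀ k → v * w * (root k * root k) ≡ + 1 ⟦ pow2ℕ k ⟧
open Unit

unit : ∀ {v w} → v * w ≡ + 1 ⟦ + 8 ⟧ → Unit v w
unit {v} {w} (q by e) = record
  { root = approx ; root-coh = approx-coh
  ; root-inv = λ k → subst (λ u → u * (approx k * approx k) ≡ + 1 ⟦ pow2ℕ k ⟧) (trans (lem q) (sym e)) (approx-inverts k) }
  where
  open InverseSquareRoot (- q)
  lem : ∀ q → + 1 - + 8 * (- q) ≡ + 1 + q * + 8
  lem = solve-∀

⊡-scaleˡ : ∀ {u v w} c (A : Mat u v) (B : Mat v w) i j → ((c ∙ A) ⊡ B) i j ≡ c * (A ⊡ B) i j
⊡-scaleˡ {v = v} c A B i j = trans (∑-cong v (λ r → ℤₚ.*-assoc c (A i r) (B r j))) (∑-*ˡ v c _)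

⊡-scaleʳ : ∀ {u v w} c (A : Mat u v) (B : Mat v w) i j → (A ⊡ (c ∙ B)) i j ≡ c * (A ⊡ B) i j
⊡-scaleʳ {v = v} c A B i j = trans (∑-cong v (λ r → lem c (A i r) (B r j))) (∑-*ˡ v c _)
  where
  lem : ∀ c a b → a * (c * b) ≡ c * (a * b)
  lem = solve-∀

-- The square of an odd integer is 1 mod 8, so the determinant d is a 2-adic unit.
integral-≅ : ∀ {u v} {A : Mat u u} {B : Mat v v} (P : Mat u v) (Q : Mat v u) d →
  d * d ≡ + 1 ⟦ + 8 ⟧ →
  (∀ i j → (P ⊡ Q) i j ≡ (d ∙ δ u) i j) → (∀ i j → (Q ⊡ P) i j ≡ (d ∙ δ v) i j) →
  (∀ i j → (((P ᵀ) ⊡ A) ⊡ P) i j ≡ B i j) → A ≅ B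
integral-≅ {u} {v} {A} {B} P Q d odd PQ QP PAP = record
  { to = constᶠ P
  ; from = record
    { at = λ k → w k ∙ Q
    ; coh = λ k i j → *-congʳᵐ (*-congˡᵐ d (*-congᵐ (root-coh y k) (root-coh y k))) (Q i j) }
  ; isometry = λ k → record
    { PQ≃1 = λ i j → transᵐ (≡⇒≡ᵐ (trans (⊡-scaleʳ (w k) P Q i j) (cong (w k *_) (PQ i j)))) (inv k (δ u i j))
    ; QP≃1 = λ i j → transᵐ (≡⇒≡ᵐ (trans (⊡-scaleˡ (w k) Q P i j) (cong (w k *_) (QP i j)))) (inv k (δ v i j))
    ; gram = λ i j → ≡⇒≡ᵐ (PAP i j) } }
  where
  y = unit {d} {d} odd
  -- Since `d * d * root² ≡ 1`, the inverse of `d` is `d * root²`.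
  w : ℕ → ℤ
  w k = d * (root y k * root y k)
  lem : ∀ d y z → d * y * (d * z) ≡ d * d * y * z
  lem = solve-∀
  inv : ∀ k z → w k * (d * z) ≡ z ⟦ pow2ℕ k ⟧
  inv k z = transᵐ (≡⇒≡ᵐ (lem d (root y k * root y k) z)) (transᵐ (*-congʳᵐ (root-inv y k) z) (≡⇒≡ᵐ (ℤₚ.*-identityˡ z)))

-- If `v w y² = 1`, then the scalar `w y` satisfies `(w y)² v = w`, and its inverse is `v y`.
unit-scale-≅ : ∀ {u} {A : Mat u u} {v w} → v * w ≡ + 1 ⟦ + 8 ⟧ → v ∙ A ≅ w ∙ A
unit-scale-≅ {u} {A} {v} {w} vw = record
  { to = fam w ; from = fam v
  ; isometry = λ k → record
    { PQ≃1 = λ i j → inverse w v (lem₁ v w) k i j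
    ; QP≃1 = λ i j → inverse v w (lem₂ v w) k i j
    ; gram = λ i j → transᵐ (≡⇒≡ᵐ (gram-eq k i j)) (transᵐ (≡⇒≡ᵐ (lem₃ v w (root y k) (A i j))) (transᵐ (*-congʳᵐ (root-inv y k) (w * A i j)) (≡⇒≡ᵐ (ℤₚ.*-identityˡ _)))) } }
  where
  y = unit {v} {w} vw
  fam : ℤ → Fam u u
  fam c = record
    { at = λ k → (c * root y k) ∙ δ u
    ; coh = λ k i j → *-congʳᵐ (*-congˡᵐ c (root-coh y k)) (δ u i j) }
  lem₁ : ∀ v w r z → w * r * (v * r * z) ≡ v * w * (r * r) * z
  lem₁ = solve-∀
  lem₂ : ∀ v w r z → v * r * (w * r * z) ≡ v * w * (r * r) * z
  lem₂ = solve-∀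
  lem₃ : ∀ v w r a → w * r * (w * r * (v * a)) ≡ v * w * (r * r) * (w * a)
  lem₃ = solve-∀
  δδ : ∀ i j → (δ u ⊡ δ u) i j ≡ δ u i j
  δδ i j = ∑-δ u i (λ r → δ u r j)
  inverse : ∀ a b → (∀ r z → a * r * (b * r * z) ≡ v * w * (r * r) * z) → ∀ k →
    ((a * root y k) ∙ δ u) ⊡ ((b * root y k) ∙ δ u) ≃ δ u ⟦ pow2ℕ k ⟧
  inverse a b lem k i j = transᵐ
    (≡⇒≡ᵐ (trans (⊡-scaleˡ (a * root y k) (δ u) ((b * root y k) ∙ δ u) i j)
      (cong (a * root y k *_) (trans (⊡-scaleʳ (b * root y k) (δ u) (δ u) i j) (cong (b * root y k *_) (δδ i j))))))
    (transᵐ (≡⇒≡ᵐ (lem (root y k) (δ u i j)))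
      (transᵐ (*-congʳᵐ (root-inv y k) (δ u i j)) (≡⇒≡ᵐ (ℤₚ.*-identityˡ _))))
  gram-eq : ∀ k i j → (((((w * root y k) ∙ δ u) ᵀ) ⊡ (v ∙ A)) ⊡ ((w * root y k) ∙ δ u)) i j ≡ w * root y k * (w * root y k * (v * A i j))
  gram-eq k i j = begin
    (((c ∙ (δ u ᵀ)) ⊡ (v ∙ A)) ⊡ (c ∙ δ u)) i j ≡⟨ ⊡-scaleʳ c ((c ∙ (δ u ᵀ)) ⊡ (v ∙ A)) (δ u) i j ⟩
    c * (((c ∙ (δ u ᵀ)) ⊡ (v ∙ A)) ⊡ δ u) i j   ≡⟨ cong (c *_) (mod0 (⊡-identityʳ ((c ∙ (δ u ᵀ)) ⊡ (v ∙ A)) i j)) ⟩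
    c * ((c ∙ (δ u ᵀ)) ⊡ (v ∙ A)) i j           ≡⟨ cong (c *_) (⊡-scaleˡ c (δ u ᵀ) (v ∙ A) i j) ⟩
    c * (c * ((δ u ᵀ) ⊡ (v ∙ A)) i j)           ≡⟨ cong (λ z → c * (c * z)) (∑-cong u (λ r → cong (_* (v * A r j)) (δ-sym u r i))) ⟩
    c * (c * (δ u ⊡ (v ∙ A)) i j)               ≡⟨ cong (λ z → c * (c * z)) (mod0 (⊡-identityˡ (v ∙ A) i j)) ⟩
    c * (c * (v * A i j))                       ∎
    where
    open ≡-Reasoning
    c = w * root y k

-- Quantifiers over indices, signs and labels are decided, so that numerical matrix identities and
-- tables of residues hold by evaluation.
all-El? : ∀ u {P : El u → Set} → (∀ i → Dec (P i)) → Dec (∀ i → P i)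
all-El? 𝟘       P? = yes λ ()
all-El? 𝟙       P? = map′ (λ p _ → p) (λ f → f tt) (P? tt)
all-El? (u ⊕ v) P? = map′ (λ (p , q) → λ { (inj₁ i) → p i ; (inj₂ i) → q i }) (λ f → (λ i → f (inj₁ i)) , (λ i → f (inj₂ i)))
  (all-El? u (λ i → P? (inj₁ i)) ×-dec all-El? v (λ i → P? (inj₂ i)))

infix 4 _≐_ _≐?_ _≡_⟦8⟧?
_≐_ : ∀ {u v} → Mat u v → Mat u v → Set
A ≐ B = ∀ i j → A i j ≡ B i j

_≐?_ : ∀ {u v} (A B : Mat u v) → Dec (A ≐ B)
_≐?_ {u} {v} A B = all-El? u (λ i → all-El? v (λ j → A i j ℤ.≟ B i j))

_≡_⟦8⟧? : ∀ x y → Dec (x ≡ y ⟦ + 8 ⟧)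
x ≡ y ⟦8⟧? = map′ (∣⇒≡ᵐ ∘ ℤS.∣⇒∣ᵤ) (ℤS.∣ᵤ⇒∣ ∘ ≡ᵐ⇒∣) (+ 8 ℤS.∣? (x - y))

all-Sign? : {P : Sign → Set} → (∀ s → Dec (P s)) → Dec (∀ s → P s)
all-Sign? P? = map′ (λ (p , q) → λ { plus → p ; minus → q }) (λ f → f plus , f minus) (P? plus ×-dec P? minus)

all-Label? : {P : Label → Set} → (∀ l → Dec (P l)) → Dec (∀ l → P l)
all-Label? P? = map′ (λ (p , q) → λ { G → p ; R → q }) (λ f → f G , f R) (P? G ×-dec P? R)

uK : Kind → U
uK II    = 𝟙 ⊕ 𝟙
uK (I _) = 𝟙

⟨_⟩ : ℤ → Mat 𝟙 𝟙
⟨ a ⟩ _ _ = a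

⟪_,_,_⟫ : ℤ → ℤ → ℤ → Mat (𝟙 ⊕ 𝟙) (𝟙 ⊕ 𝟙)
⟪ a , b , c ⟫ (inj₁ _) (inj₁ _) = a
⟪ a , b , c ⟫ (inj₁ _) (inj₂ _) = b
⟪ a , b , c ⟫ (inj₂ _) (inj₁ _) = b
⟪ a , b , c ⟫ (inj₂ _) (inj₂ _) = c

value : Sign → Label → ℤ
value plus  G = + 1
value minus G = - + 3
value plus  R = - + 1
value minus R = + 3

hyp : Sign → Mat (𝟙 ⊕ 𝟙) (𝟙 ⊕ 𝟙)
hyp plus  = ⟪ + 0 , + 1 , + 0 ⟫
hyp minus = ⟪ + 2 , + 1 , + 2 ⟫

base : Sign → (k : Kind) → Mat (uK k) (uK k)
base s II    = hyp s
base s (I l) = ⟨ value s l ⟩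

⟨⟩-≅ : ∀ c {v w} → v * w ≡ + 1 ⟦ + 8 ⟧ → ⟨ c * v ⟩ ≅ ⟨ c * w ⟩
⟨⟩-≅ c {v} {w} e =
  ≅-trans (≅-≡ (λ _ _ → cong (c *_) (sym (ℤₚ.*-identityʳ v))))
  (≅-trans (≅-scale c (unit-scale-≅ {A = ⟨ + 1 ⟩} {v} {w} e)) (≅-≡ (λ _ _ → cong (c *_) (ℤₚ.*-identityʳ w))))

mat2 : ℤ → ℤ → ℤ → ℤ → Mat (𝟙 ⊕ 𝟙) (𝟙 ⊕ 𝟙)
mat2 a b c d (inj₁ _) (inj₁ _) = a
mat2 a b c d (inj₁ _) (inj₂ _) = b
mat2 a b c d (inj₂ _) (inj₁ _) = c
mat2 a b c d (inj₂ _) (inj₂ _) = d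

-- Witnesses that x + s y splits off ⟨ a' ⟩ ⊞ ⟨ c b' ⟩ from ⟨ a ⟩ ⊞ ⟨ c b ⟩.
BinaryMove : ℤ → ℤ → (a b a' b' : ℤ) → Set
BinaryMove c s a b a' b' =
  (d * d ≡ + 1 ⟦ + 8 ⟧) × (d * a' ≡ + 1 ⟦ + 8 ⟧) × (a * b * d * b' ≡ + 1 ⟦ + 8 ⟧)
  where d = a + c * b * (s * s)

binaryMove? : ∀ c s a b a' b' → Dec (BinaryMove c s a b a' b')
binaryMove? c s a b a' b' = (_ ≡ _ ⟦8⟧?) ×-dec ((_ ≡ _ ⟦8⟧?) ×-dec (_ ≡ _ ⟦8⟧?))

-- The complement of `x + s y` is spanned by `- c s b x + a y`, of norm `c a b d`. This change of
-- basis has determinant `d`, and the two norms matter only through their units mod 8, an odd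
-- residue being its own inverse there.
binary-≅ : ∀ c s a b {a' b'} → BinaryMove c s a b a' b' →
  ⟨ a ⟩ ⊞ ⟨ c * b ⟩ ≅ ⟨ a' ⟩ ⊞ ⟨ c * b' ⟩
binary-≅ c s a b {a'} {b'} (odd , ea , eb) = ≅-trans
  (integral-≅ {B = ⟨ d ⟩ ⊞ ⟨ c * (a * b * d) ⟩} (mat2 (+ 1) (- (c * s * b)) s a) (mat2 a (c * s * b) (- s) (+ 1)) d odd PQ QP gr)
  (≅-trans (≅-≡ (λ { (inj₁ _) (inj₁ _) → sym (ℤₚ.*-identityˡ d) ; (inj₁ _) (inj₂ _) → refl ; (inj₂ _) (inj₁ _) → refl ; (inj₂ _) (inj₂ _) → refl }))
  (≅-trans (⟨⟩-≅ (+ 1) {d} {a'} ea ⊞-≅ ⟨⟩-≅ c {a * b * d} {b'} eb)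
  (≅-≡ (λ { (inj₁ _) (inj₁ _) → ℤₚ.*-identityˡ a' ; (inj₁ _) (inj₂ _) → refl ; (inj₂ _) (inj₁ _) → refl ; (inj₂ _) (inj₂ _) → refl }))))
  where
  d = a + c * b * (s * s)
  l₁ : ∀ a b c s → + 1 * a + - (c * s * b) * - s ≡ (a + c * b * (s * s)) * + 1
  l₁ = solve-∀
  l₂ : ∀ a b c s → + 1 * (c * s * b) + - (c * s * b) * + 1 ≡ (a + c * b * (s * s)) * + 0
  l₂ = solve-∀
  l₃ : ∀ a b c s → s * a + a * - s ≡ (a + c * b * (s * s)) * + 0
  l₃ = solve-∀
  l₄ : ∀ a b c s → s * (c * s * b) + a * + 1 ≡ (a + c * b * (s * s)) * + 1
  l₄ = solve-∀
  r₁ : ∀ a b c s → a * + 1 + c * s * b * s ≡ (a + c * b * (s * s)) * + 1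
  r₁ = solve-∀
  r₂ : ∀ a b c s → a * - (c * s * b) + c * s * b * a ≡ (a + c * b * (s * s)) * + 0
  r₂ = solve-∀
  r₃ : ∀ a b c s → - s * + 1 + + 1 * s ≡ (a + c * b * (s * s)) * + 0
  r₃ = solve-∀
  r₄ : ∀ a b c s → - s * - (c * s * b) + + 1 * a ≡ (a + c * b * (s * s)) * + 1
  r₄ = solve-∀
  g₁ : ∀ a b c s → (+ 1 * a + s * + 0) * + 1 + (+ 1 * + 0 + s * (c * b)) * s ≡ a + c * b * (s * s)
  g₁ = solve-∀
  g₂ : ∀ a b c s → (+ 1 * a + s * + 0) * - (c * s * b) + (+ 1 * + 0 + s * (c * b)) * a ≡ + 0
  g₂ = solve-∀
  g₃ : ∀ a b c s → (- (c * s * b) * a + a * + 0) * + 1 + (- (c * s * b) * + 0 + a * (c * b)) * s ≡ + 0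
  g₃ = solve-∀
  g₄ : ∀ a b c s → (- (c * s * b) * a + a * + 0) * - (c * s * b) + (- (c * s * b) * + 0 + a * (c * b)) * a ≡ c * (a * b * (a + c * b * (s * s)))
  g₄ = solve-∀
  PQ : mat2 (+ 1) (- (c * s * b)) s a ⊡ mat2 a (c * s * b) (- s) (+ 1) ≐ d ∙ δ (𝟙 ⊕ 𝟙)
  PQ (inj₁ _) (inj₁ _) = l₁ a b c s
  PQ (inj₁ _) (inj₂ _) = l₂ a b c s
  PQ (inj₂ _) (inj₁ _) = l₃ a b c s
  PQ (inj₂ _) (inj₂ _) = l₄ a b c s
  QP : mat2 a (c * s * b) (- s) (+ 1) ⊡ mat2 (+ 1) (- (c * s * b)) s a ≐ d ∙ δ (𝟙 ⊕ 𝟙)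
  QP (inj₁ _) (inj₁ _) = r₁ a b c s
  QP (inj₁ _) (inj₂ _) = r₂ a b c s
  QP (inj₂ _) (inj₁ _) = r₃ a b c s
  QP (inj₂ _) (inj₂ _) = r₄ a b c s
  gr : ((mat2 (+ 1) (- (c * s * b)) s a ᵀ) ⊡ (⟨ a ⟩ ⊞ ⟨ c * b ⟩)) ⊡ mat2 (+ 1) (- (c * s * b)) s a ≐ ⟨ d ⟩ ⊞ ⟨ c * (a * b * d) ⟩
  gr (inj₁ _) (inj₁ _) = g₁ a b c s
  gr (inj₁ _) (inj₂ _) = g₂ a b c s
  gr (inj₂ _) (inj₁ _) = g₃ a b c s
  gr (inj₂ _) (inj₂ _) = g₄ a b c s

-- The vector `x + 2 y` has norm `a + 4 b ≡ a + 4` mod 8. Adding 4 exchanges 1 with -3 and -1 with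
-- 3, that is, it flips the sign and keeps the label.
walk0-≅ : ∀ s l s' l' → ⟨ value s l ⟩ ⊞ ⟨ + 1 * value s' l' ⟩ ≅ ⟨ value (flipS s) l ⟩ ⊞ ⟨ + 1 * value (flipS s') l' ⟩
walk0-≅ s l s' l' = binary-≅ (+ 1) (+ 2) (value s l) (value s' l') (moves s l s' l')
  where
  moves = from-yes (all-Sign? λ s → all-Label? λ l → all-Sign? λ s' → all-Label? λ l' →
    binaryMove? (+ 1) (+ 2) (value s l) (value s' l') (value (flipS s) l) (value (flipS s') l'))

-- Givers are the units 1 mod 4 and receivers the units 3 mod 4. So the norm `a + 2 b` is `a + 2`
-- mod 8 for two givers and `a - 2` for two receivers; either change flips both the label and the
-- sign of `a`.
walk2-≅ : ∀ s s' l → ⟨ value s l ⟩ ⊞ ⟨ + 2 * value s' l ⟩ ≅ ⟨ value (flipS s) (flipL l) ⟩ ⊞ ⟨ + 2 * value (flipS s') (flipL l) ⟩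
walk2-≅ s s' l = binary-≅ (+ 2) (+ 1) (value s l) (value s' l) (moves s s' l)
  where
  moves = from-yes (all-Sign? λ s → all-Sign? λ s' → all-Label? λ l →
    binaryMove? (+ 2) (+ 1) (value s l) (value s' l) (value (flipS s) (flipL l)) (value (flipS s') (flipL l)))

-- For opposite labels `a + 2 b` is `a - 2` mod 8 if `a` is a giver and `a + 2` if it is a receiver,
-- which changes the label but not the sign.
swap-≅ : ∀ s s' l → ⟨ value s l ⟩ ⊞ ⟨ + 2 * value s' (flipL l) ⟩ ≅ ⟨ value s (flipL l) ⟩ ⊞ ⟨ + 2 * value s' l ⟩
swap-≅ s s' l = binary-≅ (+ 2) (+ 1) (value s l) (value s' (flipL l)) (moves s s' l)
  where
  moves = from-yes (all-Sign? λ s → all-Sign? λ s' → all-Label? λ l →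
    binaryMove? (+ 2) (+ 1) (value s l) (value s' (flipL l)) (value s (flipL l)) (value s' l))

walk3-≅ : ∀ s l s' l' → ⟨ value s l ⟩ ⊞ ⟨ + 4 * value s' l' ⟩ ≅ ⟨ value (flipS s) l ⟩ ⊞ ⟨ + 4 * value (flipS s') l' ⟩
walk3-≅ s l s' l' = binary-≅ (+ 4) (+ 1) (value s l) (value s' l') (moves s l s' l')
  where
  moves = from-yes (all-Sign? λ s → all-Label? λ l → all-Sign? λ s' → all-Label? λ l' →
    binaryMove? (+ 4) (+ 1) (value s l) (value s' l') (value (flipS s) l) (value (flipS s') l'))

infixr 5 _▹_
_▹_ : ∀ {u v} {X : Set} → (El u → X) → (El v → X) → El (u ⊕ v) → X
f ▹ g = [ f , g ]

‵_ : {X : Set} → X → El 𝟙 → X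
(‵ x) _ = x

infix 6 ‵_

row2 : ℤ → ℤ → El (𝟙 ⊕ 𝟙) → ℤ
row2 a b = ‵ a ▹ ‵ b

row3 : ℤ → ℤ → ℤ → El (𝟙 ⊕ 𝟙 ⊕ 𝟙) → ℤ
row3 a b c = ‵ a ▹ ‵ b ▹ ‵ c

row4 : ℤ → ℤ → ℤ → ℤ → El (𝟙 ⊕ 𝟙 ⊕ 𝟙 ⊕ 𝟙) → ℤ
row4 a b c d = ‵ a ▹ ‵ b ▹ ‵ c ▹ ‵ d

row22 : ℤ → ℤ → ℤ → ℤ → El ((𝟙 ⊕ 𝟙) ⊕ 𝟙 ⊕ 𝟙) → ℤ
row22 a b c d = (‵ a ▹ ‵ b) ▹ ‵ c ▹ ‵ d

pattern e₁ = inj₁ tt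
pattern e₂ = inj₂ tt

mod8! : ∀ {x y} {t : True (x ≡ y ⟦8⟧?)} → x ≡ y ⟦ + 8 ⟧
mod8! {t = t} = toWitness t

decide-≅ : ∀ {u v} {A : Mat u u} {B : Mat v v} (P : Mat u v) (Q : Mat v u) d →
  {True (d * d ≡ + 1 ⟦8⟧?)} → {True (P ⊡ Q ≐? d ∙ δ u)} → {True (Q ⊡ P ≐? d ∙ δ v)} →
  {True (((P ᵀ) ⊡ A) ⊡ P ≐? B)} → A ≅ B
decide-≅ P Q d {odd} {PQ} {QP} {PAP} = integral-≅ P Q d (toWitness odd) (toWitness PQ) (toWitness QP) (toWitness PAP)

-- The norm form x² + x y + y² of hyp minus is multiplicative: multiplication by an element of norm n scales hyp minus by n.
norm3 : hyp minus ≅ + 3 ∙ hyp minus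
norm3 = decide-≅ (‵ row2 (+ 1) (- + 1) ▹ ‵ row2 (+ 1) (+ 2)) (‵ row2 (+ 2) (+ 1) ▹ ‵ row2 (- + 1) (+ 1)) (+ 3)
  

norm7 : hyp minus ≅ + 7 ∙ hyp minus
norm7 = decide-≅ (‵ row2 (+ 1) (- + 2) ▹ ‵ row2 (+ 2) (+ 3)) (‵ row2 (+ 3) (+ 2) ▹ ‵ row2 (- + 2) (+ 1)) (+ 7)
  

norm-1 : hyp minus ≅ - + 1 ∙ hyp minus
norm-1 = ≅-trans norm7 (unit-scale-≅ {v = + 7} {w = - + 1} mod8!)

∙-∙ : ∀ {u} c d (A : Mat u u) → (c * d) ∙ A ≐ c ∙ (d ∙ A)
∙-∙ c d A i j = ℤₚ.*-assoc c d (A i j)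

-- Splitting a new vector off `⟨ a ⟩` and a hyperbolic plane leaves `hyp minus` multiplied by `a`;
-- this isometry removes the factor.
unit∙hyp : ∀ s l → hyp minus ≅ value s l ∙ hyp minus
unit∙hyp plus  G = ≅-≡ (from-yes (hyp minus ≐? + 1 ∙ hyp minus))
unit∙hyp minus R = norm3
unit∙hyp plus  R = norm-1
unit∙hyp minus G = ≅-trans norm-1 (≅-trans (≅-scale (- + 1) norm3) (≅-≡ (from-yes (- + 1 ∙ (+ 3 ∙ hyp minus) ≐? value minus G ∙ hyp minus))))

-- In terms of hyperbolic pairs (f, g) and (f', g'), the columns are f + g, g + f' + g', f - g - g' and f' - g'.
type2-≅ : hyp plus ⊞ hyp plus ≅ hyp minus ⊞ hyp minus
type2-≅ = ≅-trans (decide-≅ {B = hyp minus ⊞ (- + 1 ∙ hyp minus)}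
    ((‵ row22 (+ 1) (+ 0) (+ 1) (+ 0) ▹ ‵ row22 (+ 1) (+ 1) (- + 1) (+ 0)) ▹ (‵ row22 (+ 0) (+ 1) (+ 0) (+ 1) ▹ ‵ row22 (+ 0) (+ 1) (- + 1) (- + 1)))
    ((‵ row22 (+ 1) (+ 2) (- + 1) (- + 1) ▹ ‵ row22 (+ 1) (- + 1) (+ 2) (+ 2)) ▹ (‵ row22 (+ 2) (- + 2) (+ 1) (+ 1) ▹ ‵ row22 (- + 1) (+ 1) (+ 1) (- + 2)))
    (+ 3))
  (≅-refl ⊞-≅ ≅-sym norm-1)

walk0-II-≅ : ∀ s s' → hyp s ⊞ hyp s' ≅ hyp (flipS s) ⊞ hyp (flipS s')
walk0-II-≅ plus  plus  = type2-≅
walk0-II-≅ minus minus = ≅-sym type2-≅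
walk0-II-≅ plus  minus = ⊞-comm
walk0-II-≅ minus plus  = ⊞-comm

all-value? : {P : ℤ → Set} → (∀ a → Dec (P a)) → Dec (∀ s l → P (value s l))
all-value? P? = all-Sign? λ s → all-Label? λ l → P? (value s l)

value-odd : ∀ s l → (+ 3 * value s l) * (+ 3 * value s l) ≡ + 1 ⟦ + 8 ⟧
value-odd = from-yes (all-value? λ a → (+ 3 * a) * (+ 3 * a) ≡ + 1 ⟦8⟧?)

-- The factor `-3 a` comes from the norm of the vector split off in the walks with a type II term.
-- It is `a + 4` mod 8.
flip-value : ∀ s l → (- + 3 * value s l) * value (flipS s) l ≡ + 1 ⟦ + 8 ⟧
flip-value = from-yes (all-Sign? λ s → all-Label? λ l → (- + 3 * value s l) * value (flipS s) l ≡ + 1 ⟦8⟧?)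

-- The columns of P are v = e + f - a g, 2 e + f and 2 e - a g, where e spans ⟨ a ⟩ and f, g are isotropic.
walkUp-+≅ : ∀ s l → ⟨ value s l ⟩ ⊞ + 2 ∙ hyp plus ≅ ⟨ value (flipS s) l ⟩ ⊞ + 2 ∙ hyp minus
walkUp-+≅ s l = ≅-trans
  (integral-≅ {A = A a} {B a} (P a) (Q a) (+ 3 * a) (value-odd s l)
    (from-yes (all-value? λ a → P a ⊡ Q a ≐? (+ 3 * a) ∙ δ (𝟙 ⊕ 𝟙 ⊕ 𝟙)) s l)
    (from-yes (all-value? λ a → Q a ⊡ P a ≐? (+ 3 * a) ∙ δ (𝟙 ⊕ 𝟙 ⊕ 𝟙)) s l)
    (from-yes (all-value? λ a → ((P a ᵀ) ⊡ A a) ⊡ P a ≐? B a) s l))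
  (≅-trans (⟨⟩-≅ (+ 1) {v = - + 3 * a} {w = value (flipS s) l} (flip-value s l)
      ⊞-≅ ≅-trans (≅-≡ (∙-∙ (+ 2) a (hyp minus))) (≅-scale (+ 2) (≅-sym (unit∙hyp s l))))
    (≅-≡ (λ _ _ → ℤₚ.*-identityˡ _) ⊞-≅ ≅-refl))
  where
  a = value s l
  P Q A B : ℤ → Mat (𝟙 ⊕ 𝟙 ⊕ 𝟙) (𝟙 ⊕ 𝟙 ⊕ 𝟙)
  P a = ‵ row3 (+ 1) (+ 2) (+ 2) ▹ ‵ row3 (+ 1) (+ 1) (+ 0) ▹ ‵ row3 (- a) (+ 0) (- a)
  Q a = ‵ row3 (- a) (+ 2 * a) (- + 2) ▹ ‵ row3 a a (+ 2) ▹ ‵ row3 a (- + 2 * a) (- + 1)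
  A a = ⟨ a ⟩ ⊞ + 2 ∙ hyp plus
  B a = ⟨ + 1 * (- + 3 * a) ⟩ ⊞ (+ 2 * a) ∙ hyp minus

-- The columns of P are v = e + 2 f - 2 a g, e + f and e - a g.
walkDown-+≅ : ∀ s l → ⟨ + 2 * value s l ⟩ ⊞ hyp plus ≅ ⟨ + 2 * value (flipS s) l ⟩ ⊞ hyp minus
walkDown-+≅ s l = ≅-trans
  (integral-≅ {A = A a} {B a} (P a) (Q a) (+ 3 * a) (value-odd s l)
    (from-yes (all-value? λ a → P a ⊡ Q a ≐? (+ 3 * a) ∙ δ (𝟙 ⊕ 𝟙 ⊕ 𝟙)) s l)
    (from-yes (all-value? λ a → Q a ⊡ P a ≐? (+ 3 * a) ∙ δ (𝟙 ⊕ 𝟙 ⊕ 𝟙)) s l)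
    (from-yes (all-value? λ a → ((P a ᵀ) ⊡ A a) ⊡ P a ≐? B a) s l))
  (⟨⟩-≅ (+ 2) {v = - + 3 * a} {w = value (flipS s) l} (flip-value s l) ⊞-≅ ≅-sym (unit∙hyp s l))
  where
  a = value s l
  P Q A B : ℤ → Mat (𝟙 ⊕ 𝟙 ⊕ 𝟙) (𝟙 ⊕ 𝟙 ⊕ 𝟙)
  P a = ‵ row3 (+ 1) (+ 1) (+ 1) ▹ ‵ row3 (+ 2) (+ 1) (+ 0) ▹ ‵ row3 (- + 2 * a) (+ 0) (- a)
  Q a = ‵ row3 (- a) a (- + 1) ▹ ‵ row3 (+ 2 * a) a (+ 2) ▹ ‵ row3 (+ 2 * a) (- + 2 * a) (- + 1)
  A a = ⟨ + 2 * a ⟩ ⊞ hyp plus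
  B a = ⟨ + 2 * (- + 3 * a) ⟩ ⊞ a ∙ hyp minus

flipS-involutive : ∀ s → flipS (flipS s) ≡ s
flipS-involutive plus  = refl
flipS-involutive minus = refl

walkUp-≅ : ∀ s l s' → ⟨ value s l ⟩ ⊞ + 2 ∙ hyp s' ≅ ⟨ value (flipS s) l ⟩ ⊞ + 2 ∙ hyp (flipS s')
walkUp-≅ s l plus  = walkUp-+≅ s l
walkUp-≅ s l minus = ≅-sym (subst (λ t → ⟨ value (flipS s) l ⟩ ⊞ + 2 ∙ hyp plus ≅ ⟨ value t l ⟩ ⊞ + 2 ∙ hyp minus) (flipS-involutive s) (walkUp-+≅ (flipS s) l))

walkDown-≅ : ∀ s l s' → ⟨ + 2 * value s l ⟩ ⊞ hyp s' ≅ ⟨ + 2 * value (flipS s) l ⟩ ⊞ hyp (flipS s')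
walkDown-≅ s l plus  = walkDown-+≅ s l
walkDown-≅ s l minus = ≅-sym (subst (λ t → ⟨ + 2 * value (flipS s) l ⟩ ⊞ hyp plus ≅ ⟨ + 2 * value t l ⟩ ⊞ hyp minus) (flipS-involutive s) (walkDown-+≅ (flipS s) l))

-- Left multiplication by the quaternion 1 + i + j + 2 k, of norm 7 ≡ -1 mod 8.
conv-+≅ : ⟨ + 1 ⟩ ⊞ ⟨ + 1 ⟩ ⊞ ⟨ + 1 ⟩ ⊞ ⟨ + 1 ⟩ ≅ ⟨ - + 1 ⟩ ⊞ ⟨ - + 1 ⟩ ⊞ ⟨ - + 1 ⟩ ⊞ ⟨ - + 1 ⟩
conv-+≅ = ≅-trans (decide-≅ {A = ⟨ + 1 ⟩ ⊞ ⟨ + 1 ⟩ ⊞ ⟨ + 1 ⟩ ⊞ ⟨ + 1 ⟩} {B = + 7 ∙ δ (𝟙 ⊕ 𝟙 ⊕ 𝟙 ⊕ 𝟙)}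
    (‵ row4 (+ 1) (+ 1) (+ 1) (+ 2) ▹ ‵ row4 (+ 1) (- + 1) (- + 2) (+ 1) ▹ ‵ row4 (+ 1) (+ 2) (- + 1) (- + 1) ▹ ‵ row4 (+ 2) (- + 1) (+ 1) (- + 1))
    (‵ row4 (+ 1) (+ 1) (+ 1) (+ 2) ▹ ‵ row4 (+ 1) (- + 1) (+ 2) (- + 1) ▹ ‵ row4 (+ 1) (- + 2) (- + 1) (+ 1) ▹ ‵ row4 (+ 2) (+ 1) (- + 1) (- + 1))
    (+ 7))
  (≅-trans (unit-scale-≅ {v = + 7} {w = - + 1} mod8!) (≅-≡ (from-yes (- + 1 ∙ δ (𝟙 ⊕ 𝟙 ⊕ 𝟙 ⊕ 𝟙) ≐? ⟨ - + 1 ⟩ ⊞ ⟨ - + 1 ⟩ ⊞ ⟨ - + 1 ⟩ ⊞ ⟨ - + 1 ⟩))))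

-- The columns of the first matrix are orthogonal vectors of norms -1, 3, 3, 3. The determinants -3
-- and -27 differ by the square of 3, so the change of basis has the unit determinant 3 up to sign.
conv--≅ : ⟨ + 1 ⟩ ⊞ ⟨ + 1 ⟩ ⊞ ⟨ + 1 ⟩ ⊞ ⟨ - + 3 ⟩ ≅ ⟨ - + 1 ⟩ ⊞ ⟨ + 3 ⟩ ⊞ ⟨ + 3 ⟩ ⊞ ⟨ + 3 ⟩
conv--≅ = decide-≅
  (‵ row4 (+ 0) (+ 1) (+ 1) (+ 1) ▹ ‵ row4 (+ 1) (- + 2) (+ 1) (+ 1) ▹ ‵ row4 (- + 1) (+ 1) (- + 2) (+ 1) ▹ ‵ row4 (- + 1) (+ 1) (- + 1) (+ 0))
  (‵ row4 (+ 0) (- + 3) (+ 3) (- + 9) ▹ ‵ row4 (+ 1) (- + 2) (+ 1) (- + 3) ▹ ‵ row4 (+ 1) (+ 1) (- + 2) (+ 3) ▹ ‵ row4 (+ 1) (+ 1) (+ 1) (+ 0))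
  (+ 3) 

-- Local moves

uS : FineSymbol → U
uS []      = 𝟘
uS (t ∷ S) = uK (kind t) ⊕ uS S

-- The exponent of the scale of t in the lattice scaled by 2^N (meaningful if scale t + N ≥ 0).
level : ℕ → Term → ℕ
level N t = ∣ scale t + + N ∣

gramT : ∀ N t → Mat (uK (kind t)) (uK (kind t))
gramT N t = pow2ℕ (level N t) ∙ base (sign t) (kind t)

gramS : ∀ N S → Mat (uS S) (uS S)
gramS N []      = λ ()
gramS N (t ∷ S) = gramT N t ⊞ gramS N S

NonNeg : ℕ → Term → Set
NonNeg N t = ∃[ n ] scale t + + N ≡ + n

_≅ˢ_⟦_⟧ : FineSymbol → FineSymbol → ℕ → Set
S ≅ˢ T ⟦ N ⟧ = gramS N S ≅ gramS N T

⊞-identityʳ : ∀ {u} {A : Mat u u} {E : Mat 𝟘 𝟘} → A ⊞ E ≅ A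
⊞-identityʳ = reindex (λ { (inj₁ i) → i }) inj₁ (λ { (inj₁ i) → refl }) (λ _ → refl)
  (λ { (inj₁ i) j → refl }) (λ _ _ → refl)

⊞-identityˡ : ∀ {u} {A : Mat u u} {E : Mat 𝟘 𝟘} → E ⊞ A ≅ A
⊞-identityˡ = reindex (λ { (inj₂ i) → i }) inj₂ (λ { (inj₂ i) → refl }) (λ _ → refl)
  (λ { (inj₂ i) j → refl }) (λ _ _ → refl)

gram-++ : ∀ N C S → gramS N (C ++ S) ≅ gramS N C ⊞ gramS N S
gram-++ N []      S = ≅-sym ⊞-identityˡ
gram-++ N (t ∷ C) S = ≅-trans (≅-refl ⊞-≅ gram-++ N C S) ⊞-assoc

gram-↭ : ∀ N {S T} → S ↭ T → S ≅ˢ T ⟦ N ⟧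
gram-↭ N Perm.refl         = ≅-refl
gram-↭ N (Perm.prep t p)   = ≅-refl ⊞-≅ gram-↭ N p
gram-↭ N (Perm.swap t u p) = ≅-trans ⊞-assoc (≅-trans (⊞-comm ⊞-≅ gram-↭ N p) (≅-sym ⊞-assoc))
gram-↭ N (Perm.trans p q)  = ≅-trans (gram-↭ N p) (gram-↭ N q)

-- These generate all operations in any context, without reference to compartments.
data Move : FineSymbol → FineSymbol → Set where
  walk-I   : ∀ e s l s' l' → Move (term e s (I l) ∷ term e s' (I l') ∷ []) (term e (flipS s) (I l) ∷ term e (flipS s') (I l') ∷ [])
  walk-II  : ∀ e s s' → Move (term e s II ∷ term e s' II ∷ []) (term e (flipS s) II ∷ term e (flipS s') II ∷ [])
  walk-I,II : ∀ e s l s' → Move (term e s (I l) ∷ term (e + + 1) s' II ∷ []) (term e (flipS s) (I l) ∷ term (e + + 1) (flipS s') II ∷ [])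
  walk-II,I : ∀ e s s' l → Move (term e s II ∷ term (e + + 1) s' (I l) ∷ []) (term e (flipS s) II ∷ term (e + + 1) (flipS s') (I l) ∷ [])
  walk-≡   : ∀ e s s' l → Move (term e s (I l) ∷ term (e + + 1) s' (I l) ∷ [])
                               (term e (flipS s) (I (flipL l)) ∷ term (e + + 1) (flipS s') (I (flipL l)) ∷ [])
  walk-4   : ∀ e s l s' l' → Move (term e s (I l) ∷ term (e + + 2) s' (I l') ∷ []) (term e (flipS s) (I l) ∷ term (e + + 2) (flipS s') (I l') ∷ [])
  exchange : ∀ e s s' l → Move (term e s (I l) ∷ term (e + + 1) s' (I (flipL l)) ∷ []) (term e s (I (flipL l)) ∷ term (e + + 1) s' (I l) ∷ [])
  -- By `walk-I` four signs at one scale matter only through their product, so one conversion for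
  -- each product suffices.
  convert+ : ∀ e → Move (term e plus (I G) ∷ term e plus (I G) ∷ term e plus (I G) ∷ term e plus (I G) ∷ [])
                        (term e plus (I R) ∷ term e plus (I R) ∷ term e plus (I R) ∷ term e plus (I R) ∷ [])
  convert- : ∀ e → Move (term e plus (I G) ∷ term e plus (I G) ∷ term e plus (I G) ∷ term e minus (I G) ∷ [])
                        (term e plus (I R) ∷ term e minus (I R) ∷ term e minus (I R) ∷ term e minus (I R) ∷ [])

infix 4 _∼_
-- Symmetry is built in, so inverse moves need no constructors and two symbols may be brought to a
-- common form from both sides.
data _∼_ : FineSymbol → FineSymbol → Set where
  perm   : ∀ {S T} → S ↭ T → S ∼ T
  move   : ∀ {C C'} → Move C C' → ∀ S → C ++ S ∼ C' ++ S
  ∼-sym  : ∀ {S T} → S ∼ T → T ∼ S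
  ∼-trans : ∀ {S T W} → S ∼ T → T ∼ W → S ∼ W

∙-⊞ : ∀ {u v} c (A : Mat u u) (B : Mat v v) → c ∙ (A ⊞ B) ≐ (c ∙ A) ⊞ (c ∙ B)
∙-⊞ c A B (inj₁ i) (inj₁ j) = refl
∙-⊞ c A B (inj₁ i) (inj₂ j) = ℤₚ.*-zeroʳ c
∙-⊞ c A B (inj₂ i) (inj₁ j) = ℤₚ.*-zeroʳ c
∙-⊞ c A B (inj₂ i) (inj₂ j) = refl

level-+ : ∀ N e d s k → NonNeg N (term e s k) → ∣ e + + d + + N ∣ ≡ ∣ e + + N ∣ ℕ.+ d
level-+ N e d s k (n , eq) = begin
  ∣ e + + d + + N ∣   ≡⟨ cong ∣_∣ (lem e (+ d) (+ N)) ⟩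
  ∣ e + + N + + d ∣   ≡⟨ cong (λ z → ∣ z + + d ∣) eq ⟩
  n ℕ.+ d             ≡⟨ cong (λ z → ∣ z ∣ ℕ.+ d) (sym eq) ⟩
  ∣ e + + N ∣ ℕ.+ d   ∎
  where
  open ≡-Reasoning
  lem : ∀ a b c → a + b + c ≡ a + c + b
  lem = solve-∀

-- Taking out the lower scale reduces a move on two terms to the scales 1 and `2^d`.
pair-≅ : ∀ N (t u t' u' : Term) d →
  level N u ≡ level N t ℕ.+ d → level N t' ≡ level N t → level N u' ≡ level N u →
  base (sign t) (kind t) ⊞ pow2ℕ d ∙ base (sign u) (kind u) ≅ base (sign t') (kind t') ⊞ pow2ℕ d ∙ base (sign u') (kind u') →
  (t ∷ u ∷ []) ≅ˢ (t' ∷ u' ∷ []) ⟦ N ⟧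
pair-≅ N t u t' u' d eu et' eu' φ =
  ≅-trans (expand t u eu)
    (≅-trans (≅-scale (pow2ℕ (level N t)) φ)
    (subst (λ n → pow2ℕ n ∙ (base (sign t') (kind t') ⊞ pow2ℕ d ∙ base (sign u') (kind u')) ≅ gramS N (t' ∷ u' ∷ [])) et'
      (≅-sym (expand t' u' (trans eu' (trans eu (cong (ℕ._+ d) (sym et'))))))))
  where
  expand : ∀ t u → level N u ≡ level N t ℕ.+ d → gramS N (t ∷ u ∷ []) ≅ pow2ℕ (level N t) ∙ (base (sign t) (kind t) ⊞ pow2ℕ d ∙ base (sign u) (kind u))
  expand t u eu = ≅-trans (≅-refl ⊞-≅ ≅-trans ⊞-identityʳ (≅-≡ λ i j → trans
      (cong (_* base (sign u) (kind u) i j) (trans (cong pow2ℕ eu) (pow2ℕ-+ (level N t) d)))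
      (∙-∙ (pow2ℕ (level N t)) (pow2ℕ d) (base (sign u) (kind u)) i j)))
    (≅-sym (≅-≡ (∙-⊞ (pow2ℕ (level N t)) (base (sign t) (kind t)) (pow2ℕ d ∙ base (sign u) (kind u)))))

quad-≅ : ∀ N e {s₁ s₂ s₃ s₄ l r₁ r₂ r₃ r₄ l'} →
  ⟨ value s₁ l ⟩ ⊞ ⟨ value s₂ l ⟩ ⊞ ⟨ value s₃ l ⟩ ⊞ ⟨ value s₄ l ⟩ ≅ ⟨ value r₁ l' ⟩ ⊞ ⟨ value r₂ l' ⟩ ⊞ ⟨ value r₃ l' ⟩ ⊞ ⟨ value r₄ l' ⟩ →
  (term e s₁ (I l) ∷ term e s₂ (I l) ∷ term e s₃ (I l) ∷ term e s₄ (I l) ∷ []) ≅ˢ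
  (term e r₁ (I l') ∷ term e r₂ (I l') ∷ term e r₃ (I l') ∷ term e r₄ (I l') ∷ []) ⟦ N ⟧
quad-≅ N e φ = ≅-trans (expand _ _ _ _) (≅-trans (≅-scale c φ) (≅-sym (expand _ _ _ _)))
  where
  c = pow2ℕ ∣ e + + N ∣
  expand : ∀ v₁ v₂ v₃ v₄ {E : Mat 𝟘 𝟘} → c ∙ ⟨ v₁ ⟩ ⊞ c ∙ ⟨ v₂ ⟩ ⊞ c ∙ ⟨ v₃ ⟩ ⊞ c ∙ ⟨ v₄ ⟩ ⊞ E ≅ c ∙ (⟨ v₁ ⟩ ⊞ ⟨ v₂ ⟩ ⊞ ⟨ v₃ ⟩ ⊞ ⟨ v₄ ⟩)
  expand v₁ v₂ v₃ v₄ = ≅-trans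
    (≅-refl ⊞-≅ ≅-trans (≅-refl ⊞-≅ ≅-trans (≅-refl ⊞-≅ ⊞-identityʳ)
      (≅-sym (≅-≡ (∙-⊞ c ⟨ v₃ ⟩ ⟨ v₄ ⟩)))) (≅-sym (≅-≡ (∙-⊞ c ⟨ v₂ ⟩ (⟨ v₃ ⟩ ⊞ ⟨ v₄ ⟩)))))
    (≅-sym (≅-≡ (∙-⊞ c ⟨ v₁ ⟩ (⟨ v₂ ⟩ ⊞ ⟨ v₃ ⟩ ⊞ ⟨ v₄ ⟩))))

1∙ : ∀ {u} {A : Mat u u} → A ≅ + 1 ∙ A
1∙ {A = A} = ≅-≡ (λ i j → sym (ℤₚ.*-identityˡ (A i j)))

move-≅ : ∀ N {C C'} → Move C C' → All (NonNeg N) C → C ≅ˢ C' ⟦ N ⟧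
move-≅ N (walk-I e s l s' l') (p ∷ _) = pair-≅ N (term e s (I l)) (term e s' (I l')) (term e (flipS s) (I l)) (term e (flipS s') (I l')) 0 (sym (ℕₚ.+-identityʳ _)) refl refl (walk0-≅ s l s' l')
move-≅ N (walk-II e s s') (p ∷ _) = pair-≅ N (term e s II) (term e s' II) (term e (flipS s) II) (term e (flipS s') II) 0 (sym (ℕₚ.+-identityʳ _)) refl refl
  (≅-trans (≅-refl ⊞-≅ ≅-sym 1∙) (≅-trans (walk0-II-≅ s s') (≅-refl ⊞-≅ 1∙)))
move-≅ N (walk-I,II e s l s') (p ∷ _) = pair-≅ N (term e s (I l)) (term (e + + 1) s' II) (term e (flipS s) (I l)) (term (e + + 1) (flipS s') II) 1 (level-+ N e 1 s (I l) p) refl refl (walkUp-≅ s l s')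
move-≅ N (walk-II,I e s s' l) (p ∷ _) = pair-≅ N (term e s II) (term (e + + 1) s' (I l)) (term e (flipS s) II) (term (e + + 1) (flipS s') (I l)) 1 (level-+ N e 1 s II p) refl refl
  (≅-trans ⊞-comm (≅-trans (walkDown-≅ s' l s) ⊞-comm))
move-≅ N (walk-≡ e s s' l) (p ∷ _) = pair-≅ N (term e s (I l)) (term (e + + 1) s' (I l)) (term e (flipS s) (I (flipL l))) (term (e + + 1) (flipS s') (I (flipL l))) 1 (level-+ N e 1 s (I l) p) refl refl (walk2-≅ s s' l)
move-≅ N (walk-4 e s l s' l') (p ∷ _) = pair-≅ N (term e s (I l)) (term (e + + 2) s' (I l')) (term e (flipS s) (I l)) (term (e + + 2) (flipS s') (I l')) 2 (level-+ N e 2 s (I l) p) refl refl (walk3-≅ s l s' l')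
move-≅ N (exchange e s s' l) (p ∷ _) = pair-≅ N (term e s (I l)) (term (e + + 1) s' (I (flipL l))) (term e s (I (flipL l))) (term (e + + 1) s' (I l)) 1 (level-+ N e 1 s (I l) p) refl refl (swap-≅ s s' l)
move-≅ N (convert+ e) _ = quad-≅ N e {plus} {plus} {plus} {plus} {G} {plus} {plus} {plus} {plus} {R} conv-+≅
move-≅ N (convert- e) _ = quad-≅ N e {plus} {plus} {plus} {minus} {G} {plus} {minus} {minus} {minus} {R} conv--≅

move-scale : ∀ {C C'} → Move C C' → Pointwise (λ t u → scale t ≡ scale u) C C'
move-scale (walk-I e s l s' l') = refl ∷ refl ∷ []
move-scale (walk-II e s s') = refl ∷ refl ∷ []
move-scale (walk-I,II e s l s') = refl ∷ refl ∷ []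
move-scale (walk-II,I e s s' l) = refl ∷ refl ∷ []
move-scale (walk-≡ e s s' l) = refl ∷ refl ∷ []
move-scale (walk-4 e s l s' l') = refl ∷ refl ∷ []
move-scale (exchange e s s' l) = refl ∷ refl ∷ []
move-scale (convert+ e) = refl ∷ refl ∷ refl ∷ refl ∷ []
move-scale (convert- e) = refl ∷ refl ∷ refl ∷ refl ∷ []

NonNeg-pointwise : ∀ {N S T} → Pointwise (λ t u → scale t ≡ scale u) S T → All (NonNeg N) S → All (NonNeg N) T
NonNeg-pointwise [] [] = []
NonNeg-pointwise {N} (e ∷ es) ((n , p) ∷ ps) = (n , trans (cong (_+ + N) (sym e)) p) ∷ NonNeg-pointwise es ps

∼-NonNeg : ∀ {N S T} → S ∼ T → (All (NonNeg N) S → All (NonNeg N) T) × (All (NonNeg N) T → All (NonNeg N) S)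
∼-NonNeg (perm p) = Permₚ.All-resp-↭ p , Permₚ.All-resp-↭ (↭-sym p)
∼-NonNeg (move {C} {C'} m S) =
  (λ ps → Allₚ.++⁺ (NonNeg-pointwise (move-scale m) (Allₚ.++⁻ˡ C ps)) (Allₚ.++⁻ʳ C ps)) ,
  (λ ps → Allₚ.++⁺ (NonNeg-pointwise (PW.symmetric sym (move-scale m)) (Allₚ.++⁻ˡ C' ps)) (Allₚ.++⁻ʳ C' ps))
∼-NonNeg (∼-sym p) = proj₂ (∼-NonNeg p) , proj₁ (∼-NonNeg p)
∼-NonNeg (∼-trans p q) = proj₁ (∼-NonNeg q) ∘ proj₁ (∼-NonNeg p) , proj₂ (∼-NonNeg p) ∘ proj₂ (∼-NonNeg q)

∼⇒≅ : ∀ {N S T} → S ∼ T → All (NonNeg N) S → S ≅ˢ T ⟦ N ⟧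
∼⇒≅ {N} (perm p) _ = gram-↭ N p
∼⇒≅ {N} (move {C} {C'} m S) ps = ≅-trans (gram-++ N C S) (≅-trans (move-≅ N m (Allₚ.++⁻ˡ C ps) ⊞-≅ ≅-refl) (≅-sym (gram-++ N C' S)))
∼⇒≅ (∼-sym p) ps = ≅-sym (∼⇒≅ p (proj₂ (∼-NonNeg p) ps))
∼⇒≅ (∼-trans p q) ps = ≅-trans (∼⇒≅ p ps) (∼⇒≅ q (proj₁ (∼-NonNeg p) ps))

-- From indices in Fin to blocks

sumFin-++ : ∀ m {n} (f : Fin (m ℕ.+ n) → ℤ) → sumFin f ≡ sumFin (λ i → f (i ↑ˡ n)) + sumFin (λ i → f (m ↑ʳ i))
sumFin-++ zero    f = sym (ℤₚ.+-identityˡ _)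
sumFin-++ (suc m) f = trans (cong (λ z → f zero + z) (sumFin-++ m (λ i → f (suc i)))) (sym (ℤₚ.+-assoc (f zero) _ _))

idMat-↑ˡ : ∀ {m} n (i j : Fin m) → idMat (i ↑ˡ n) (j ↑ˡ n) ≡ idMat i j
idMat-↑ˡ n zero    zero    = refl
idMat-↑ˡ n zero    (suc j) = refl
idMat-↑ˡ n (suc i) zero    = refl
idMat-↑ˡ n (suc i) (suc j) = idMat-↑ˡ n i j

idMat-↑ʳ : ∀ m {n} (i j : Fin n) → idMat (m ↑ʳ i) (m ↑ʳ j) ≡ idMat i j
idMat-↑ʳ zero    i j = refl
idMat-↑ʳ (suc m) i j = idMat-↑ʳ m i j

idMat-↑ˡʳ : ∀ {m n} (i : Fin m) (j : Fin n) → idMat (i ↑ˡ n) (m ↑ʳ j) ≡ + 0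
idMat-↑ˡʳ zero    j = refl
idMat-↑ˡʳ (suc i) j = idMat-↑ˡʳ i j

idMat-↑ʳˡ : ∀ {m n} (i : Fin m) (j : Fin n) → idMat (m ↑ʳ j) (i ↑ˡ n) ≡ + 0
idMat-↑ʳˡ zero    j = refl
idMat-↑ʳˡ (suc i) j = idMat-↑ʳˡ i j

-- The last two fields make matrix products and identity matrices correspond, so that isometries can
-- be transported in both directions.
record Enumeration (u : U) (n : ℕ) : Set where
  field
    index   : El u → Fin n
    element : Fin n → El u
    element-index : ∀ i → element (index i) ≡ i
    index-element : ∀ i → index (element i) ≡ i
    ∑-index : ∀ f → sumFin f ≡ ∑ u (f ∘ index)
    δ-index : ∀ i j → idMat (index i) (index j) ≡ δ u i j
open Enumeration

enum-𝟘 : Enumeration 𝟘 0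
enum-𝟘 = record { index = λ () ; element = λ () ; element-index = λ () ; index-element = λ () ; ∑-index = λ f → refl ; δ-index = λ () }

enum-𝟙 : Enumeration 𝟙 1
enum-𝟙 = record
  { index = λ _ → zero ; element = λ _ → tt ; element-index = λ _ → refl ; index-element = λ { zero → refl }
  ; ∑-index = λ f → ℤₚ.+-identityʳ (f zero) ; δ-index = λ _ _ → refl }

enum-⊕ : ∀ {u v m n} → Enumeration u m → Enumeration v n → Enumeration (u ⊕ v) (m ℕ.+ n)
enum-⊕ {u} {v} {m} {n} E F = record
  { index = ix ; element = el
  ; element-index = λ
    { (inj₁ i) → trans (cong tag (Finₚ.splitAt-↑ˡ m (index E i) n)) (cong inj₁ (element-index E i))
    ; (inj₂ i) → trans (cong tag (Finₚ.splitAt-↑ʳ m n (index F i))) (cong inj₂ (element-index F i)) }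
  ; index-element = ix-el
  ; ∑-index = λ f → trans (sumFin-++ m f) (cong₂ _+_ (∑-index E _) (∑-index F _))
  ; δ-index = λ
    { (inj₁ i) (inj₁ j) → trans (idMat-↑ˡ n (index E i) (index E j)) (δ-index E i j)
    ; (inj₁ i) (inj₂ j) → idMat-↑ˡʳ (index E i) _
    ; (inj₂ i) (inj₁ j) → idMat-↑ʳˡ (index E j) _
    ; (inj₂ i) (inj₂ j) → trans (idMat-↑ʳ m (index F i) (index F j)) (δ-index F i j) } }
  where
  ix : El (u ⊕ v) → Fin (m ℕ.+ n)
  ix (inj₁ i) = index E i ↑ˡ n
  ix (inj₂ i) = m ↑ʳ index F i
  tag : Fin m ⊎ Fin n → El (u ⊕ v)
  tag (inj₁ i) = inj₁ (element E i)
  tag (inj₂ i) = inj₂ (element F i)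
  el : Fin (m ℕ.+ n) → El (u ⊕ v)
  el k = tag (splitAt m k)
  ix-tag : ∀ s → ix (tag s) ≡ Fin.join m n s
  ix-tag (inj₁ i) = cong (_↑ˡ n) (index-element E i)
  ix-tag (inj₂ i) = cong (m ↑ʳ_) (index-element F i)
  ix-el : ∀ k → ix (el k) ≡ k
  ix-el k = trans (ix-tag (splitAt m k)) (Finₚ.join-splitAt m n k)

enumK : ∀ k → Enumeration (uK k) (rankK k)
enumK II    = enum-⊕ enum-𝟙 enum-𝟙
enumK (I l) = enum-𝟙

enumS : ∀ S → Enumeration (uS S) (rank S)
enumS []      = enum-𝟘
enumS (t ∷ S) = enum-⊕ (enumK (kind t)) (enumS S)

baseGram-index : ∀ s k i j → baseGram s k (index (enumK k) i) (index (enumK k) j) ≡ base s k i j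
baseGram-index plus  II (inj₁ _) (inj₁ _) = refl
baseGram-index plus  II (inj₁ _) (inj₂ _) = refl
baseGram-index plus  II (inj₂ _) (inj₁ _) = refl
baseGram-index plus  II (inj₂ _) (inj₂ _) = refl
baseGram-index minus II (inj₁ _) (inj₁ _) = refl
baseGram-index minus II (inj₁ _) (inj₂ _) = refl
baseGram-index minus II (inj₂ _) (inj₁ _) = refl
baseGram-index minus II (inj₂ _) (inj₂ _) = refl
baseGram-index plus  (I G) _ _ = refl
baseGram-index minus (I G) _ _ = refl
baseGram-index plus  (I R) _ _ = refl
baseGram-index minus (I R) _ _ = refl

blockDiag-ˡˡ : ∀ {m n} (A : IMat m m) (B : IMat n n) i j → blockDiag A B (i ↑ˡ n) (j ↑ˡ n) ≡ A i j
blockDiag-ˡˡ {m} {n} A B i j rewrite Finₚ.splitAt-↑ˡ m i n | Finₚ.splitAt-↑ˡ m j n = refl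

blockDiag-ˡʳ : ∀ {m n} (A : IMat m m) (B : IMat n n) i j → blockDiag A B (i ↑ˡ n) (m ↑ʳ j) ≡ + 0
blockDiag-ˡʳ {m} {n} A B i j rewrite Finₚ.splitAt-↑ˡ m i n | Finₚ.splitAt-↑ʳ m n j = refl

blockDiag-ʳˡ : ∀ {m n} (A : IMat m m) (B : IMat n n) i j → blockDiag A B (m ↑ʳ i) (j ↑ˡ n) ≡ + 0
blockDiag-ʳˡ {m} {n} A B i j rewrite Finₚ.splitAt-↑ʳ m n i | Finₚ.splitAt-↑ˡ m j n = refl

blockDiag-ʳʳ : ∀ {m n} (A : IMat m m) (B : IMat n n) i j → blockDiag A B (m ↑ʳ i) (m ↑ʳ j) ≡ B i j
blockDiag-ʳʳ {m} {n} A B i j rewrite Finₚ.splitAt-↑ʳ m n i | Finₚ.splitAt-↑ʳ m n j = refl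

pow2ℤ-level : ∀ N t → NonNeg N t → pow2ℤ (scale t + + N) ≡ pow2ℕ (level N t)
pow2ℤ-level N t (n , eq) = trans (cong pow2ℤ eq) (cong (pow2ℕ ∘ ∣_∣) (sym eq))

scaledBlock : ∀ N t → IMat (rankK (kind t)) (rankK (kind t))
scaledBlock N t i j = pow2ℤ (scale t + + N) * baseGram (sign t) (kind t) i j

scaledGram-index : ∀ N S → All (NonNeg N) S → ∀ i j → scaledGram N S (index (enumS S) i) (index (enumS S) j) ≡ gramS N S i j
scaledGram-index N (t ∷ S) (p ∷ ps) (inj₁ i) (inj₁ j) = trans (blockDiag-ˡˡ (scaledBlock N t) (scaledGram N S) (index (enumK (kind t)) i) (index (enumK (kind t)) j)) (cong₂ _*_ (pow2ℤ-level N t p) (baseGram-index (sign t) (kind t) i j))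
scaledGram-index N (t ∷ S) (p ∷ ps) (inj₁ i) (inj₂ j) = blockDiag-ˡʳ (scaledBlock N t) (scaledGram N S) (index (enumK (kind t)) i) (index (enumS S) j)
scaledGram-index N (t ∷ S) (p ∷ ps) (inj₂ i) (inj₁ j) = blockDiag-ʳˡ (scaledBlock N t) (scaledGram N S) (index (enumS S) i) (index (enumK (kind t)) j)
scaledGram-index N (t ∷ S) (p ∷ ps) (inj₂ i) (inj₂ j) = trans (blockDiag-ʳʳ (scaledBlock N t) (scaledGram N S) (index (enumS S) i) (index (enumS S) j)) (scaledGram-index N S ps i j)

module _ {u v m n} (E : Enumeration u m) (F : Enumeration v n) {A : IMat m m} {B : IMat n n} {A' : Mat u u} {B' : Mat v v}
  (A-index : ∀ i j → A (index E i) (index E j) ≡ A' i j) (B-index : ∀ i j → B (index F i) (index F j) ≡ B' i j) where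

  private
    f = index E
    g = index F

  fromIsometricGram : IsometricGram A B → A' ≅ B'
  fromIsometricGram (P , Q , iso) = record
    { to = record { at = λ k i j → seq (P (f i) (g j)) k ; coh = λ k i j → ∣⇒≡ᵐ (coh (P (f i) (g j)) k) }
    ; from = record { at = λ k i j → seq (Q (g i) (f j)) k ; coh = λ k i j → ∣⇒≡ᵐ (coh (Q (g i) (f j)) k) }
    ; isometry = λ k → record
      { PQ≃1 = λ i j → transᵐ (≡⇒≡ᵐ (sym (∑-index F (λ r → seq (P (f i) r) k * seq (Q r (f j)) k))))
          (transᵐ (∣⇒≡ᵐ (proj₁ (iso k) (f i) (f j))) (≡⇒≡ᵐ (δ-index E i j)))
      ; QP≃1 = λ i j → transᵐ (≡⇒≡ᵐ (sym (∑-index E (λ r → seq (Q (g i) r) k * seq (P r (g j)) k))))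
          (transᵐ (∣⇒≡ᵐ (proj₁ (proj₂ (iso k)) (g i) (g j))) (≡⇒≡ᵐ (δ-index F i j)))
      ; gram = λ i j → transᵐ (≡⇒≡ᵐ (sym (trans (∑-index E (λ r → sumFin (λ s → seq (P s (g i)) k * A s r) * seq (P r (g j)) k))
          (∑-cong u (λ r → cong (_* seq (P (f r) (g j)) k) (trans (∑-index E (λ s → seq (P s (g i)) k * A s (f r)))
            (∑-cong u (λ s → cong (seq (P (f s) (g i)) k *_) (A-index s r)))))))))
          (transᵐ (∣⇒≡ᵐ (proj₂ (proj₂ (iso k)) (g i) (g j))) (≡⇒≡ᵐ (B-index i j))) } }
    where open ℤ₂

  toIsometricGram : A' ≅ B' → IsometricGram A B
  toIsometricGram φ = P , Q , λ k →
    (λ i j → ≡ᵐ⇒∣ (transᵐ (≡⇒≡ᵐ (trans (∑-index F _) (∑-cong v (λ r → cong₂ (λ x y → at (to φ) k (a i) x * at (from φ) k y (a j)) (element-index F r) (element-index F r)))))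
      (transᵐ (PQ≃1 (isometry φ k) (a i) (a j)) (≡⇒≡ᵐ (δE i j))))) ,
    (λ i j → ≡ᵐ⇒∣ (transᵐ (≡⇒≡ᵐ (trans (∑-index E _) (∑-cong u (λ r → cong₂ (λ x y → at (from φ) k (b i) x * at (to φ) k y (b j)) (element-index E r) (element-index E r)))))
      (transᵐ (QP≃1 (isometry φ k) (b i) (b j)) (≡⇒≡ᵐ (δF i j))))) ,
    (λ i j → ≡ᵐ⇒∣ (transᵐ (≡⇒≡ᵐ (trans (∑-index E _) (∑-cong u (λ r → cong₂ _*_
        (trans (∑-index E _) (∑-cong u (λ s → cong₂ (λ x y → at (to φ) k x (b i) * y) (element-index E s) (A-index s r))))
        (cong (λ x → at (to φ) k x (b j)) (element-index E r))))))
      (transᵐ (gram (isometry φ k) (b i) (b j)) (≡⇒≡ᵐ (trans (sym (B-index (b i) (b j))) (cong₂ B (index-element F i) (index-element F j)))))))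
    where
    a = element E
    b = element F
    δE : ∀ i j → δ u (a i) (a j) ≡ idMat i j
    δE i j = trans (sym (δ-index E (a i) (a j))) (cong₂ idMat (index-element E i) (index-element E j))
    δF : ∀ i j → δ v (b i) (b j) ≡ idMat i j
    δF i j = trans (sym (δ-index F (b i) (b j))) (cong₂ idMat (index-element F i) (index-element F j))
    P : Mat₂ m n
    P i j = record { seq = λ k → at (to φ) k (a i) (b j) ; coh = λ k → ≡ᵐ⇒∣ (coh (to φ) k (a i) (b j)) }
    Q : Mat₂ n m
    Q i j = record { seq = λ k → at (from φ) k (b i) (a j) ; coh = λ k → ≡ᵐ⇒∣ (coh (from φ) k (b i) (a j)) }

negPart-+ : ∀ z N → negPart z ℕ.≤ N → ∃[ n ] z + + N ≡ + n
negPart-+ (+ k)    N p = k ℕ.+ N , refl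
negPart-+ -[1+ k ] N p = N ℕ.∸ suc k , ℤₚ.⊖-≥ p

shift-NonNeg : ∀ N S → shift S ℕ.≤ N → All (NonNeg N) S
shift-NonNeg N []      p = []
shift-NonNeg N (t ∷ S) p = negPart-+ (scale t) N (ℕₚ.≤-trans (ℕₚ.m≤m⊔n _ _) p) ∷ shift-NonNeg N S (ℕₚ.≤-trans (ℕₚ.m≤n⊔m (negPart (scale t)) _) p)

commonShift : FineSymbol → FineSymbol → ℕ
commonShift S T = shift S ℕ.⊔ shift T

commonShift-NonNeg : ∀ S T → All (NonNeg (commonShift S T)) S × All (NonNeg (commonShift S T)) T
commonShift-NonNeg S T = shift-NonNeg _ S (ℕₚ.m≤m⊔n (shift S) (shift T)) , shift-NonNeg _ T (ℕₚ.m≤n⊔m (shift S) (shift T))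

Isometric⇒≅ : ∀ S T → Isometric S T → S ≅ˢ T ⟦ commonShift S T ⟧
Isometric⇒≅ S T = fromIsometricGram (enumS S) (enumS T)
  (scaledGram-index _ S (proj₁ (commonShift-NonNeg S T))) (scaledGram-index _ T (proj₂ (commonShift-NonNeg S T)))

≅⇒Isometric : ∀ S T → S ≅ˢ T ⟦ commonShift S T ⟧ → Isometric S T
≅⇒Isometric S T = toIsometricGram (enumS S) (enumS T)
  (scaledGram-index _ S (proj₁ (commonShift-NonNeg S T))) (scaledGram-index _ T (proj₂ (commonShift-NonNeg S T)))

-- Sums over residue vectors

infix 4 _≡_⟦_⟧? _≈_⟦_⟧?
infixr 7 _⊛_

range : ℕ → (ℤ → ℤ) → ℤ
range zero    f = + 0
range (suc n) f = range n f + f (+ n)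

range-cong : ∀ {m} n {f g} → (∀ x → f x ≡ g x ⟦ m ⟧) → range n f ≡ range n g ⟦ m ⟧
range-cong zero    e = reflᵐ
range-cong (suc n) e = +-congᵐ (range-cong n e) (e (+ n))

range-+ : ∀ n f g → range n (λ x → f x + g x) ≡ range n f + range n g
range-+ zero    f g = refl
range-+ (suc n) f g = trans (cong (_+ (f (+ n) + g (+ n))) (range-+ n f g)) (lem (range n f) (range n g) (f (+ n)) (g (+ n)))
  where
  lem : ∀ a b c d → (a + b) + (c + d) ≡ (a + c) + (b + d)
  lem = solve-∀

range-*ˡ : ∀ n c f → range n (λ x → c * f x) ≡ c * range n f
range-*ˡ zero    c f = sym (ℤₚ.*-zeroʳ c)
range-*ˡ (suc n) c f = trans (cong (_+ c * f (+ n)) (range-*ˡ n c f)) (sym (ℤₚ.*-distribˡ-+ c (range n f) (f (+ n))))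

range-const : ∀ n c → range n (λ _ → c) ≡ + n * c
range-const zero    c = refl
range-const (suc n) c = trans (cong (_+ c) (range-const n c)) (lem (+ n) c)
  where
  lem : ∀ n c → n * c + c ≡ (+ 1 + n) * c
  lem = solve-∀

range-zero : ∀ n → range n (λ _ → + 0) ≡ + 0
range-zero n = trans (range-const n (+ 0)) (ℤₚ.*-zeroʳ (+ n))

range-++ : ∀ a b f → range (a ℕ.+ b) f ≡ range a f + range b (λ x → f (+ a + x))
range-++ a zero    f = trans (cong (λ n → range n f) (ℕₚ.+-identityʳ a)) (sym (ℤₚ.+-identityʳ (range a f)))
range-++ a (suc b) f = begin
  range (a ℕ.+ suc b) f                        ≡⟨ cong (λ n → range n f) (ℕₚ.+-suc a b) ⟩
  range (a ℕ.+ b) f + f (+ (a ℕ.+ b))          ≡⟨ cong (_+ f (+ (a ℕ.+ b))) (range-++ a b f) ⟩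
  range a f + range b g + g (+ b)              ≡⟨ ℤₚ.+-assoc (range a f) (range b g) (g (+ b)) ⟩
  range a f + (range b g + g (+ b))            ∎
  where
  open ≡-Reasoning
  g : ℤ → ℤ
  g x = f (+ a + x)

Periodic : ℤ → ℕ → (ℤ → ℤ) → Set
Periodic m M f = ∀ {x y} → x ≡ y ⟦ + M ⟧ → f x ≡ f y ⟦ m ⟧

≡ᵐ-+M : ∀ x M → x ≡ x + M ⟦ M ⟧
≡ᵐ-+M x M = - + 1 by lem x M
  where
  lem : ∀ x M → x ≡ (x + M) + - + 1 * M
  lem = solve-∀

+-shiftᵐ : ∀ {x y m} z → x ≡ y ⟦ m ⟧ → x + z ≡ y + z ⟦ m ⟧
+-shiftᵐ z e = +-congᵐ e (reflᵐ {z})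

-- Both sums arise from the sum over `suc n` consecutive integers by removing an end, and
-- periodicity identifies the two end values.
range-shift-1 : ∀ {m} n f → Periodic m n f → range n (λ x → f (+ 1 + x)) ≡ range n f ⟦ m ⟧
range-shift-1 {m} n f p = transᵐ
  (≡⇒≡ᵐ (trans (lem₁ (range n (λ x → f (+ 1 + x))) (f (+ 0))) (cong (_- f (+ 0)) (trans (sym (range-++ 1 n f)) refl))))
  (transᵐ (+-shiftᵐ (- f (+ 0)) (+-congᵐ (reflᵐ {range n f}) (symᵐ (p (transᵐ (≡ᵐ-+M (+ 0) (+ n)) (≡⇒≡ᵐ (ℤₚ.+-identityˡ (+ n))))))))
    (≡⇒≡ᵐ (lem₂ (range n f) (f (+ 0)))))
  where
  lem₁ : ∀ a b → a ≡ (+ 0 + b + a) - b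
  lem₁ = solve-∀
  lem₂ : ∀ a b → (a + b) - b ≡ a
  lem₂ = solve-∀

range-shift-ℕ : ∀ {m} n f k → Periodic m n f → range n (λ x → f (x + + k)) ≡ range n f ⟦ m ⟧
range-shift-ℕ n f zero    p = range-cong n (λ x → p (≡⇒≡ᵐ (ℤₚ.+-identityʳ x)))
range-shift-ℕ n f (suc k) p = transᵐ (range-cong n (λ x → p (≡⇒≡ᵐ (lem x (+ k)))))
  (transᵐ (range-shift-1 n (λ x → f (x + + k)) (λ e → p (+-shiftᵐ (+ k) e))) (range-shift-ℕ n f k p))
  where
  lem : ∀ x k → x + (+ 1 + k) ≡ + 1 + x + k
  lem = solve-∀

range-shift : ∀ {m} n f z → Periodic m n f → range n (λ x → f (x + z)) ≡ range n f ⟦ m ⟧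
range-shift n f (+ k)    p = range-shift-ℕ n f k p
range-shift n f -[1+ k ] p = symᵐ (transᵐ
  (range-cong n (λ x → p (≡⇒≡ᵐ (lem x (+ suc k)))))
  (range-shift-ℕ n (λ x → f (x + -[1+ k ])) (suc k) (λ e → p (+-shiftᵐ -[1+ k ] e))))
  where
  lem : ∀ x k → x ≡ x + k + - k
  lem = solve-∀

ind : {P : Set} → Dec P → ℤ
ind d = if does d then + 1 else + 0

ind-yes : {P : Set} (d : Dec P) → P → ind d ≡ + 1
ind-yes (yes _) p = refl
ind-yes (no ¬p) p = ⊥-elim (¬p p)

ind-no : {P : Set} (d : Dec P) → ¬ P → ind d ≡ + 0
ind-no (yes p) ¬p = ⊥-elim (¬p p)
ind-no (no _)  ¬p = refl

ind-⇔ : {P Q : Set} (d : Dec P) (e : Dec Q) → (P → Q) → (Q → P) → ind d ≡ ind e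
ind-⇔ (yes p) e f g = sym (ind-yes e (f p))
ind-⇔ (no ¬p) e f g = sym (ind-no e (¬p ∘ g))

ind-× : {P Q : Set} (d : Dec P) (e : Dec Q) → ind (d ×-dec e) ≡ ind d * ind e
ind-× (yes p) (yes q) = refl
ind-× (yes p) (no q)  = refl
ind-× (no p)  (yes q) = refl
ind-× (no p)  (no q)  = refl

_≡_⟦_⟧? : ∀ x y m → Dec (x ≡ y ⟦ m ⟧)
x ≡ y ⟦ m ⟧? = map′ (∣⇒≡ᵐ ∘ ℤS.∣⇒∣ᵤ) (ℤS.∣ᵤ⇒∣ ∘ ≡ᵐ⇒∣) (m ℤS.∣? (x - y))

-- x - z runs through all residues, and only the residue 0 contributes.
range-δ : ∀ {m} M f z → Periodic m (suc M) f → range (suc M) (λ x → ind (x ≡ z ⟦ + suc M ⟧?) * f x) ≡ f z ⟦ m ⟧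
range-δ {m} M f z p = transᵐ (symᵐ (range-shift (suc M) g z g-periodic))
  (transᵐ (≡⇒≡ᵐ (range-++ 1 M (λ x → g (x + z))))
  (transᵐ (+-congᵐ head (tail M ℕₚ.≤-refl)) (≡⇒≡ᵐ (ℤₚ.+-identityʳ (f z)))))
  where
  g : ℤ → ℤ
  g x = ind (x ≡ z ⟦ + suc M ⟧?) * f x
  g-periodic : Periodic m (suc M) g
  g-periodic {x} {y} e = *-congᵐ (≡⇒≡ᵐ (ind-⇔ (x ≡ z ⟦ + suc M ⟧?) (y ≡ z ⟦ + suc M ⟧?) (transᵐ (symᵐ e)) (transᵐ e))) (p e)
  head : + 0 + g (+ 0 + z) ≡ f z ⟦ m ⟧
  head = transᵐ (≡⇒≡ᵐ (trans (ℤₚ.+-identityˡ _) (cong g (ℤₚ.+-identityˡ z))))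
    (≡⇒≡ᵐ (trans (cong (_* f z) (ind-yes (z ≡ z ⟦ + suc M ⟧?) reflᵐ)) (ℤₚ.*-identityˡ (f z))))
  far : ∀ k → k ℕ.< M → ¬ (+ 1 + + k + z ≡ z ⟦ + suc M ⟧)
  far k k<M e = ℕₚ.<⇒≱ (ℕ.s<s k<M) (ℕD.∣⇒≤ (subst (λ w → suc M ℕD.∣ ∣ w ∣) (lem (+ suc k) z) (≡ᵐ⇒∣ e)))
    where
    lem : ∀ k z → k + z - z ≡ k
    lem = solve-∀
  tail : ∀ k → k ℕ.≤ M → range k (λ x → g (+ 1 + x + z)) ≡ + 0 ⟦ m ⟧
  tail zero    _   = reflᵐ
  tail (suc k) k<M = +-congᵐ (tail k (ℕₚ.<⇒≤ k<M))
    (≡⇒≡ᵐ (trans (cong (_* f (+ 1 + + k + z)) (ind-no ((+ 1 + + k + z) ≡ z ⟦ + suc M ⟧?) (far k k<M))) refl))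

Vector : U → Set
Vector u = El u → ℤ

vectors : ∀ (M : ℕ) u → (Vector u → ℤ) → ℤ
vectors M 𝟘       F = F (λ ())
vectors M 𝟙       F = range M (λ x → F (λ _ → x))
vectors M (u ⊕ v) F = vectors M u (λ x → vectors M v (λ y → F [ x , y ]))

vectors-cong : ∀ {m} M u {F H : Vector u → ℤ} → (∀ x → F x ≡ H x ⟦ m ⟧) → vectors M u F ≡ vectors M u H ⟦ m ⟧
vectors-cong M 𝟘       e = e _
vectors-cong M 𝟙       e = range-cong M (λ x → e _)
vectors-cong M (u ⊕ v) e = vectors-cong M u (λ x → vectors-cong M v (λ y → e _))

vectors-+ : ∀ {m} M u (F H : Vector u → ℤ) → vectors M u (λ x → F x + H x) ≡ vectors M u F + vectors M u H ⟦ m ⟧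
vectors-+ M 𝟘       F H = reflᵐ
vectors-+ M 𝟙       F H = ≡⇒≡ᵐ (range-+ M _ _)
vectors-+ M (u ⊕ v) F H = transᵐ (vectors-cong M u (λ x → vectors-+ M v _ _)) (vectors-+ M u _ _)

vectors-*ˡ : ∀ {m} M u c (F : Vector u → ℤ) → vectors M u (λ x → c * F x) ≡ c * vectors M u F ⟦ m ⟧
vectors-*ˡ M 𝟘       c F = reflᵐ
vectors-*ˡ M 𝟙       c F = ≡⇒≡ᵐ (range-*ˡ M c _)
vectors-*ˡ M (u ⊕ v) c F = transᵐ (vectors-cong M u (λ x → vectors-*ˡ M v c _)) (vectors-*ˡ M u c _)

vectors-*ʳ : ∀ {m} M u (F : Vector u → ℤ) c → vectors M u (λ x → F x * c) ≡ vectors M u F * c ⟦ m ⟧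
vectors-*ʳ M u F c = transᵐ (vectors-cong M u (λ x → ≡⇒≡ᵐ (ℤₚ.*-comm (F x) c)))
  (transᵐ (vectors-*ˡ M u c F) (≡⇒≡ᵐ (ℤₚ.*-comm c (vectors M u F))))

vectors-zero : ∀ {m} M u → vectors M u (λ _ → + 0) ≡ + 0 ⟦ m ⟧
vectors-zero M 𝟘       = reflᵐ
vectors-zero M 𝟙       = ≡⇒≡ᵐ (range-zero M)
vectors-zero M (u ⊕ v) = transᵐ (vectors-cong M u (λ x → vectors-zero M v)) (vectors-zero M u)

range-vectors : ∀ {m} M n v (F : ℤ → Vector v → ℤ) →
  range n (λ x → vectors M v (F x)) ≡ vectors M v (λ y → range n (λ x → F x y)) ⟦ m ⟧
range-vectors M zero    v F = symᵐ (vectors-zero M v)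
range-vectors M (suc n) v F = transᵐ (+-congᵐ (range-vectors M n v F) reflᵐ) (symᵐ (vectors-+ M v _ _))

vectors-swap : ∀ {m} M u v (F : Vector u → Vector v → ℤ) →
  vectors M u (λ x → vectors M v (F x)) ≡ vectors M v (λ y → vectors M u (λ x → F x y)) ⟦ m ⟧
vectors-swap M 𝟘       v F = reflᵐ
vectors-swap M 𝟙       v F = range-vectors M M v (λ x → F (λ _ → x))
vectors-swap M (u ⊕ w) v F = transᵐ (vectors-cong M u (λ x → vectors-swap M w v (λ y → F [ x , y ]))) (vectors-swap M u v _)

vectors-⊕ : ∀ {m} M u v (F : Vector u → ℤ) (H : Vector v → ℤ) →
  vectors M (u ⊕ v) (λ z → F (z ∘ inj₁) * H (z ∘ inj₂)) ≡ vectors M u F * vectors M v H ⟦ m ⟧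
vectors-⊕ M u v F H = transᵐ (vectors-cong M u (λ x → vectors-*ˡ M v (F x) H)) (vectors-*ʳ M u F (vectors M v H))

infix 4 _≈_⟦_⟧
_≈_⟦_⟧ : ∀ {u} → Vector u → Vector u → ℤ → Set
x ≈ y ⟦ m ⟧ = ∀ i → x i ≡ y i ⟦ m ⟧

_≈_⟦_⟧? : ∀ {u} (x y : Vector u) m → Dec (x ≈ y ⟦ m ⟧)
_≈_⟦_⟧? {u} x y m = all-El? u (λ i → x i ≡ y i ⟦ m ⟧?)

-- Vectors are functions, so this condition also serves to replace a vector by a pointwise equal one
-- in the absence of extensionality.
PeriodicV : ∀ {u} → ℤ → ℕ → (Vector u → ℤ) → Set
PeriodicV m M F = ∀ {x y} → x ≈ y ⟦ + M ⟧ → F x ≡ F y ⟦ m ⟧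

vectors-δ : ∀ {m} M u (F : Vector u → ℤ) z → PeriodicV m (suc M) F →
  vectors (suc M) u (λ x → ind (x ≈ z ⟦ + suc M ⟧?) * F x) ≡ F z ⟦ m ⟧
vectors-δ M 𝟘       F z p = transᵐ (≡⇒≡ᵐ (ℤₚ.*-identityˡ (F (λ ())))) (p (λ ()))
vectors-δ M 𝟙       F z p = transᵐ (range-δ M (λ x → F (λ _ → x)) (z tt) (λ e → p (λ _ → e))) (p (λ _ → reflᵐ))
vectors-δ {m} M (u ⊕ v) F z p = transᵐ
  (vectors-cong (suc M) u (λ x → transᵐ
    (vectors-cong (suc M) v (λ y → ≡⇒≡ᵐ (split x y)))
    (transᵐ (vectors-*ˡ (suc M) v (ind (x ≈ z ∘ inj₁ ⟦ + suc M ⟧?)) _) (*-congˡᵐ (ind (x ≈ z ∘ inj₁ ⟦ + suc M ⟧?))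
      (vectors-δ M v (λ y → F [ x , y ]) (z ∘ inj₂) (λ e → p λ { (inj₁ i) → reflᵐ ; (inj₂ i) → e i }))))))
  (transᵐ (vectors-δ M u (λ x → F [ x , z ∘ inj₂ ]) (z ∘ inj₁) (λ e → p λ { (inj₁ i) → e i ; (inj₂ i) → reflᵐ }))
    (p λ { (inj₁ i) → reflᵐ ; (inj₂ i) → reflᵐ }))
  where
  split : ∀ x y → ind ([ x , y ] ≈ z ⟦ + suc M ⟧?) * F [ x , y ] ≡
    ind (x ≈ z ∘ inj₁ ⟦ + suc M ⟧?) * (ind (y ≈ z ∘ inj₂ ⟦ + suc M ⟧?) * F [ x , y ])
  split x y = trans (cong (_* F [ x , y ]) (ind-× (x ≈ z ∘ inj₁ ⟦ + suc M ⟧?) (y ≈ z ∘ inj₂ ⟦ + suc M ⟧?)))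
    (ℤₚ.*-assoc (ind (x ≈ z ∘ inj₁ ⟦ + suc M ⟧?)) (ind (y ≈ z ∘ inj₂ ⟦ + suc M ⟧?)) (F [ x , y ]))

_⊛_ : ∀ {u v} → Mat u v → Vector v → Vector u
_⊛_ {v = v} A x i = ∑ v (λ j → A i j * x j)

column : ∀ {u} → Vector u → Mat u 𝟙
column x i _ = x i

⊛-inverse : ∀ {u v m} {P : Mat u v} {Q : Mat v u} {x y} → Q ⊡ P ≃ δ v ⟦ m ⟧ →
  x ≈ P ⊛ y ⟦ m ⟧ → y ≈ Q ⊛ x ⟦ m ⟧
⊛-inverse {P = P} {Q} {x} {y} QP e i = symᵐ
  (transᵐ (⊡-congˡ Q {C = column x} {D = P ⊡ column y} (λ j _ → e j) i tt)
  (transᵐ (symᵐ (⊡-assoc Q P (column y) i tt))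
  (transᵐ (⊡-congʳ (column y) QP i tt) (⊡-identityˡ (column y) i tt))))

-- Both sides count the pairs (x, y) with x ≡ P y, equivalently y ≡ Q x, weighted by F x.
vectors-reindex : ∀ {m} M {u v} {P : Mat u v} {Q : Mat v u} →
  P ⊡ Q ≃ δ u ⟦ + suc M ⟧ → Q ⊡ P ≃ δ v ⟦ + suc M ⟧ →
  (F : Vector u → ℤ) (H : Vector v → ℤ) → PeriodicV m (suc M) F → (∀ y → H y ≡ F (P ⊛ y) ⟦ m ⟧) →
  vectors (suc M) u F ≡ vectors (suc M) v H ⟦ m ⟧
vectors-reindex {m} M {u} {v} {P} {Q} PQ QP F H p e = symᵐ
  (transᵐ (vectors-cong (suc M) v (λ y → transᵐ (e y) (symᵐ (vectors-δ M u F (P ⊛ y) p))))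
  (transᵐ (vectors-swap (suc M) v u (λ y x → ind (x ≈ P ⊛ y ⟦ + suc M ⟧?) * F x))
  (vectors-cong (suc M) u (λ x → transᵐ
    (vectors-cong (suc M) v (λ y → ≡⇒≡ᵐ (trans (cong (_* F x) (ind-⇔ (x ≈ P ⊛ y ⟦ + suc M ⟧?) (y ≈ Q ⊛ x ⟦ + suc M ⟧?) (⊛-inverse {P = P} {Q} QP) (⊛-inverse {P = Q} {P} PQ)))
      (cong (_* F x) (sym (ℤₚ.*-identityʳ (ind (y ≈ Q ⊛ x ⟦ + suc M ⟧?))))))))
    (transᵐ (vectors-*ʳ (suc M) v (λ y → ind (y ≈ Q ⊛ x ⟦ + suc M ⟧?) * + 1) (F x))
    (transᵐ (*-congʳᵐ (vectors-δ M v (λ _ → + 1) (Q ⊛ x) (λ _ → reflᵐ)) (F x)) (≡⇒≡ᵐ (ℤₚ.*-identityˡ (F x)))))))))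

-- Quadratic Gauss sums

record Character (m : ℤ) (ψ : ℤ → ℤ) : Set where
  field
    ψ-zero : ψ (+ 0) ≡ + 1 ⟦ m ⟧
    ψ-+    : ∀ x y → ψ (x + y) ≡ ψ x * ψ y ⟦ m ⟧
open Character

-- ψ has order exactly 2^r, expressed by its value -1 at 2^(r-1).
Order : ℤ → (ℤ → ℤ) → ℕ → Set
Order m ψ zero    = ψ (+ 1) ≡ + 1 ⟦ m ⟧
Order m ψ (suc r) = ψ (pow2ℕ r) ≡ - + 1 ⟦ m ⟧

module _ {m : ℤ} {ψ : ℤ → ℤ} (χ : Character m ψ) where

  character-∘ : ∀ c → Character m (λ x → ψ (c * x))
  ψ-zero (character-∘ c) = subst (λ z → ψ z ≡ + 1 ⟦ m ⟧) (sym (ℤₚ.*-zeroʳ c)) (ψ-zero χ)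
  ψ-+ (character-∘ c) x y = transᵐ (≡⇒≡ᵐ (cong ψ (ℤₚ.*-distribˡ-+ c x y))) (ψ-+ χ (c * x) (c * y))

  ψ-neg : ∀ {x} → ψ x ≡ + 1 ⟦ m ⟧ → ψ (- x) ≡ + 1 ⟦ m ⟧
  ψ-neg {x} e = transᵐ (≡⇒≡ᵐ (sym (ℤₚ.*-identityˡ (ψ (- x)))))
    (transᵐ (*-congʳᵐ (symᵐ e) (ψ (- x)))
    (transᵐ (symᵐ (ψ-+ χ x (- x))) (transᵐ (≡⇒≡ᵐ (cong ψ (ℤₚ.+-inverseʳ x))) (ψ-zero χ))))

  ψ-multiple-ℕ : ∀ {a} → ψ a ≡ + 1 ⟦ m ⟧ → ∀ n → ψ (+ n * a) ≡ + 1 ⟦ m ⟧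
  ψ-multiple-ℕ {a} e zero    = ψ-zero χ
  ψ-multiple-ℕ {a} e (suc n) = transᵐ (≡⇒≡ᵐ (cong ψ (lem (+ n) a)))
    (transᵐ (ψ-+ χ a (+ n * a)) (*-congᵐ e (ψ-multiple-ℕ e n)))
    where
    lem : ∀ n a → (+ 1 + n) * a ≡ a + n * a
    lem = solve-∀

  ψ-multiple : ∀ {a} → ψ a ≡ + 1 ⟦ m ⟧ → ∀ q → ψ (q * a) ≡ + 1 ⟦ m ⟧
  ψ-multiple e (+ n)        = ψ-multiple-ℕ e n
  ψ-multiple {a} e -[1+ n ] = transᵐ (≡⇒≡ᵐ (cong ψ (sym (ℤₚ.neg-distribˡ-* (+ suc n) a)))) (ψ-neg (ψ-multiple-ℕ e (suc n)))

  ψ-order : ∀ r → Order m ψ r → ψ (pow2ℕ r) ≡ + 1 ⟦ m ⟧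
  ψ-order zero    o = o
  ψ-order (suc r) o = transᵐ (≡⇒≡ᵐ (cong ψ (trans (pow2ℕ-suc r) (lem (pow2ℕ r))))) (transᵐ (ψ-+ χ (pow2ℕ r) (pow2ℕ r)) (*-congᵐ o o))
    where
    lem : ∀ a → + 2 * a ≡ a + a
    lem = solve-∀

  ψ-periodic : ∀ r → Order m ψ r → ∀ x q → ψ (x + q * pow2ℕ r) ≡ ψ x ⟦ m ⟧
  ψ-periodic r o x q = transᵐ (ψ-+ χ x _) (transᵐ (*-congˡᵐ (ψ x) (ψ-multiple (ψ-order r o) q)) (≡⇒≡ᵐ (ℤₚ.*-identityʳ (ψ x))))

  -- An odd multiple of half the period changes the sign. All cancellations in the sums below pair
  -- an argument with a shift that moves the form by such a multiple.
  ψ-antiperiodic : ∀ r → Order m ψ (suc r) → ∀ x q → ψ (x + (+ 1 + q * + 2) * pow2ℕ r) ≡ - ψ x ⟦ m ⟧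
  ψ-antiperiodic r o x q = transᵐ (≡⇒≡ᵐ (cong ψ (trans (lem x q (pow2ℕ r)) (cong (λ z → x + pow2ℕ r + q * z) (sym (pow2ℕ-suc r))))))
    (transᵐ (ψ-periodic (suc r) o (x + pow2ℕ r) q)
    (transᵐ (ψ-+ χ x (pow2ℕ r)) (transᵐ (*-congˡᵐ (ψ x) o) (≡⇒≡ᵐ (lem′ (ψ x))))))
    where
    lem : ∀ x q c → x + (+ 1 + q * + 2) * c ≡ x + c + q * (+ 2 * c)
    lem = solve-∀
    lem′ : ∀ x → x * - + 1 ≡ - x
    lem′ = solve-∀

  order-∘4 : ∀ r → Order m ψ (suc (suc r)) → Order m (λ x → ψ (+ 4 * x)) r
  order-∘4 zero    o = ψ-order 2 o
  order-∘4 (suc r) o = transᵐ (≡⇒≡ᵐ (cong ψ (trans (lem (pow2ℕ r)) (sym (trans (pow2ℕ-suc (suc r)) (cong (+ 2 *_) (pow2ℕ-suc r))))))) o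
    where
    lem : ∀ c → + 4 * c ≡ + 2 * (+ 2 * c)
    lem = solve-∀

range-double : ∀ n f → range (n ℕ.* 2) f ≡ range n (λ x → f (+ 2 * x)) + range n (λ x → f (+ 2 * x + + 1))
range-double zero    f = refl
range-double (suc n) f = begin
  range (n ℕ.* 2) f + f (+ (n ℕ.* 2)) + f (+ suc (n ℕ.* 2))
    ≡⟨ cong₂ _+_ (cong₂ _+_ (range-double n f) (cong f even)) (cong f odd) ⟩
  a + b + f (+ 2 * + n) + f (+ 2 * + n + + 1)
    ≡⟨ lem a b (f (+ 2 * + n)) (f (+ 2 * + n + + 1)) ⟩
  a + f (+ 2 * + n) + (b + f (+ 2 * + n + + 1)) ∎
  where
  open ≡-Reasoning
  a = range n (λ x → f (+ 2 * x))
  b = range n (λ x → f (+ 2 * x + + 1))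
  even : + (n ℕ.* 2) ≡ + 2 * + n
  even = trans (ℤₚ.pos-* n 2) (ℤₚ.*-comm (+ n) (+ 2))
  odd : + suc (n ℕ.* 2) ≡ + 2 * + n + + 1
  odd = trans (ℤₚ.+-comm (+ 1) (+ (n ℕ.* 2))) (cong (_+ + 1) even)
  lem : ∀ a b c d → a + b + c + d ≡ a + c + (b + d)
  lem = solve-∀

2^-suc : ∀ n → 2 ℕ.^ suc n ≡ 2 ℕ.^ n ℕ.* 2
2^-suc n = ℕₚ.*-comm 2 (2 ℕ.^ n)

range-2^ : ∀ n f → range (2 ℕ.^ suc n) f ≡ range (2 ℕ.^ n) (λ x → f (+ 2 * x)) + range (2 ℕ.^ n) (λ x → f (+ 2 * x + + 1))
range-2^ n f = trans (cong (λ k → range k f) (2^-suc n)) (range-double (2 ℕ.^ n) f)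

range-halves : ∀ n f → range (2 ℕ.^ suc n) f ≡ range (2 ℕ.^ n) f + range (2 ℕ.^ n) (λ x → f (pow2ℕ n + x))
range-halves n f = trans (cong (λ k → range k f) (cong (2 ℕ.^ n ℕ.+_) (ℕₚ.+-identityʳ (2 ℕ.^ n)))) (range-++ (2 ℕ.^ n) (2 ℕ.^ n) f)

range-invariant : ∀ {m} n f → (∀ x → f (x + + 1) ≡ f x ⟦ m ⟧) → range n f ≡ + n * f (+ 0) ⟦ m ⟧
range-invariant zero    f e = reflᵐ
range-invariant {m} (suc n) f e = transᵐ (+-congᵐ (range-invariant n f e) (at-zero n)) (≡⇒≡ᵐ (lem (+ n) (f (+ 0))))
  where
  lem : ∀ n c → n * c + c ≡ (+ 1 + n) * c
  lem = solve-∀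
  at-zero : ∀ n → f (+ n) ≡ f (+ 0) ⟦ m ⟧
  at-zero zero    = reflᵐ
  at-zero (suc n) = transᵐ (≡⇒≡ᵐ (cong f (ℤₚ.+-comm (+ 1) (+ n)))) (transᵐ (e (+ n)) (at-zero n))

range-antiperiodic : ∀ {m} r j f → (∀ x → f (x + pow2ℕ r) ≡ - f x ⟦ m ⟧) → range (2 ℕ.^ (suc r ℕ.+ j)) f ≡ + 0 ⟦ m ⟧
range-antiperiodic r zero f e = transᵐ (≡⇒≡ᵐ (trans (cong (λ k → range (2 ℕ.^ suc k) f) (ℕₚ.+-identityʳ r)) (range-halves r f)))
  (transᵐ (symᵐ (≡⇒≡ᵐ (range-+ (2 ℕ.^ r) f (λ x → f (pow2ℕ r + x)))))
  (transᵐ (range-cong (2 ℕ.^ r) (λ x → transᵐ (+-congᵐ (reflᵐ {f x}) (transᵐ (≡⇒≡ᵐ (cong f (ℤₚ.+-comm (pow2ℕ r) x))) (e x))) (≡⇒≡ᵐ (ℤₚ.+-inverseʳ (f x)))))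
  (≡⇒≡ᵐ (range-zero (2 ℕ.^ r)))))
range-antiperiodic r (suc j) f e = transᵐ (≡⇒≡ᵐ (trans (cong (λ k → range (2 ℕ.^ suc k) f) (ℕₚ.+-suc r j)) (range-halves (suc r ℕ.+ j) f)))
  (+-congᵐ (range-antiperiodic r j f e) (range-antiperiodic r j (λ x → f (c + x)) (λ x → transᵐ (≡⇒≡ᵐ (cong f (sym (ℤₚ.+-assoc c x (pow2ℕ r))))) (e (c + x)))))
  where
  c = pow2ℕ (suc r ℕ.+ j)

range-antiperiodic-≤ : ∀ {m} r n f → suc r ℕ.≤ n → (∀ x → f (x + pow2ℕ r) ≡ - f x ⟦ m ⟧) → range (2 ℕ.^ n) f ≡ + 0 ⟦ m ⟧
range-antiperiodic-≤ r n f p e = subst (λ k → range (2 ℕ.^ k) f ≡ + 0 ⟦ _ ⟧) (ℕₚ.m+[n∸m]≡n p) (range-antiperiodic r (n ℕ.∸ suc r) f e)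

-- Sums of a character over squares and over binary norms

sumSquares : ℕ → (ℤ → ℤ) → ℤ
sumSquares n ψ = range (2 ℕ.^ n) (λ x → ψ (x * x))

+0ʳᵐ : ∀ {x y m} → y ≡ + 0 ⟦ m ⟧ → x + y ≡ x ⟦ m ⟧
+0ʳᵐ {x} e = transᵐ (+-congᵐ (reflᵐ {x}) e) (≡⇒≡ᵐ (ℤₚ.+-identityʳ x))

4^ : ℕ → ℤ
4^ zero    = + 1
4^ (suc k) = + 4 * 4^ k

-- Half the quadratic form of `hyp s`, whose values are even; the factor 2 is moved into the
-- character.
norm : Sign → ℤ → ℤ → ℤ
norm plus  x y = x * y
norm minus x y = x * x + x * y + y * y

sumNorms : Sign → ℕ → (ℤ → ℤ) → ℤ
sumNorms s n ψ = range (2 ℕ.^ n) (λ x → range (2 ℕ.^ n) (λ y → ψ (norm s x y)))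

range-swap : ∀ a b (f : ℤ → ℤ → ℤ) → range a (λ x → range b (f x)) ≡ range b (λ y → range a (λ x → f x y))
range-swap zero    b f = sym (range-zero b)
range-swap (suc a) b f = trans (cong (_+ range b (f (+ a))) (range-swap a b f)) (sym (range-+ b _ _))

signed2 : Sign → ℤ
signed2 plus  = + 2
signed2 minus = - + 2

module _ {m : ℤ} where

  sumSquares-trivial : ∀ n {ψ} → Character m ψ → Order m ψ 0 → sumSquares n ψ ≡ pow2ℕ n ⟦ m ⟧
  sumSquares-trivial n {ψ} χ o = transᵐ
    (range-cong (2 ℕ.^ n) (λ x → transᵐ (≡⇒≡ᵐ (cong ψ (sym (ℤₚ.*-identityʳ (x * x))))) (ψ-multiple χ o (x * x))))
    (≡⇒≡ᵐ (trans (range-const (2 ℕ.^ n) (+ 1)) (ℤₚ.*-identityʳ (pow2ℕ n))))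

  sumSquares-vanish : ∀ n {ψ} → Character m ψ → Order m ψ 1 → 1 ℕ.≤ n → sumSquares n ψ ≡ + 0 ⟦ m ⟧
  sumSquares-vanish n {ψ} χ o p = range-antiperiodic-≤ 0 n _ p (λ x → transᵐ (≡⇒≡ᵐ (cong ψ (lem x))) (ψ-antiperiodic χ 0 o (x * x) x))
    where
    lem : ∀ x → (x + + 1) * (x + + 1) ≡ x * x + (+ 1 + x * + 2) * + 1
    lem = solve-∀

  sumSquares-4 : ∀ n {ψ} → Character m ψ → Order m ψ 2 → sumSquares (suc n) ψ ≡ pow2ℕ n * (+ 1 + ψ (+ 1)) ⟦ m ⟧
  sumSquares-4 n {ψ} χ o = transᵐ (≡⇒≡ᵐ (range-2^ n _)) (transᵐ
    (+-congᵐ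
      (transᵐ (range-cong (2 ℕ.^ n) (λ x → transᵐ (≡⇒≡ᵐ (cong ψ (lem₁ x))) (transᵐ (ψ-periodic χ 2 o (+ 0) (x * x)) (ψ-zero χ)))) (≡⇒≡ᵐ (range-const (2 ℕ.^ n) (+ 1))))
      (range-invariant (2 ℕ.^ n) _ (λ x → transᵐ (≡⇒≡ᵐ (cong ψ (lem₂ x))) (ψ-periodic χ 2 o _ (+ 2 * (x + + 1))))))
    (≡⇒≡ᵐ (sym (ℤₚ.*-distribˡ-+ (pow2ℕ n) (+ 1) (ψ (+ 1))))))
    where
    lem₁ : ∀ x → + 2 * x * (+ 2 * x) ≡ + 0 + x * x * + 4
    lem₁ = solve-∀
    lem₂ : ∀ x → (+ 2 * (x + + 1) + + 1) * (+ 2 * (x + + 1) + + 1) ≡ (+ 2 * x + + 1) * (+ 2 * x + + 1) + + 2 * (x + + 1) * + 4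
    lem₂ = solve-∀

  even-part : ∀ n ψ → range (2 ℕ.^ n) (λ x → ψ (+ 2 * x * (+ 2 * x))) ≡ sumSquares n (λ x → ψ (+ 4 * x)) ⟦ m ⟧
  even-part n ψ = range-cong (2 ℕ.^ n) (λ x → ≡⇒≡ᵐ (cong ψ (lem x)))
    where
    lem : ∀ x → + 2 * x * (+ 2 * x) ≡ + 4 * (x * x)
    lem = solve-∀

  -- Odd squares are 1 mod 8. The even squares give a sum for `ψ (4 x)`, a character of order 2, and
  -- that sum vanishes.
  sumSquares-8 : ∀ n {ψ} → Character m ψ → Order m ψ 3 → 1 ℕ.≤ n → sumSquares (suc n) ψ ≡ pow2ℕ n * ψ (+ 1) ⟦ m ⟧
  sumSquares-8 n {ψ} χ o p = transᵐ (≡⇒≡ᵐ (range-2^ n _)) (transᵐ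
    (+-congᵐ
      (transᵐ (even-part n ψ) (sumSquares-vanish n (character-∘ χ (+ 4)) (order-∘4 χ 1 o) p))
      (range-invariant (2 ℕ.^ n) _ (λ x → transᵐ (≡⇒≡ᵐ (cong ψ (lem₂ x))) (ψ-periodic χ 3 o _ (x + + 1)))))
    (≡⇒≡ᵐ (ℤₚ.+-identityˡ (pow2ℕ n * ψ (+ 1)))))
    where
    lem₂ : ∀ x → (+ 2 * (x + + 1) + + 1) * (+ 2 * (x + + 1) + + 1) ≡ (+ 2 * x + + 1) * (+ 2 * x + + 1) + (x + + 1) * + 8
    lem₂ = solve-∀

  -- The odd squares cancel: y ↦ y + 2^(r+1) changes (2 y + 1)² by an odd multiple of 2^(r+3).
  sumSquares-step : ∀ n r {ψ} → Character m ψ → Order m ψ (4 ℕ.+ r) → 4 ℕ.+ r ℕ.≤ suc n →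
    sumSquares (suc n) ψ ≡ sumSquares n (λ x → ψ (+ 4 * x)) ⟦ m ⟧
  sumSquares-step n r {ψ} χ o (s≤s p) = transᵐ (≡⇒≡ᵐ (range-2^ n _)) (transᵐ
    (+0ʳᵐ (range-antiperiodic-≤ (suc r) n _ (ℕₚ.≤-trans (ℕₚ.n≤1+n _) p) (λ x → transᵐ (≡⇒≡ᵐ (cong ψ (eq x))) (ψ-antiperiodic χ (3 ℕ.+ r) o _ (x + pow2ℕ r)))))
    (even-part n ψ))
    where
    p1 = pow2ℕ-suc r
    p3 : pow2ℕ (3 ℕ.+ r) ≡ + 8 * pow2ℕ r
    p3 = trans (pow2ℕ-+ 3 r) refl
    lem : ∀ x c → (+ 2 * (x + + 2 * c) + + 1) * (+ 2 * (x + + 2 * c) + + 1) ≡ (+ 2 * x + + 1) * (+ 2 * x + + 1) + (+ 1 + (x + c) * + 2) * (+ 8 * c)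
    lem = solve-∀
    eq : ∀ x → (+ 2 * (x + pow2ℕ (suc r)) + + 1) * (+ 2 * (x + pow2ℕ (suc r)) + + 1) ≡
      (+ 2 * x + + 1) * (+ 2 * x + + 1) + (+ 1 + (x + pow2ℕ r) * + 2) * pow2ℕ (3 ℕ.+ r)
    eq x = trans (cong (λ z → (+ 2 * (x + z) + + 1) * (+ 2 * (x + z) + + 1)) p1)
      (trans (lem x (pow2ℕ r)) (cong (λ z → (+ 2 * x + + 1) * (+ 2 * x + + 1) + (+ 1 + (x + pow2ℕ r) * + 2) * z) (sym p3)))

  -- Each step divides the order of `ψ` by 4. The descent ends at order 4 here and at order 8 for
  -- odd exponents; order 2 stands apart because its sum vanishes.
  sumSquares-even : ∀ k n {ψ} → Character m ψ → Order m ψ (2 ℕ.+ k ℕ.* 2) → 2 ℕ.+ k ℕ.* 2 ℕ.≤ n →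
    sumSquares n ψ ≡ pow2ℕ (n ℕ.∸ suc k) * (+ 1 + ψ (4^ k)) ⟦ m ⟧
  sumSquares-even zero    (suc n) χ o p = sumSquares-4 n χ o
  sumSquares-even (suc k) (suc n) χ o p = transᵐ (sumSquares-step n (k ℕ.* 2) χ o p)
    (sumSquares-even k n (character-∘ χ (+ 4)) (order-∘4 χ (2 ℕ.+ k ℕ.* 2) o) (ℕₚ.≤-trans (ℕₚ.n≤1+n _) (ℕₚ.≤-pred p)))

  sumSquares-odd : ∀ k n {ψ} → Character m ψ → Order m ψ (3 ℕ.+ k ℕ.* 2) → 3 ℕ.+ k ℕ.* 2 ℕ.≤ n →
    sumSquares n ψ ≡ pow2ℕ (n ℕ.∸ suc k) * ψ (4^ k) ⟦ m ⟧
  sumSquares-odd zero    (suc n) χ o p = sumSquares-8 n χ o (ℕₚ.≤-trans (s≤s z≤n) (ℕₚ.≤-pred p))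
  sumSquares-odd (suc k) (suc n) χ o p = transᵐ (sumSquares-step n (1 ℕ.+ k ℕ.* 2) χ o p)
    (sumSquares-odd k n (character-∘ χ (+ 4)) (order-∘4 χ (3 ℕ.+ k ℕ.* 2) o) (ℕₚ.≤-trans (ℕₚ.n≤1+n _) (ℕₚ.≤-pred p)))

  range-2-valued : ∀ n f a b → (∀ x → f (+ 2 * x) ≡ a ⟦ m ⟧) → (∀ x → f (+ 2 * x + + 1) ≡ b ⟦ m ⟧) →
    range (2 ℕ.^ suc n) f ≡ pow2ℕ n * (a + b) ⟦ m ⟧
  range-2-valued n f a b ea eb = transᵐ (≡⇒≡ᵐ (range-2^ n f))
    (transᵐ (+-congᵐ (transᵐ (range-cong (2 ℕ.^ n) ea) (≡⇒≡ᵐ (range-const (2 ℕ.^ n) a))) (transᵐ (range-cong (2 ℕ.^ n) eb) (≡⇒≡ᵐ (range-const (2 ℕ.^ n) b))))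
    (≡⇒≡ᵐ (sym (ℤₚ.*-distribˡ-+ (pow2ℕ n) a b))))

  sumNorms-trivial : ∀ s n {ψ} → Character m ψ → Order m ψ 0 → sumNorms s n ψ ≡ pow2ℕ n * pow2ℕ n ⟦ m ⟧
  sumNorms-trivial s n {ψ} χ o = transᵐ
    (range-cong (2 ℕ.^ n) (λ x → transᵐ
      (range-cong (2 ℕ.^ n) (λ y → transᵐ (≡⇒≡ᵐ (cong ψ (sym (ℤₚ.*-identityʳ (norm s x y))))) (ψ-multiple χ o (norm s x y))))
      (≡⇒≡ᵐ (trans (range-const (2 ℕ.^ n) (+ 1)) (ℤₚ.*-identityʳ (pow2ℕ n))))))
    (≡⇒≡ᵐ (range-const (2 ℕ.^ n) (pow2ℕ n)))

  -- Of the four points mod 2, the form `x y` is odd at one and `x² + x y + y²` at three. The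
  -- resulting sums 2 and -2 are the two Arf invariants.
  sumNorms-2 : ∀ s n {ψ} → Character m ψ → Order m ψ 1 → sumNorms s (suc n) ψ ≡ pow2ℕ n * (pow2ℕ n * signed2 s) ⟦ m ⟧
  sumNorms-2 s n {ψ} χ o = transᵐ
    (range-cong (2 ℕ.^ suc n) (λ x → range-2-valued n _ (ψ (norm s x (+ 0))) (ψ (norm s x (+ 1)))
      (λ y → transᵐ (≡⇒≡ᵐ (cong ψ (y-period₀ s x y))) (ψ-periodic χ 1 o _ (y-step₀ s x y)))
      (λ y → transᵐ (≡⇒≡ᵐ (cong ψ (y-period₁ s x y))) (ψ-periodic χ 1 o _ (y-step₁ s x y)))))
    (transᵐ (range-2-valued n _ (pow2ℕ n * (ψ (norm s (+ 0) (+ 0)) + ψ (norm s (+ 0) (+ 1)))) (pow2ℕ n * (ψ (norm s (+ 1) (+ 0)) + ψ (norm s (+ 1) (+ 1))))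
      (λ x → *-congˡᵐ (pow2ℕ n) (+-congᵐ (transᵐ (≡⇒≡ᵐ (cong ψ (x-period₀ s x (+ 0)))) (ψ-periodic χ 1 o _ (x-step₀ s x (+ 0)))) (transᵐ (≡⇒≡ᵐ (cong ψ (x-period₀ s x (+ 1)))) (ψ-periodic χ 1 o _ (x-step₀ s x (+ 1))))))
      (λ x → *-congˡᵐ (pow2ℕ n) (+-congᵐ (transᵐ (≡⇒≡ᵐ (cong ψ (x-period₁ s x (+ 0)))) (ψ-periodic χ 1 o _ (x-step₁ s x (+ 0)))) (transᵐ (≡⇒≡ᵐ (cong ψ (x-period₁ s x (+ 1)))) (ψ-periodic χ 1 o _ (x-step₁ s x (+ 1)))))))
    (*-congˡᵐ (pow2ℕ n) (transᵐ (≡⇒≡ᵐ (sym (ℤₚ.*-distribˡ-+ (pow2ℕ n) (ψ (norm s (+ 0) (+ 0)) + ψ (norm s (+ 0) (+ 1))) _))) (*-congˡᵐ (pow2ℕ n) (values s)))))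
    where
    y-step₀ y-step₁ x-step₀ x-step₁ : Sign → ℤ → ℤ → ℤ
    y-step₀ plus  x y = x * y
    y-step₀ minus x y = x * y + + 2 * y * y
    y-step₁ plus  x y = x * y
    y-step₁ minus x y = x * y + + 2 * y * y + + 2 * y
    x-step₀ plus  x y = x * y
    x-step₀ minus x y = x * y + + 2 * x * x
    x-step₁ plus  x y = x * y
    x-step₁ minus x y = x * y + + 2 * x * x + + 2 * x
    y-period₀ : ∀ s x y → norm s x (+ 2 * y) ≡ norm s x (+ 0) + y-step₀ s x y * + 2
    y-period₀ plus = lem
      where
      lem : ∀ x y → x * (+ 2 * y) ≡ x * + 0 + (x * y) * + 2
      lem = solve-∀
    y-period₀ minus = lem
      where
      lem : ∀ x y → x * x + x * (+ 2 * y) + (+ 2 * y) * (+ 2 * y) ≡ x * x + x * + 0 + + 0 * + 0 + (x * y + + 2 * y * y) * + 2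
      lem = solve-∀
    y-period₁ : ∀ s x y → norm s x (+ 2 * y + + 1) ≡ norm s x (+ 1) + y-step₁ s x y * + 2
    y-period₁ plus = lem
      where
      lem : ∀ x y → x * (+ 2 * y + + 1) ≡ x * + 1 + (x * y) * + 2
      lem = solve-∀
    y-period₁ minus = lem
      where
      lem : ∀ x y → x * x + x * (+ 2 * y + + 1) + (+ 2 * y + + 1) * (+ 2 * y + + 1) ≡ x * x + x * + 1 + + 1 * + 1 + (x * y + + 2 * y * y + + 2 * y) * + 2
      lem = solve-∀
    x-period₀ : ∀ s x y → norm s (+ 2 * x) y ≡ norm s (+ 0) y + x-step₀ s x y * + 2
    x-period₀ plus = lem
      where
      lem : ∀ x y → (+ 2 * x) * y ≡ + 0 * y + (x * y) * + 2
      lem = solve-∀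
    x-period₀ minus = lem
      where
      lem : ∀ x y → (+ 2 * x) * (+ 2 * x) + (+ 2 * x) * y + y * y ≡ + 0 * + 0 + + 0 * y + y * y + (x * y + + 2 * x * x) * + 2
      lem = solve-∀
    x-period₁ : ∀ s x y → norm s (+ 2 * x + + 1) y ≡ norm s (+ 1) y + x-step₁ s x y * + 2
    x-period₁ plus = lem
      where
      lem : ∀ x y → (+ 2 * x + + 1) * y ≡ + 1 * y + (x * y) * + 2
      lem = solve-∀
    x-period₁ minus = lem
      where
      lem : ∀ x y → (+ 2 * x + + 1) * (+ 2 * x + + 1) + (+ 2 * x + + 1) * y + y * y ≡ + 1 * + 1 + + 1 * y + y * y + (x * y + + 2 * x * x + + 2 * x) * + 2
      lem = solve-∀
    ψ0 = ψ-zero χ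
    values : ∀ s → (ψ (norm s (+ 0) (+ 0)) + ψ (norm s (+ 0) (+ 1))) + (ψ (norm s (+ 1) (+ 0)) + ψ (norm s (+ 1) (+ 1))) ≡ signed2 s ⟦ m ⟧
    values plus  = +-congᵐ (+-congᵐ ψ0 ψ0) (+-congᵐ ψ0 o)
    values minus = +-congᵐ (+-congᵐ ψ0 o) (+-congᵐ o (transᵐ (ψ-periodic χ 1 o (+ 1) (+ 1)) o))

  -- The terms with x or y odd cancel, as in sumSquares-step.
  sumNorms-step : ∀ s n r {ψ} → Character m ψ → Order m ψ (2 ℕ.+ r) → 2 ℕ.+ r ℕ.≤ suc n →
    sumNorms s (suc n) ψ ≡ sumNorms s n (λ x → ψ (+ 4 * x)) ⟦ m ⟧
  sumNorms-step s n r {ψ} χ o (s≤s p) = transᵐ (≡⇒≡ᵐ (range-2^ n _))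
    (transᵐ (+0ʳᵐ (transᵐ (range-cong (2 ℕ.^ n) (λ x → range-antiperiodic-≤ (suc r) (suc n) _ (s≤s p)
        (λ y → transᵐ (≡⇒≡ᵐ (cong ψ (odd-x s x y))) (ψ-antiperiodic χ (suc r) o _ (q₁ s x y))))) (≡⇒≡ᵐ (range-zero (2 ℕ.^ n)))))
    (transᵐ (range-cong (2 ℕ.^ n) (λ x → ≡⇒≡ᵐ (range-2^ n (λ y → ψ (norm s (+ 2 * x) y)))))
    (transᵐ (≡⇒≡ᵐ (range-+ (2 ℕ.^ n) _ _))
    (transᵐ (+0ʳᵐ (transᵐ (≡⇒≡ᵐ (range-swap (2 ℕ.^ n) (2 ℕ.^ n) (λ x y → ψ (norm s (+ 2 * x) (+ 2 * y + + 1)))))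
      (transᵐ (range-cong (2 ℕ.^ n) (λ y → range-antiperiodic-≤ r n _ p
        (λ x → transᵐ (≡⇒≡ᵐ (cong ψ (odd-y s x y))) (ψ-antiperiodic χ (suc r) o _ (q₂ s x y))))) (≡⇒≡ᵐ (range-zero (2 ℕ.^ n))))))
    (range-cong (2 ℕ.^ n) (λ x → range-cong (2 ℕ.^ n) (λ y → ≡⇒≡ᵐ (cong ψ (both-even s x y)))))))))
    where
    c = pow2ℕ r
    q₁ q₂ : Sign → ℤ → ℤ → ℤ
    q₁ plus  x y = x
    q₁ minus x y = x + y + c
    q₂ plus  x y = y
    q₂ minus x y = y + + 2 * x + c
    lem₁ : ∀ x y c → (+ 2 * x + + 1) * (y + + 2 * c) ≡ (+ 2 * x + + 1) * y + (+ 1 + x * + 2) * (+ 2 * c)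
    lem₁ = solve-∀
    lem₂ : ∀ x y c → (+ 2 * x + + 1) * (+ 2 * x + + 1) + (+ 2 * x + + 1) * (y + + 2 * c) + (y + + 2 * c) * (y + + 2 * c) ≡ (+ 2 * x + + 1) * (+ 2 * x + + 1) + (+ 2 * x + + 1) * y + y * y + (+ 1 + (x + y + c) * + 2) * (+ 2 * c)
    lem₂ = solve-∀
    lem₃ : ∀ x y c → + 2 * (x + c) * (+ 2 * y + + 1) ≡ + 2 * x * (+ 2 * y + + 1) + (+ 1 + y * + 2) * (+ 2 * c)
    lem₃ = solve-∀
    lem₄ : ∀ x y c → (+ 2 * (x + c)) * (+ 2 * (x + c)) + (+ 2 * (x + c)) * (+ 2 * y + + 1) + (+ 2 * y + + 1) * (+ 2 * y + + 1) ≡ (+ 2 * x) * (+ 2 * x) + (+ 2 * x) * (+ 2 * y + + 1) + (+ 2 * y + + 1) * (+ 2 * y + + 1) + (+ 1 + (y + + 2 * x + c) * + 2) * (+ 2 * c)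
    lem₄ = solve-∀
    odd-x : ∀ s x y → norm s (+ 2 * x + + 1) (y + pow2ℕ (suc r)) ≡ norm s (+ 2 * x + + 1) y + (+ 1 + q₁ s x y * + 2) * pow2ℕ (suc r)
    odd-x s x y = subst (λ d → norm s (+ 2 * x + + 1) (y + d) ≡ norm s (+ 2 * x + + 1) y + (+ 1 + q₁ s x y * + 2) * d) (sym (pow2ℕ-suc r)) (lem s)
      where
      lem : ∀ s → norm s (+ 2 * x + + 1) (y + + 2 * c) ≡ norm s (+ 2 * x + + 1) y + (+ 1 + q₁ s x y * + 2) * (+ 2 * c)
      lem plus  = lem₁ x y c
      lem minus = lem₂ x y c
    odd-y : ∀ s x y → norm s (+ 2 * (x + c)) (+ 2 * y + + 1) ≡ norm s (+ 2 * x) (+ 2 * y + + 1) + (+ 1 + q₂ s x y * + 2) * pow2ℕ (suc r)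
    odd-y s x y = subst (λ d → norm s (+ 2 * (x + c)) (+ 2 * y + + 1) ≡ norm s (+ 2 * x) (+ 2 * y + + 1) + (+ 1 + q₂ s x y * + 2) * d) (sym (pow2ℕ-suc r)) (lem s)
      where
      lem : ∀ s → norm s (+ 2 * (x + c)) (+ 2 * y + + 1) ≡ norm s (+ 2 * x) (+ 2 * y + + 1) + (+ 1 + q₂ s x y * + 2) * (+ 2 * c)
      lem plus  = lem₃ x y c
      lem minus = lem₄ x y c
    both-even : ∀ s x y → norm s (+ 2 * x) (+ 2 * y) ≡ + 4 * norm s x y
    both-even plus = lem
      where
      lem : ∀ x y → (+ 2 * x) * (+ 2 * y) ≡ + 4 * (x * y)
      lem = solve-∀
    both-even minus = lem
      where
      lem : ∀ x y → (+ 2 * x) * (+ 2 * x) + (+ 2 * x) * (+ 2 * y) + (+ 2 * y) * (+ 2 * y) ≡ + 4 * (x * x + x * y + y * y)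
      lem = solve-∀

  -- For an even exponent the descent ends at the trivial character, so the sign `s` leaves no
  -- trace; for an odd exponent it ends at order 2, where the sign survives.
  sumNorms-even : ∀ s k n {ψ} → Character m ψ → Order m ψ (k ℕ.* 2) → k ℕ.* 2 ℕ.≤ n →
    sumNorms s n ψ ≡ pow2ℕ (n ℕ.∸ k) * pow2ℕ (n ℕ.∸ k) ⟦ m ⟧
  sumNorms-even s zero    n       χ o p = sumNorms-trivial s n χ o
  sumNorms-even s (suc k) (suc n) χ o p = transᵐ (sumNorms-step s n (k ℕ.* 2) χ o p)
    (sumNorms-even s k n (character-∘ χ (+ 4)) (order-∘4 χ (k ℕ.* 2) o) (ℕₚ.≤-trans (ℕₚ.n≤1+n _) (ℕₚ.≤-pred p)))

  sumNorms-odd : ∀ s k n {ψ} → Character m ψ → Order m ψ (1 ℕ.+ k ℕ.* 2) → 1 ℕ.+ k ℕ.* 2 ℕ.≤ n →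
    sumNorms s n ψ ≡ pow2ℕ (n ℕ.∸ suc k) * (pow2ℕ (n ℕ.∸ suc k) * signed2 s) ⟦ m ⟧
  sumNorms-odd s zero    (suc n) χ o p = sumNorms-2 s n χ o
  sumNorms-odd s (suc k) (suc n) χ o p = transᵐ (sumNorms-step s n (1 ℕ.+ k ℕ.* 2) χ o p)
    (sumNorms-odd s k n (character-∘ χ (+ 4)) (order-∘4 χ (1 ℕ.+ k ℕ.* 2) o) (ℕₚ.≤-trans (ℕₚ.n≤1+n _) (ℕₚ.≤-pred p)))

-- Invertible residues and an eighth root of unity modulo a Fermat number

record Invertible (m c : ℤ) : Set where
  field
    inverse   : ℤ
    c*inverse : c * inverse ≡ + 1 ⟦ m ⟧
open Invertible

module _ {m : ℤ} where

  invertible-* : ∀ {c d} → Invertible m c → Invertible m d → Invertible m (c * d)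
  invertible-* {c} {d} p q = record
    { inverse = inverse p * inverse q
    ; c*inverse = transᵐ (≡⇒≡ᵐ (lem c d (inverse p) (inverse q))) (*-congᵐ (c*inverse p) (c*inverse q)) }
    where
    lem : ∀ c d p q → c * d * (p * q) ≡ c * p * (d * q)
    lem = solve-∀

  invertible-1 : Invertible m (+ 1)
  invertible-1 = record { inverse = + 1 ; c*inverse = reflᵐ }

  -- Fermat numbers need not be prime, so cancellation rests on explicit inverses instead of
  -- nonvanishing.
  invertible-cancel : ∀ {c} → Invertible m c → ∀ {x y} → c * x ≡ c * y ⟦ m ⟧ → x ≡ y ⟦ m ⟧
  invertible-cancel {c} p {x} {y} e = transᵐ (symᵐ (undo x)) (transᵐ (*-congˡᵐ (inverse p) e) (undo y))
    where
    lem : ∀ d c x → d * (c * x) ≡ c * d * x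
    lem = solve-∀
    undo : ∀ x → inverse p * (c * x) ≡ x ⟦ m ⟧
    undo x = transᵐ (≡⇒≡ᵐ (lem (inverse p) c x)) (transᵐ (*-congʳᵐ (c*inverse p) x) (≡⇒≡ᵐ (ℤₚ.*-identityˡ x)))

^-congᵐ : ∀ {x y m} n → x ≡ y ⟦ m ⟧ → x ^ n ≡ y ^ n ⟦ m ⟧
^-congᵐ zero    e = reflᵐ
^-congᵐ (suc n) e = *-congᵐ e (^-congᵐ n e)

^-*ᵐ : ∀ x a b → x ^ (a ℕ.* b) ≡ (x ^ b) ^ a
^-*ᵐ x a b = trans (cong (x ^_) (ℕₚ.*-comm a b)) (sym (ℤₚ.^-*-assoc x b a))

ψ-^ : ∀ {m ψ} → Character m ψ → ∀ n x → ψ (+ n * x) ≡ ψ x ^ n ⟦ m ⟧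
ψ-^ χ zero    x = Character.ψ-zero χ
ψ-^ {ψ = ψ} χ (suc n) x = transᵐ (≡⇒≡ᵐ (cong ψ (lem (+ n) x))) (transᵐ (Character.ψ-+ χ x (+ n * x)) (*-congˡᵐ (ψ x) (ψ-^ χ n x)))
  where
  lem : ∀ n x → (+ 1 + n) * x ≡ x + n * x
  lem = solve-∀

-- 2 is a root of unity of order 2^(κ+3) modulo the Fermat number 2^(2^(κ+2)) + 1.
module FermatCharacter (κ : ℕ) where

  K : ℕ
  K = 3 ℕ.+ κ

  M : ℕ
  M = 2 ℕ.^ K

  instance
    M-nonZero : NonZero M
    M-nonZero = ℕₚ.m^n≢0 2 K

  fermat : ℤ
  fermat = pow2ℕ (2 ℕ.^ (2 ℕ.+ κ)) + + 1

  pow-half : pow2ℕ (2 ℕ.^ (2 ℕ.+ κ)) ≡ - + 1 ⟦ fermat ⟧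
  pow-half = + 1 by lem (pow2ℕ (2 ℕ.^ (2 ℕ.+ κ)))
    where
    lem : ∀ a → a ≡ - + 1 + + 1 * (a + + 1)
    lem = solve-∀

  pow-M : pow2ℕ M ≡ + 1 ⟦ fermat ⟧
  pow-M = transᵐ (≡⇒≡ᵐ (trans (cong pow2ℕ (cong (2 ℕ.^ (2 ℕ.+ κ) ℕ.+_) (ℕₚ.+-identityʳ _))) (pow2ℕ-+ (2 ℕ.^ (2 ℕ.+ κ)) (2 ℕ.^ (2 ℕ.+ κ)))))
    (*-congᵐ pow-half pow-half)

  pow-+M : ∀ b q → pow2ℕ (b ℕ.+ q ℕ.* M) ≡ pow2ℕ b ⟦ fermat ⟧
  pow-+M b zero    = ≡⇒≡ᵐ (cong pow2ℕ (ℕₚ.+-identityʳ b))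
  pow-+M b (suc q) = transᵐ (≡⇒≡ᵐ (trans (cong pow2ℕ (trans (sym (ℕₚ.+-assoc b M _)) (trans (cong (ℕ._+ q ℕ.* M) (ℕₚ.+-comm b M)) (ℕₚ.+-assoc M b _)))) (pow2ℕ-+ M (b ℕ.+ q ℕ.* M))))
    (transᵐ (*-congᵐ pow-M (pow-+M b q)) (≡⇒≡ᵐ (ℤₚ.*-identityˡ (pow2ℕ b))))

  pow-periodic : ∀ a b → + a ≡ + b ⟦ + M ⟧ → pow2ℕ a ≡ pow2ℕ b ⟦ fermat ⟧
  pow-periodic a b (+ q by e) = transᵐ (≡⇒≡ᵐ (cong pow2ℕ (ℤₚ.+-injective (trans e (cong (λ z → + b + z) (sym (ℤₚ.pos-* q M))))))) (pow-+M b q)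
  pow-periodic a b (-[1+ q ] by e) = symᵐ (transᵐ (≡⇒≡ᵐ (cong pow2ℕ (ℤₚ.+-injective
      (trans (lem (+ b) (+ suc q) (+ M)) (trans (cong (_+ + suc q * + M) (sym e)) (cong (λ z → + a + z) (sym (ℤₚ.pos-* (suc q) M)))))))) (pow-+M a (suc q)))
    where
    lem : ∀ b q M → b ≡ b + - q * M + q * M
    lem = solve-∀

  χ : ℤ → ℤ
  χ z = pow2ℕ (z ℤDM.%ℕ M)

  residue : ∀ z → + (z ℤDM.%ℕ M) ≡ z ⟦ + M ⟧
  residue z = symᵐ ((z ℤDM./ℕ M) by ℤDM.a≡a%ℕn+[a/ℕn]*n z M)

  χ-pow : ∀ {z} a → z ≡ + a ⟦ + M ⟧ → χ z ≡ pow2ℕ a ⟦ fermat ⟧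
  χ-pow {z} a e = pow-periodic _ a (transᵐ (residue z) e)

  χ-periodic : Periodic fermat M χ
  χ-periodic {x} {y} e = χ-pow (y ℤDM.%ℕ M) (transᵐ e (symᵐ (residue y)))

  χ-character : Character fermat χ
  χ-character = record
    { ψ-zero = χ-pow 0 reflᵐ
    ; ψ-+ = λ x y → transᵐ (χ-pow (x ℤDM.%ℕ M ℕ.+ y ℤDM.%ℕ M) (symᵐ (+-congᵐ (residue x) (residue y)))) (≡⇒≡ᵐ (pow2ℕ-+ (x ℤDM.%ℕ M) (y ℤDM.%ℕ M))) }

  χ-order : Order fermat χ K
  χ-order = transᵐ (χ-pow (2 ℕ.^ (2 ℕ.+ κ)) reflᵐ) pow-half

  2-invertible : Invertible fermat (+ 2)
  2-invertible = record { inverse = - pow2ℕ p ; c*inverse = - + 1 by eq }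
    where
    p = ℕ.pred (2 ℕ.^ (2 ℕ.+ κ))
    suc-p : suc p ≡ 2 ℕ.^ (2 ℕ.+ κ)
    suc-p = ℕₚ.suc-pred (2 ℕ.^ (2 ℕ.+ κ)) {{ℕₚ.m^n≢0 2 (2 ℕ.+ κ)}}
    lem : ∀ a → + 2 * - a ≡ + 1 + - + 1 * (+ 2 * a + + 1)
    lem = solve-∀
    eq : + 2 * - pow2ℕ p ≡ + 1 + - + 1 * fermat
    eq = trans (lem (pow2ℕ p)) (cong (λ z → + 1 + - + 1 * (z + + 1)) (trans (sym (pow2ℕ-suc p)) (cong pow2ℕ suc-p)))

  pow2-invertible : ∀ n → Invertible fermat (pow2ℕ n)
  pow2-invertible zero    = invertible-1
  pow2-invertible (suc n) = subst (Invertible fermat) (sym (pow2ℕ-suc n)) (invertible-* {c = + 2} {pow2ℕ n} 2-invertible (pow2-invertible n))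

  1≢0 : ¬ (+ 1 ≡ + 0 ⟦ fermat ⟧)
  1≢0 e = ℕₚ.<⇒≱ (ℕₚ.m<n+m 1 (ℕₚ.m^n>0 2 (2 ℕ.^ (2 ℕ.+ κ)))) (ℕD.∣⇒≤ (≡ᵐ⇒∣ e))

  1≢-1 : ¬ (+ 1 ≡ - + 1 ⟦ fermat ⟧)
  1≢-1 e = 1≢0 (invertible-cancel 2-invertible {+ 1} {+ 0} (+-congᵐ e (reflᵐ {+ 1})))

  -- `pow2ℕ κ` is an eighth of the period `M` of `χ`.
  θ : ℤ
  θ = χ (pow2ℕ κ)

  χ-θ : ∀ n → χ (+ n * pow2ℕ κ) ≡ θ ^ n ⟦ fermat ⟧
  χ-θ n = ψ-^ χ-character n (pow2ℕ κ)

  θ⁴ : θ ^ 4 ≡ - + 1 ⟦ fermat ⟧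
  θ⁴ = transᵐ (symᵐ (χ-θ 4)) (transᵐ (≡⇒≡ᵐ (cong χ (trans (lem (pow2ℕ κ)) (sym (trans (pow2ℕ-suc (suc κ)) (cong (+ 2 *_) (pow2ℕ-suc κ))))))) χ-order)
    where
    lem : ∀ a → + 4 * a ≡ + 2 * (+ 2 * a)
    lem = solve-∀

  θ⁸ : θ ^ 8 ≡ + 1 ⟦ fermat ⟧
  θ⁸ = transᵐ (≡⇒≡ᵐ (ℤₚ.^-distribˡ-+-* θ 4 4)) (*-congᵐ θ⁴ θ⁴)

  θ-invertible : ∀ n → Invertible fermat (θ ^ n)
  θ-invertible zero    = invertible-1
  θ-invertible (suc n) = invertible-* {c = θ} {θ ^ n} (record { inverse = θ ^ 7 ; c*inverse = θ⁸ }) (θ-invertible n)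

  θ-periodic : ∀ n q → θ ^ (n ℕ.+ q ℕ.* 8) ≡ θ ^ n ⟦ fermat ⟧
  θ-periodic n q = transᵐ (≡⇒≡ᵐ (trans (ℤₚ.^-distribˡ-+-* θ n (q ℕ.* 8)) (cong (θ ^ n *_) (^-*ᵐ θ q 8))))
    (transᵐ (*-congˡᵐ (θ ^ n) (transᵐ (^-congᵐ q θ⁸) (≡⇒≡ᵐ (ℤₚ.^-zeroˡ q)))) (≡⇒≡ᵐ (ℤₚ.*-identityʳ (θ ^ n))))

  -- Every nonzero residue mod 8 has a multiple congruent to 4, so `θ ^ r ≡ 1` would give
  -- `θ ^ 4 ≡ 1`, whereas `θ ^ 4 ≡ -1`.
  θ≢1 : ∀ r → r ℕ.< 8 → θ ^ r ≡ + 1 ⟦ fermat ⟧ → r ≡ 0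
  θ≢1 r r<8 e = cases r r<8 e
    where
    absurd : ∀ r j q → j ℕ.* r ≡ 4 ℕ.+ q ℕ.* 8 → θ ^ r ≡ + 1 ⟦ fermat ⟧ → ⊥
    absurd r j q eq e = 1≢-1 (transᵐ (symᵐ (transᵐ (≡⇒≡ᵐ (^-*ᵐ θ j r)) (transᵐ (^-congᵐ j e) (≡⇒≡ᵐ (ℤₚ.^-zeroˡ j)))))
      (transᵐ (≡⇒≡ᵐ (cong (θ ^_) eq)) (transᵐ (θ-periodic 4 q) θ⁴)))
    cases : ∀ r → r ℕ.< 8 → θ ^ r ≡ + 1 ⟦ fermat ⟧ → r ≡ 0
    cases 0 _ _ = refl
    cases 1 _ e = ⊥-elim (absurd 1 4 0 refl e)
    cases 2 _ e = ⊥-elim (absurd 2 2 0 refl e)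
    cases 3 _ e = ⊥-elim (absurd 3 4 1 refl e)
    cases 4 _ e = ⊥-elim (absurd 4 1 0 refl e)
    cases 5 _ e = ⊥-elim (absurd 5 4 2 refl e)
    cases 6 _ e = ⊥-elim (absurd 6 2 1 refl e)
    cases 7 _ e = ⊥-elim (absurd 7 4 3 refl e)
    cases (suc (suc (suc (suc (suc (suc (suc (suc _)))))))) (s≤s (s≤s (s≤s (s≤s (s≤s (s≤s (s≤s (s≤s ())))))))) _

  θ-injective-≤ : ∀ a b → a ℕ.≤ b → θ ^ a ≡ θ ^ b ⟦ fermat ⟧ → + a ≡ + b ⟦ + 8 ⟧
  θ-injective-≤ a b a≤b e = symᵐ (+ q by trans (cong +_ (sym (trans (cong (λ z → a ℕ.+ z) (sym c≡)) (ℕₚ.m+[n∸m]≡n a≤b)))) (cong (λ z → + a + z) (ℤₚ.pos-* q 8)))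
    where
    c = b ℕ.∸ a
    q = c DM./ 8
    r = c DM.% 8
    θc : θ ^ c ≡ + 1 ⟦ fermat ⟧
    θc = symᵐ (invertible-cancel (θ-invertible a) (transᵐ (≡⇒≡ᵐ (ℤₚ.*-identityʳ (θ ^ a)))
      (transᵐ e (≡⇒≡ᵐ (trans (cong (θ ^_) (sym (ℕₚ.m+[n∸m]≡n a≤b))) (ℤₚ.^-distribˡ-+-* θ a c))))))
    r≡0 : r ≡ 0
    r≡0 = θ≢1 r (DM.m%n<n c 8) (transᵐ (symᵐ (θ-periodic r q)) (transᵐ (≡⇒≡ᵐ (cong (θ ^_) (sym (DM.m≡m%n+[m/n]*n c 8)))) θc))
    c≡ : c ≡ q ℕ.* 8
    c≡ = trans (DM.m≡m%n+[m/n]*n c 8) (cong (ℕ._+ q ℕ.* 8) r≡0)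

  θ-injective : ∀ a b → θ ^ a ≡ θ ^ b ⟦ fermat ⟧ → + a ≡ + b ⟦ + 8 ⟧
  θ-injective a b e with ℕₚ.≤-total a b
  ... | inj₁ p = θ-injective-≤ a b p e
  ... | inj₂ p = symᵐ (θ-injective-≤ b a p (symᵐ e))

-- The Gauss sums depend on the Fermat number through these properties only, so they are evaluated
-- over an abstract modulus.
record GaussCharacter (κ : ℕ) : Set where
  field
    modulus         : ℤ
    χ               : ℤ → ℤ
    θ               : ℤ
    χ-periodic      : Periodic modulus (2 ℕ.^ (3 ℕ.+ κ)) χ
    χ-character     : Character modulus χ
    χ-order         : Order modulus χ (3 ℕ.+ κ)
    χ-θ             : ∀ n → χ (+ n * pow2ℕ κ) ≡ θ ^ n ⟦ modulus ⟧
    θ⁴              : θ ^ 4 ≡ - + 1 ⟦ modulus ⟧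
    θ-periodic      : ∀ n q → θ ^ (n ℕ.+ q ℕ.* 8) ≡ θ ^ n ⟦ modulus ⟧
    θ-invertible    : ∀ n → Invertible modulus (θ ^ n)
    θ-injective     : ∀ a b → θ ^ a ≡ θ ^ b ⟦ modulus ⟧ → + a ≡ + b ⟦ + 8 ⟧
    pow2-invertible : ∀ n → Invertible modulus (pow2ℕ n)
    1≢0             : ¬ (+ 1 ≡ + 0 ⟦ modulus ⟧)

gaussCharacter : ∀ κ → GaussCharacter κ
gaussCharacter κ = record
  { modulus = fermat ; χ = χ ; θ = θ ; χ-periodic = χ-periodic ; χ-character = χ-character ; χ-order = χ-order
  ; χ-θ = χ-θ ; θ⁴ = θ⁴ ; θ-periodic = θ-periodic ; θ-invertible = θ-invertible ; θ-injective = θ-injective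
  ; pow2-invertible = pow2-invertible ; 1≢0 = 1≢0 }
  where open FermatCharacter κ

-- Gauss sums of quadratic forms and of single terms

quad : ∀ {u} → Mat u u → Vector u → ℤ
quad {u} A x = ∑ u (λ i → x i * (A ⊛ x) i)

quad-isometry : ∀ {m u v} {A : Mat u u} {B : Mat v v} {P Q} → IsIsometry m A B P Q →
  ∀ y → quad B y ≡ quad A (P ⊛ y) ⟦ m ⟧
quad-isometry {A = A} {B} {P} φ y = symᵐ (
  transᵐ (⊡-congʳ (A ⊡ (P ⊡ c)) (ᵀ-⊡ P c) tt tt)
  (transᵐ (⊡-assoc (c ᵀ) (P ᵀ) (A ⊡ (P ⊡ c)) tt tt)
  (⊡-congˡ (c ᵀ) (≃-trans (≃-sym (⊡-assoc (P ᵀ) A (P ⊡ c))) (≃-trans (≃-sym (⊡-assoc ((P ᵀ) ⊡ A) P c)) (⊡-congʳ c (gram φ)))) tt tt)))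
  where c = column y

quad-⊞ : ∀ {u v} (A : Mat u u) (B : Mat v v) z → quad (A ⊞ B) z ≡ quad A (z ∘ inj₁) + quad B (z ∘ inj₂)
quad-⊞ {u} {v} A B z = cong₂ _+_
  (∑-cong u (λ i → cong (z (inj₁ i) *_) (trans (cong (λ w → (A ⊛ (z ∘ inj₁)) i + w) (∑-zero v)) (ℤₚ.+-identityʳ _))))
  (∑-cong v (λ i → cong (z (inj₂ i) *_) (trans (cong (_+ (B ⊛ (z ∘ inj₂)) i) (∑-zero u)) (ℤₚ.+-identityˡ _))))

quad-periodic : ∀ {u} (A : Mat u u) m {x y : Vector u} → x ≈ y ⟦ m ⟧ → quad A x ≡ quad A y ⟦ m ⟧
quad-periodic {u} A m e = ∑-congᵐ u (λ i → *-congᵐ (e i) (∑-congᵐ u (λ j → *-congˡᵐ (A i j) (e j))))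

reindex-2^ : ∀ {m} k {u v} {P : Mat u v} {Q : Mat v u} →
  P ⊡ Q ≃ δ u ⟦ pow2ℕ k ⟧ → Q ⊡ P ≃ δ v ⟦ pow2ℕ k ⟧ →
  (F : Vector u → ℤ) (H : Vector v → ℤ) → PeriodicV m (2 ℕ.^ k) F → (∀ y → H y ≡ F (P ⊛ y) ⟦ m ⟧) →
  vectors (2 ℕ.^ k) u F ≡ vectors (2 ℕ.^ k) v H ⟦ m ⟧
reindex-2^ k {P = P} {Q} = positive (2 ℕ.^ k) (ℕₚ.m^n>0 2 k) {P = P} {Q}
  where
  -- The reindexing lemma is stated for a modulus `suc M`; generalizing `2 ^ k` to a positive number
  -- makes this form visible.
  positive : ∀ {m} M → 0 ℕ.< M → ∀ {u v} {P : Mat u v} {Q : Mat v u} →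
    P ⊡ Q ≃ δ u ⟦ + M ⟧ → Q ⊡ P ≃ δ v ⟦ + M ⟧ →
    (F : Vector u → ℤ) (H : Vector v → ℤ) → PeriodicV m M F → (∀ y → H y ≡ F (P ⊛ y) ⟦ m ⟧) →
    vectors M u F ≡ vectors M v H ⟦ m ⟧
  positive (suc M) _ {P = P} {Q} = vectors-reindex M {P = P} {Q}

data Type : Set where
  type-I type-II : Type

type : Kind → Type
type II    = type-II
type (I _) = type-I

-- The residue mod 8 of the unit value s l.
ExpI : Sign → Label → ℕ
ExpI plus  G = 1
ExpI minus G = 5
ExpI plus  R = 7
ExpI minus R = 3

-- The exponent of θ that a term contributes to the Gauss sum at level d above its scale; the argument
-- of contribution₊ is d - 1.
contribution₊ : ℕ → Sign → Kind → ℕ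
contribution₊ zero          _     (I G) = 0
contribution₊ zero          _     (I R) = 6
contribution₊ zero          plus  II    = 0
contribution₊ zero          minus II    = 4
contribution₊ (suc zero)    s     (I l) = ExpI s l
contribution₊ (suc zero)    _     II    = 0
contribution₊ (suc (suc d)) s     k     = contribution₊ d s k

contribution : ℤ → Term → ℕ
contribution (+ suc d) (term _ s k) = contribution₊ d s k
contribution _         _            = 0

contribution₊-even : ∀ j s k → contribution₊ (j ℕ.* 2) s k ≡ contribution₊ 0 s k
contribution₊-even zero    s k = refl
contribution₊-even (suc j) s k = contribution₊-even j s k

contribution₊-odd : ∀ j s k → contribution₊ (1 ℕ.+ j ℕ.* 2) s k ≡ contribution₊ 1 s k
contribution₊-odd zero    s k = refl
contribution₊-odd (suc j) s k = contribution₊-odd j s k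

data Parity : ℕ → Set where
  even : ∀ j → Parity (j ℕ.* 2)
  odd  : ∀ j → Parity (1 ℕ.+ j ℕ.* 2)

parity : ∀ n → Parity n
parity zero    = even 0
parity (suc n) with parity n
... | even j = odd j
... | odd j  = even (suc j)

value-ExpI : ∀ s l → value s l ≡ + ExpI s l ⟦ + 8 ⟧
value-ExpI = from-yes (all-Sign? λ s → all-Label? λ l → value s l ≡ + ExpI s l ⟦8⟧?)

-- (value s l - 1) / 2
half : Sign → Label → ℤ
half plus  G = + 0
half minus G = - + 2
half plus  R = - + 1
half minus R = + 1

value-half : ∀ s l → value s l ≡ + 1 + half s l * + 2
value-half plus  G = refl
value-half minus G = refl
value-half plus  R = refl
value-half minus R = refl

4^≡ : ∀ j → 4^ j ≡ pow2ℕ (j ℕ.* 2)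
4^≡ zero    = refl
4^≡ (suc j) = trans (cong (+ 4 *_) (4^≡ j)) (sym (pow2ℕ-+ 2 (j ℕ.* 2)))

module GaussSum {κ : ℕ} (γ : GaussCharacter κ) where
  open GaussCharacter γ

  K k : ℕ
  K = 3 ℕ.+ κ
  k = 2 ℕ.+ κ

  gauss : ∀ {u} → Mat u u → ℤ
  gauss {u} A = vectors (2 ℕ.^ K) u (λ x → χ (quad A x))

  gauss-isometry : ∀ {u v} {A : Mat u u} {B : Mat v v} → A ≅ B → gauss A ≡ gauss B ⟦ modulus ⟧
  gauss-isometry {A = A} {B} φ = reindex-2^ K {P = at (to φ) K} {at (from φ) K} (PQ≃1 ψ) (QP≃1 ψ) (λ x → χ (quad A x)) (λ y → χ (quad B y))
    (λ e → χ-periodic (quad-periodic A _ e)) (λ y → χ-periodic (quad-isometry {A = A} {B} ψ y))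
    where ψ = isometry φ K

  gauss-⊞ : ∀ {u v} (A : Mat u u) (B : Mat v v) → gauss (A ⊞ B) ≡ gauss A * gauss B ⟦ modulus ⟧
  gauss-⊞ {u} {v} A B = transᵐ
    (vectors-cong (2 ℕ.^ K) (u ⊕ v) (λ z → transᵐ (≡⇒≡ᵐ (cong χ (quad-⊞ A B z))) (Character.ψ-+ χ-character (quad A (z ∘ inj₁)) (quad B (z ∘ inj₂)))))
    (vectors-⊕ (2 ℕ.^ K) u v (λ x → χ (quad A x)) (λ y → χ (quad B y)))

  scaled-order : ∀ e r q → e ℕ.+ r ≡ K → Order modulus (λ z → χ (pow2ℕ e * (+ 1 + q * + 2) * z)) r
  scaled-order e zero q eq = transᵐ (χ-periodic ((+ 1 + q * + 2) by trans (cong (λ n → pow2ℕ n * (+ 1 + q * + 2) * + 1) (trans (sym (ℕₚ.+-identityʳ e)) eq)) (lem (pow2ℕ K) (+ 1 + q * + 2)))) (Character.ψ-zero χ-character)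
    where
    lem : ∀ c a → c * a * + 1 ≡ + 0 + a * c
    lem = solve-∀
  scaled-order e (suc r) q eq = transᵐ (≡⇒≡ᵐ (cong χ (trans (lem (pow2ℕ e) (+ 1 + q * + 2) (pow2ℕ r)) (cong (λ c → + 0 + (+ 1 + q * + 2) * c) (trans (sym (pow2ℕ-+ e r)) (cong pow2ℕ (ℕₚ.suc-injective (trans (sym (ℕₚ.+-suc e r)) eq))))))))
    (transᵐ (ψ-antiperiodic χ-character k χ-order (+ 0) q) (-‿congᵐ (Character.ψ-zero χ-character)))
    where
    lem : ∀ c a d → c * a * d ≡ + 0 + a * (c * d)
    lem = solve-∀

  scaled-order-0 : ∀ e q → K ℕ.≤ e → Order modulus (λ z → χ (pow2ℕ e * (+ 1 + q * + 2) * z)) 0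
  scaled-order-0 e q p = transᵐ (χ-periodic ((pow2ℕ (e ℕ.∸ K) * (+ 1 + q * + 2)) by
      trans (cong (λ c → c * (+ 1 + q * + 2) * + 1) (trans (cong pow2ℕ (sym (ℕₚ.m+[n∸m]≡n p))) (pow2ℕ-+ K (e ℕ.∸ K)))) (lem (pow2ℕ K) (pow2ℕ (e ℕ.∸ K)) (+ 1 + q * + 2))))
    (Character.ψ-zero χ-character)
    where
    lem : ∀ c d a → c * d * a * + 1 ≡ + 0 + d * a * c
    lem = solve-∀

  character-I : ℕ → Sign → Label → ℤ → ℤ
  character-I e s l z = χ (pow2ℕ e * (+ 1 + half s l * + 2) * z)

  -- The exponent is `suc e` because the form of `hyp s` is twice `norm s`. The factor
  -- `+ 1 + + 0 * + 2` is the unit 1 written as in `scaled-order`.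
  character-II : ℕ → ℤ → ℤ
  character-II e z = χ (pow2ℕ (suc e) * (+ 1 + + 0 * + 2) * z)

  gauss-I : ∀ e s l → gauss (pow2ℕ e ∙ ⟨ value s l ⟩) ≡ sumSquares K (character-I e s l) ⟦ modulus ⟧
  gauss-I e s l = range-cong (2 ℕ.^ K) (λ x → ≡⇒≡ᵐ (cong χ (trans (lem (pow2ℕ e) (value s l) x) (cong (λ a → pow2ℕ e * a * (x * x)) (value-half s l)))))
    where
    lem : ∀ c a x → x * (c * a * x) ≡ c * a * (x * x)
    lem = solve-∀

  gauss-II : ∀ e s → gauss (pow2ℕ e ∙ hyp s) ≡ sumNorms s K (character-II e) ⟦ modulus ⟧
  gauss-II e s = range-cong (2 ℕ.^ K) (λ x → range-cong (2 ℕ.^ K) (λ y → ≡⇒≡ᵐ (cong χ (trans (lem s x y) (cong (λ c → c * (+ 1 + + 0 * + 2) * norm s x y) (sym (pow2ℕ-suc e)))))))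
    where
    c = pow2ℕ e
    lem₊ : ∀ c x y → x * (c * + 0 * x + c * + 1 * y) + y * (c * + 1 * x + c * + 0 * y) ≡ + 2 * c * (+ 1 + + 0 * + 2) * (x * y)
    lem₊ = solve-∀
    lem₋ : ∀ c x y → x * (c * + 2 * x + c * + 1 * y) + y * (c * + 1 * x + c * + 2 * y) ≡ + 2 * c * (+ 1 + + 0 * + 2) * (x * x + x * y + y * y)
    lem₋ = solve-∀
    lem : ∀ s x y → quad (pow2ℕ e ∙ hyp s) [ (λ _ → x) , (λ _ → y) ] ≡ + 2 * c * (+ 1 + + 0 * + 2) * norm s x y
    lem plus  x y = lem₊ c x y
    lem minus x y = lem₋ c x y

  character-I-character : ∀ e s l → Character modulus (character-I e s l)
  character-I-character e s l = character-∘ χ-character (pow2ℕ e * (+ 1 + half s l * + 2))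

  character-II-character : ∀ e → Character modulus (character-II e)
  character-II-character e = character-∘ χ-character (pow2ℕ (suc e) * (+ 1 + + 0 * + 2))

  -- At level `k`, one less than `K`, the character has order 2 and takes opposite values on even
  -- and odd squares.
  gauss-I-vanish : ∀ s l → gauss (pow2ℕ k ∙ ⟨ value s l ⟩) ≡ + 0 ⟦ modulus ⟧
  gauss-I-vanish s l = transᵐ (gauss-I k s l) (sumSquares-vanish K (character-I-character k s l) (scaled-order k 1 (half s l) (ℕₚ.+-comm k 1)) (s≤s z≤n))

  χ-value : ∀ s l → χ (pow2ℕ κ * value s l) ≡ θ ^ ExpI s l ⟦ modulus ⟧
  χ-value s l = transᵐ (χ-periodic (multiple-of-8 (value-ExpI s l))) (χ-θ (ExpI s l))
    where
    lem : ∀ c y q → c * (y + q * + 8) ≡ y * c + q * (+ 8 * c)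
    lem = solve-∀
    multiple-of-8 : ∀ {x y} → x ≡ y ⟦ + 8 ⟧ → pow2ℕ κ * x ≡ y * pow2ℕ κ ⟦ pow2ℕ K ⟧
    multiple-of-8 {y = y} (q by refl) = q by trans (lem (pow2ℕ κ) y q) (cong (λ c → y * pow2ℕ κ + q * c) (sym (pow2ℕ-+ 3 κ)))

  χ-value-2 : ∀ s l → χ (pow2ℕ (suc κ) * value s l) ≡ θ ^ (2 ℕ.* ExpI s l) ⟦ modulus ⟧
  χ-value-2 s l = transᵐ (≡⇒≡ᵐ (cong χ (trans (cong (_* value s l) (pow2ℕ-suc κ)) (lem (pow2ℕ κ) (value s l)))))
    (transᵐ (Character.ψ-+ χ-character (pow2ℕ κ * value s l) (pow2ℕ κ * value s l)) (transᵐ (*-congᵐ (χ-value s l) (χ-value s l))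
      (≡⇒≡ᵐ (trans (sym (ℤₚ.^-distribˡ-+-* θ (ExpI s l) (ExpI s l))) (cong (λ n → θ ^ (ExpI s l ℕ.+ n)) (sym (ℕₚ.+-identityʳ (ExpI s l))))))))
    where
    lem : ∀ c a → + 2 * c * a ≡ c * a + c * a
    lem = solve-∀

  θ⁸ : θ ^ 8 ≡ + 1 ⟦ modulus ⟧
  θ⁸ = θ-periodic 0 1

  1+θ² : ℤ
  1+θ² = + 1 + θ ^ 2

  -- The product of `1 + θ²` and `1 - θ²` is `1 - θ⁴ = 2`.
  1+θ²-invertible : Invertible modulus 1+θ²
  1+θ²-invertible = record { inverse = (+ 1 - θ ^ 2) * inverse ½ ; c*inverse = transᵐ (≡⇒≡ᵐ (lem θ (inverse ½))) (transᵐ (*-congʳᵐ (+-congᵐ (reflᵐ {+ 1}) (-‿congᵐ θ⁴)) (inverse ½)) (c*inverse ½)) }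
    where
    ½ = pow2-invertible 1
    lem : ∀ t d → (+ 1 + t * (t * + 1)) * ((+ 1 - t * (t * + 1)) * d) ≡ (+ 1 - t * (t * (t * (t * + 1)))) * d
    lem = solve-∀

  -- Twice the unit is 2 mod 8 for givers and 6 for receivers, and `1 + θ⁶ = θ⁶ (1 + θ²)`. This is
  -- the origin of the 6 contributed by a receiver, and the reason why the sign is invisible here.
  1+χ-value-2 : ∀ s l → + 1 + χ (pow2ℕ (suc κ) * value s l) ≡ 1+θ² * θ ^ contribution₊ 0 s (I l) ⟦ modulus ⟧
  1+χ-value-2 s l = transᵐ (+-congᵐ (reflᵐ {+ 1}) (χ-value-2 s l)) (cases s l)
    where
    unit-factor : + 1 + θ ^ 2 ≡ 1+θ² * θ ^ 0 ⟦ modulus ⟧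
    unit-factor = ≡⇒≡ᵐ (sym (ℤₚ.*-identityʳ 1+θ²))
    lem : ∀ a b → (+ 1 + a) * b ≡ b + a * b
    lem = solve-∀
    receiver : + 1 + θ ^ 6 ≡ 1+θ² * θ ^ 6 ⟦ modulus ⟧
    receiver = symᵐ (transᵐ (≡⇒≡ᵐ (trans (lem (θ ^ 2) (θ ^ 6)) (cong (λ z → θ ^ 6 + z) (sym (ℤₚ.^-distribˡ-+-* θ 2 6)))))
      (transᵐ (+-congᵐ (reflᵐ {θ ^ 6}) θ⁸) (≡⇒≡ᵐ (ℤₚ.+-comm (θ ^ 6) (+ 1)))))
    cases : ∀ s l → + 1 + θ ^ (2 ℕ.* ExpI s l) ≡ 1+θ² * θ ^ contribution₊ 0 s (I l) ⟦ modulus ⟧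
    cases plus  G = unit-factor
    cases minus G = transᵐ (+-congᵐ (reflᵐ {+ 1}) (θ-periodic 2 1)) unit-factor
    cases plus  R = transᵐ (+-congᵐ (reflᵐ {+ 1}) (θ-periodic 6 1)) receiver
    cases minus R = receiver

  signed2-θ : ∀ s → signed2 s ≡ pow2ℕ 1 * θ ^ contribution₊ 0 s II ⟦ modulus ⟧
  signed2-θ plus  = reflᵐ
  signed2-θ minus = *-congˡᵐ (+ 2) (symᵐ θ⁴)

  gaussT : ℕ → Sign → Kind → ℤ
  gaussT e s kd = gauss (pow2ℕ e ∙ base s kd)

  -- The factor `c` is chosen before the sign and the label, so symbols of the same shape have the
  -- same factor and it can be cancelled.
  TermValue : Type → ℕ → ℕ → Set
  TermValue t e d = ∃[ c ] Invertible modulus c × (∀ s kd → type kd ≡ t → gaussT e s kd ≡ c * θ ^ contribution₊ d s kd ⟦ modulus ⟧)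

  value-at : ∀ e s l j i → e ℕ.+ j ℕ.* 2 ≡ i → character-I e s l (4^ j) ≡ χ (pow2ℕ i * value s l) ⟦ modulus ⟧
  value-at e s l j i eq = ≡⇒≡ᵐ (cong χ (trans (cong (λ c → pow2ℕ e * (+ 1 + half s l * + 2) * c) (4^≡ j))
    (trans (lem (pow2ℕ e) (+ 1 + half s l * + 2) (pow2ℕ (j ℕ.* 2))) (cong₂ _*_ (trans (sym (pow2ℕ-+ e (j ℕ.* 2))) (cong pow2ℕ eq)) (sym (value-half s l))))))
    where
    lem : ∀ c a d → c * a * d ≡ c * d * a
    lem = solve-∀

  -- Since `K` is `suc k`, an odd distance `k - e` leaves a character whose order has the even
  -- exponent `K - e`. Its sum is `1 + ψ` of a power of 4, up to a power of 2.
  termValue-I-odd : ∀ j e → e ℕ.+ suc (j ℕ.* 2) ≡ k → TermValue type-I e (j ℕ.* 2)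
  termValue-I-odd j e eq = pow2ℕ (K ℕ.∸ suc j) * 1+θ² , invertible-* {c = pow2ℕ (K ℕ.∸ suc j)} {1+θ²} (pow2-invertible (K ℕ.∸ suc j)) 1+θ²-invertible , λ
    { s II () ; s (I l) _ → transᵐ (gauss-I e s l)
      (transᵐ (sumSquares-even j K (character-I-character e s l) (scaled-order e (2 ℕ.+ j ℕ.* 2) (half s l) r≡) (subst (2 ℕ.+ j ℕ.* 2 ℕ.≤_) r≡ (ℕₚ.m≤n+m (2 ℕ.+ j ℕ.* 2) e)))
      (transᵐ (*-congˡᵐ (pow2ℕ (K ℕ.∸ suc j)) (transᵐ (+-congᵐ (reflᵐ {+ 1}) (value-at e s l j (suc κ) i≡)) (1+χ-value-2 s l)))
      (≡⇒≡ᵐ (trans (sym (ℤₚ.*-assoc (pow2ℕ (K ℕ.∸ suc j)) 1+θ² (θ ^ contribution₊ 0 s (I l)))) (cong (λ n → pow2ℕ (K ℕ.∸ suc j) * 1+θ² * θ ^ n) (sym (contribution₊-even j s (I l)))))))) }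
    where
    r≡ : e ℕ.+ (2 ℕ.+ j ℕ.* 2) ≡ K
    r≡ = trans (ℕₚ.+-suc e (suc (j ℕ.* 2))) (cong suc eq)
    i≡ : e ℕ.+ j ℕ.* 2 ≡ suc κ
    i≡ = ℕₚ.suc-injective (trans (sym (ℕₚ.+-suc e (j ℕ.* 2))) eq)

  termValue-I-even : ∀ j e → e ℕ.+ suc (1 ℕ.+ j ℕ.* 2) ≡ k → TermValue type-I e (1 ℕ.+ j ℕ.* 2)
  termValue-I-even j e eq = pow2ℕ (K ℕ.∸ suc j) , pow2-invertible (K ℕ.∸ suc j) , λ
    { s II () ; s (I l) _ → transᵐ (gauss-I e s l)
      (transᵐ (sumSquares-odd j K (character-I-character e s l) (scaled-order e (3 ℕ.+ j ℕ.* 2) (half s l) r≡) (subst (3 ℕ.+ j ℕ.* 2 ℕ.≤_) r≡ (ℕₚ.m≤n+m (3 ℕ.+ j ℕ.* 2) e)))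
      (*-congˡᵐ (pow2ℕ (K ℕ.∸ suc j)) (transᵐ (value-at e s l j κ i≡) (transᵐ (χ-value s l) (≡⇒≡ᵐ (cong (θ ^_) (sym (contribution₊-odd j s (I l)))))))))}
    where
    r≡ : e ℕ.+ (3 ℕ.+ j ℕ.* 2) ≡ K
    r≡ = trans (ℕₚ.+-suc e (2 ℕ.+ j ℕ.* 2)) (cong suc eq)
    i≡ : e ℕ.+ j ℕ.* 2 ≡ κ
    i≡ = ℕₚ.suc-injective (ℕₚ.suc-injective (trans (cong suc (sym (ℕₚ.+-suc e (j ℕ.* 2)))) (trans (sym (ℕₚ.+-suc e (1 ℕ.+ j ℕ.* 2))) eq)))

  -- The factor 2 in the form lowers the exponent of the order from `K - e` to the distance `k - e`
  -- itself, so for type II the parities of distance and exponent agree.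
  order-II : ∀ e d → e ℕ.+ suc d ≡ k → Order modulus (character-II e) (suc d)
  order-II e d eq = scaled-order (suc e) (suc d) (+ 0) (cong suc eq)

  termValue-II-odd : ∀ j e → e ℕ.+ suc (j ℕ.* 2) ≡ k → TermValue type-II e (j ℕ.* 2)
  termValue-II-odd j e eq = c * (c * pow2ℕ 1) , invertible-* {c = c} {c * pow2ℕ 1} (pow2-invertible (K ℕ.∸ suc j)) (invertible-* {c = c} {pow2ℕ 1} (pow2-invertible (K ℕ.∸ suc j)) (pow2-invertible 1)) , λ
    { s (I l) () ; s II _ → transᵐ (gauss-II e s)
      (transᵐ (sumNorms-odd s j K (character-II-character e) (order-II e (j ℕ.* 2) eq) (ℕₚ.≤-trans (subst (suc (j ℕ.* 2) ℕ.≤_) eq (ℕₚ.m≤n+m _ e)) (ℕₚ.n≤1+n k)))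
      (transᵐ (*-congˡᵐ c (*-congˡᵐ c (signed2-θ s))) (≡⇒≡ᵐ (trans (lem c (pow2ℕ 1) _) (cong (λ n → c * (c * pow2ℕ 1) * θ ^ n) (sym (contribution₊-even j s II))))))) }
    where
    c = pow2ℕ (K ℕ.∸ suc j)
    lem : ∀ c d t → c * (c * (d * t)) ≡ c * (c * d) * t
    lem = solve-∀

  termValue-II-even : ∀ j e → e ℕ.+ suc (1 ℕ.+ j ℕ.* 2) ≡ k → TermValue type-II e (1 ℕ.+ j ℕ.* 2)
  termValue-II-even j e eq = c * c , invertible-* {c = c} {c} (pow2-invertible (K ℕ.∸ suc j)) (pow2-invertible (K ℕ.∸ suc j)) , λ
    { s (I l) () ; s II _ → transᵐ (gauss-II e s)
      (transᵐ (sumNorms-even s (suc j) K (character-II-character e) (order-II e (1 ℕ.+ j ℕ.* 2) eq) (ℕₚ.≤-trans (subst (2 ℕ.+ (j ℕ.* 2) ℕ.≤_) eq (ℕₚ.m≤n+m _ e)) (ℕₚ.n≤1+n k)))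
      (≡⇒≡ᵐ (trans (sym (ℤₚ.*-identityʳ (c * c))) (cong (λ n → c * c * θ ^ n) (sym (contribution₊-odd j s II)))))) }
    where
    c = pow2ℕ (K ℕ.∸ suc j)

  termValue : ∀ t d e → e ℕ.+ suc d ≡ k → TermValue t e d
  termValue t d e eq with parity d
  termValue type-I  _ e eq | even j = termValue-I-odd j e eq
  termValue type-I  _ e eq | odd j  = termValue-I-even j e eq
  termValue type-II _ e eq | even j = termValue-II-odd j e eq
  termValue type-II _ e eq | odd j  = termValue-II-even j e eq

  TermValue₀ : Type → ℕ → Set
  TermValue₀ t e = ∃[ c ] Invertible modulus c × (∀ s kd → type kd ≡ t → gaussT e s kd ≡ c ⟦ modulus ⟧)

  termValue₀-I : ∀ e → k ℕ.< e → TermValue₀ type-I e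
  termValue₀-I e p = pow2ℕ K , pow2-invertible K , λ
    { s II () ; s (I l) _ → transᵐ (gauss-I e s l) (sumSquares-trivial K (character-I-character e s l) (scaled-order-0 e (half s l) p)) }

  -- Because the form is even, the character is trivial already at `e = k`, the level at which a
  -- type I sum vanishes.
  termValue₀-II : ∀ e → k ℕ.≤ e → TermValue₀ type-II e
  termValue₀-II e p = pow2ℕ K * pow2ℕ K , invertible-* {c = pow2ℕ K} {pow2ℕ K} (pow2-invertible K) (pow2-invertible K) , λ
    { s (I l) () ; s II _ → transᵐ (gauss-II e s) (sumNorms-trivial s K (character-II-character e) (scaled-order-0 (suc e) (+ 0) (s≤s p))) }

-- Kernels modulo powers of 2

zeroV : ∀ {u} → Vector u
zeroV _ = + 0

kernelSize : ℕ → ∀ {u} → Mat u u → ℤ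
kernelSize k {u} A = vectors (2 ℕ.^ k) u (λ x → ind (A ⊛ x ≈ zeroV ⟦ pow2ℕ k ⟧?))

⊛-cong : ∀ {u v m} (A : Mat u v) {x y : Vector v} → x ≈ y ⟦ m ⟧ → A ⊛ x ≈ A ⊛ y ⟦ m ⟧
⊛-cong {v = v} A e i = ∑-congᵐ v (λ j → *-congˡᵐ (A i j) (e j))

⊛-zero : ∀ {u v m} (A : Mat u v) → A ⊛ zeroV ≈ zeroV ⟦ m ⟧
⊛-zero {v = v} A i = ≡⇒≡ᵐ (∑-*zero v (A i))

≈-trans : ∀ {u m} {x y z : Vector u} → x ≈ y ⟦ m ⟧ → y ≈ z ⟦ m ⟧ → x ≈ z ⟦ m ⟧
≈-trans p q i = transᵐ (p i) (q i)

gram-⊛ : ∀ {m u v} {A : Mat u u} {B : Mat v v} {P Q} → IsIsometry m A B P Q →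
  ∀ y → B ⊛ y ≈ (P ᵀ) ⊛ (A ⊛ (P ⊛ y)) ⟦ m ⟧
gram-⊛ {A = A} {B} {P} φ y i = symᵐ (transᵐ (symᵐ (⊡-assoc (P ᵀ) A (P ⊡ column y) i tt))
  (transᵐ (symᵐ (⊡-assoc ((P ᵀ) ⊡ A) P (column y) i tt)) (⊡-congʳ (column y) (gram φ) i tt)))

kernel-isometry : ∀ {m u v} {A : Mat u u} {B : Mat v v} {P Q} → IsIsometry m A B P Q →
  ∀ y → A ⊛ (P ⊛ y) ≈ zeroV ⟦ m ⟧ → B ⊛ y ≈ zeroV ⟦ m ⟧
kernel-isometry {P = P} φ y e = ≈-trans (gram-⊛ φ y) (≈-trans (⊛-cong (P ᵀ) e) (⊛-zero (P ᵀ)))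

kernelSize-isometry : ∀ k {u v} {A : Mat u u} {B : Mat v v} → A ≅ B → kernelSize k A ≡ kernelSize k B ⟦ + 0 ⟧
kernelSize-isometry k {A = A} {B} φ = reindex-2^ k {P = P} {Q} (PQ≃1 ψ) (QP≃1 ψ) _ _
  (λ e → ≡⇒≡ᵐ (ind-⇔ (_ ≈ _ ⟦ pow2ℕ k ⟧?) (_ ≈ _ ⟦ pow2ℕ k ⟧?)
    (≈-trans (⊛-cong A (λ i → symᵐ (e i)))) (≈-trans (⊛-cong A e))))
  (λ y → ≡⇒≡ᵐ (ind-⇔ (_ ≈ _ ⟦ pow2ℕ k ⟧?) (_ ≈ _ ⟦ pow2ℕ k ⟧?)
    (λ e → kernel-isometry {A = B} {A} {Q} {P} (isometry-sym ψ) (P ⊛ y) (≈-trans (⊛-cong B (λ i → symᵐ (⊛-inverse {P = P} {Q} {y = y} (QP≃1 ψ) (λ _ → reflᵐ) i))) e))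
    (kernel-isometry {A = A} {B} {P} {Q} ψ y)))
  where
  P = at (to φ) k
  Q = at (from φ) k
  ψ = isometry φ k

⊞-⊛₁ : ∀ {u v} (A : Mat u u) (B : Mat v v) z i → ((A ⊞ B) ⊛ z) (inj₁ i) ≡ (A ⊛ (z ∘ inj₁)) i
⊞-⊛₁ {v = v} A B z i = trans (cong (λ w → (A ⊛ (z ∘ inj₁)) i + w) (∑-zero* v (z ∘ inj₂))) (ℤₚ.+-identityʳ _)

⊞-⊛₂ : ∀ {u v} (A : Mat u u) (B : Mat v v) z i → ((A ⊞ B) ⊛ z) (inj₂ i) ≡ (B ⊛ (z ∘ inj₂)) i
⊞-⊛₂ {u} A B z i = trans (cong (_+ (B ⊛ (z ∘ inj₂)) i) (∑-zero* u (z ∘ inj₁))) (ℤₚ.+-identityˡ _)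

kernelSize-⊞ : ∀ k {u v} (A : Mat u u) (B : Mat v v) → kernelSize k (A ⊞ B) ≡ kernelSize k A * kernelSize k B ⟦ + 0 ⟧
kernelSize-⊞ k {u} {v} A B = transᵐ
  (vectors-cong (2 ℕ.^ k) (u ⊕ v) (λ z → ≡⇒≡ᵐ (trans
    (ind-⇔ ((A ⊞ B) ⊛ z ≈ zeroV ⟦ pow2ℕ k ⟧?) (A? (z ∘ inj₁) ×-dec B? (z ∘ inj₂))
      (λ e → (λ i → transᵐ (≡⇒≡ᵐ (sym (⊞-⊛₁ A B z i))) (e (inj₁ i))) , (λ i → transᵐ (≡⇒≡ᵐ (sym (⊞-⊛₂ A B z i))) (e (inj₂ i))))
      (λ { (p , q) (inj₁ i) → transᵐ (≡⇒≡ᵐ (⊞-⊛₁ A B z i)) (p i) ; (p , q) (inj₂ i) → transᵐ (≡⇒≡ᵐ (⊞-⊛₂ A B z i)) (q i) }))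
    (ind-× (A? (z ∘ inj₁)) (B? (z ∘ inj₂))))))
  (vectors-⊕ (2 ℕ.^ k) u v (λ x → ind (A? x)) (λ y → ind (B? y)))
  where
  A? : ∀ x → Dec (A ⊛ x ≈ zeroV ⟦ pow2ℕ k ⟧)
  A? x = A ⊛ x ≈ zeroV ⟦ pow2ℕ k ⟧?
  B? : ∀ x → Dec (B ⊛ x ≈ zeroV ⟦ pow2ℕ k ⟧)
  B? x = B ⊛ x ≈ zeroV ⟦ pow2ℕ k ⟧?

cancel-2 : ∀ {r x} → + 2 * x ≡ + 0 ⟦ pow2ℕ (suc r) ⟧ → x ≡ + 0 ⟦ pow2ℕ r ⟧
cancel-2 {r} {x} (q by e) = q by ℤₚ.*-cancelˡ-≡ (+ 2) x (+ 0 + q * pow2ℕ r)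
  (trans e (trans (cong (λ c → + 0 + q * c) (pow2ℕ-suc r)) (lem q (pow2ℕ r))))
  where
  lem : ∀ q c → + 0 + q * (+ 2 * c) ≡ + 2 * (+ 0 + q * c)
  lem = solve-∀

double-0 : ∀ {r x} → x ≡ + 0 ⟦ pow2ℕ r ⟧ → + 2 * x ≡ + 0 ⟦ pow2ℕ (suc r) ⟧
double-0 {r} {x} e = subst (λ c → + 2 * x ≡ + 0 ⟦ c ⟧) (sym (pow2ℕ-suc r)) (scaleᵐ (+ 2) e)

mod-2 : ∀ {r x} → x ≡ + 0 ⟦ pow2ℕ (suc r) ⟧ → x ≡ + 0 ⟦ + 2 ⟧
mod-2 {r} {x} e = weakenᵐ (pow2ℕ r) (subst (λ c → x ≡ + 0 ⟦ c ⟧) (trans (pow2ℕ-suc r) (ℤₚ.*-comm (+ 2) (pow2ℕ r))) e)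

odd≢0 : ∀ {x} q → x ≡ + 1 + q * + 2 → ¬ (x ≡ + 0 ⟦ + 2 ⟧)
odd≢0 {x} q refl e = 2≢1 (ℕD.∣1⇒≡1 (≡ᵐ⇒∣ {+ 1} {+ 0} (transᵐ ((- q) by lem q) e)))
  where
  2≢1 : 2 ≢ 1
  2≢1 ()
  lem : ∀ q → + 1 ≡ + 1 + q * + 2 + - q * + 2
  lem = solve-∀

-- The truncated difference covers `e ≥ k` as well, where both conditions are vacuous.
scaled-kernel : ∀ e k {u} (A : Mat u u) (x : Vector u) → ((pow2ℕ e ∙ A) ⊛ x ≈ zeroV ⟦ pow2ℕ k ⟧ → A ⊛ x ≈ zeroV ⟦ pow2ℕ (k ℕ.∸ e) ⟧) × (A ⊛ x ≈ zeroV ⟦ pow2ℕ (k ℕ.∸ e) ⟧ → (pow2ℕ e ∙ A) ⊛ x ≈ zeroV ⟦ pow2ℕ k ⟧)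
scaled-kernel e k {u} A x =
  (λ p i → proj₁ (main e k ((A ⊛ x) i)) (transᵐ (≡⇒≡ᵐ (sym (scale-⊛ i))) (p i))) ,
  (λ p i → transᵐ (≡⇒≡ᵐ (scale-⊛ i)) (proj₂ (main e k ((A ⊛ x) i)) (p i)))
  where
  scale-⊛ : ∀ i → ((pow2ℕ e ∙ A) ⊛ x) i ≡ pow2ℕ e * (A ⊛ x) i
  scale-⊛ i = ⊡-scaleˡ (pow2ℕ e) A (column x) i tt
  step : ∀ e z → pow2ℕ (suc e) * z ≡ + 2 * (pow2ℕ e * z)
  step e z = trans (cong (_* z) (pow2ℕ-suc e)) (ℤₚ.*-assoc (+ 2) (pow2ℕ e) z)
  main : ∀ e k z → (pow2ℕ e * z ≡ + 0 ⟦ pow2ℕ k ⟧ → z ≡ + 0 ⟦ pow2ℕ (k ℕ.∸ e) ⟧) × (z ≡ + 0 ⟦ pow2ℕ (k ℕ.∸ e) ⟧ → pow2ℕ e * z ≡ + 0 ⟦ pow2ℕ k ⟧)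
  main zero    k       z = transᵐ (≡⇒≡ᵐ (sym (ℤₚ.*-identityˡ z))) , transᵐ (≡⇒≡ᵐ (ℤₚ.*-identityˡ z))
  main (suc e) zero    z = (λ _ → z by lem z) , (λ _ → (pow2ℕ (suc e) * z) by lem (pow2ℕ (suc e) * z))
    where
    lem : ∀ z → z ≡ + 0 + z * + 1
    lem = solve-∀
  main (suc e) (suc k) z =
    (λ p → proj₁ (main e k z) (cancel-2 {k} (transᵐ (≡⇒≡ᵐ (sym (step e z))) p))) ,
    (λ p → transᵐ (≡⇒≡ᵐ (step e z)) (double-0 {k} (proj₂ (main e k z) p)))

-- For positive `r` a solution is even because `value s l` is odd, and halving it lowers `r` and `n`
-- together.
count-I : ∀ s l r n → r ℕ.≤ n → range (2 ℕ.^ n) (λ x → ind (base s (I l) ⊛ (λ _ → x) ≈ zeroV ⟦ pow2ℕ r ⟧?)) ≡ pow2ℕ (n ℕ.∸ r) ⟦ + 0 ⟧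
count-I s l zero n _ = transᵐ (range-cong (2 ℕ.^ n) (λ x → ≡⇒≡ᵐ (ind-yes (base s (I l) ⊛ (λ _ → x) ≈ zeroV ⟦ + 1 ⟧?) (λ _ → value s l * x by lem (value s l * x)))))
  (≡⇒≡ᵐ (trans (range-const (2 ℕ.^ n) (+ 1)) (ℤₚ.*-identityʳ (pow2ℕ n))))
  where
  lem : ∀ z → z ≡ + 0 + z * + 1
  lem = solve-∀
count-I s l (suc r) (suc n) (s≤s p) = transᵐ (≡⇒≡ᵐ (range-2^ n (λ x → ind (base s (I l) ⊛ (λ _ → x) ≈ zeroV ⟦ pow2ℕ (suc r) ⟧?)))) (transᵐ
  (+0ʳᵐ (transᵐ (range-cong (2 ℕ.^ n) (λ x → ≡⇒≡ᵐ (ind-no (base s (I l) ⊛ (λ _ → + 2 * x + + 1) ≈ zeroV ⟦ pow2ℕ (suc r) ⟧?)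
    (λ e → odd≢0 (half s l + x + + 2 * half s l * x) (trans (cong (_* (+ 2 * x + + 1)) (value-half s l)) (odd-lem (half s l) x)) (mod-2 {r} (e tt)))))) (≡⇒≡ᵐ (range-zero (2 ℕ.^ n)))))
  (transᵐ (range-cong (2 ℕ.^ n) (λ x → ≡⇒≡ᵐ (ind-⇔ (base s (I l) ⊛ (λ _ → + 2 * x) ≈ zeroV ⟦ pow2ℕ (suc r) ⟧?) (base s (I l) ⊛ (λ _ → x) ≈ zeroV ⟦ pow2ℕ r ⟧?)
    (λ e _ → cancel-2 {r} (transᵐ (≡⇒≡ᵐ (even-lem (value s l) x)) (e tt))) (λ e _ → transᵐ (≡⇒≡ᵐ (sym (even-lem (value s l) x))) (double-0 {r} (e tt))))))
  (count-I s l r n p)))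
  where
  odd-lem : ∀ h x → (+ 1 + h * + 2) * (+ 2 * x + + 1) ≡ + 1 + (h + x + + 2 * h * x) * + 2
  odd-lem = solve-∀
  even-lem : ∀ a x → + 2 * (a * x) ≡ a * (+ 2 * x)
  even-lem = solve-∀

pair : ℤ → ℤ → Vector (𝟙 ⊕ 𝟙)
pair x y = [ (λ _ → x) , (λ _ → y) ]

-- Modulo 2 both planes have the Gram matrix that exchanges the coordinates.
hyp-even : ∀ s {r} x y → hyp s ⊛ pair x y ≈ zeroV ⟦ pow2ℕ (suc r) ⟧ → (x ≡ + 0 ⟦ + 2 ⟧) × (y ≡ + 0 ⟦ + 2 ⟧)
hyp-even plus {r} x y e = transᵐ (≡⇒≡ᵐ (lem₂ x y)) (mod-2 {r} (e e₂)) , transᵐ (≡⇒≡ᵐ (lem₁ x y)) (mod-2 {r} (e e₁))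
  where
  lem₁ : ∀ x y → y ≡ + 0 * x + + 1 * y
  lem₁ = solve-∀
  lem₂ : ∀ x y → x ≡ + 1 * x + + 0 * y
  lem₂ = solve-∀
hyp-even minus {r} x y e = transᵐ ((- y) by lem₂ x y) (mod-2 {r} (e e₂)) , transᵐ ((- x) by lem₁ x y) (mod-2 {r} (e e₁))
  where
  lem₁ : ∀ x y → y ≡ + 2 * x + + 1 * y + - x * + 2
  lem₁ = solve-∀
  lem₂ : ∀ x y → x ≡ + 1 * x + + 2 * y + - y * + 2
  lem₂ = solve-∀

2x+1-odd : ∀ x → ¬ (+ 2 * x + + 1 ≡ + 0 ⟦ + 2 ⟧)
2x+1-odd x = odd≢0 x (lem x)
  where
  lem : ∀ x → + 2 * x + + 1 ≡ + 1 + x * + 2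
  lem = solve-∀

hyp-double : ∀ s x y i → (hyp s ⊛ pair (+ 2 * x) (+ 2 * y)) i ≡ + 2 * (hyp s ⊛ pair x y) i
hyp-double s x y i = lem (hyp s i e₁) (hyp s i e₂) x y
  where
  lem : ∀ a b x y → a * (+ 2 * x) + b * (+ 2 * y) ≡ + 2 * (a * x + b * y)
  lem = solve-∀

count-II : ∀ s r n → r ℕ.≤ n → range (2 ℕ.^ n) (λ x → range (2 ℕ.^ n) (λ y → ind (hyp s ⊛ pair x y ≈ zeroV ⟦ pow2ℕ r ⟧?))) ≡ pow2ℕ (n ℕ.∸ r) * pow2ℕ (n ℕ.∸ r) ⟦ + 0 ⟧
count-II s zero n _ = transᵐ (range-cong (2 ℕ.^ n) (λ x → transᵐ
    (range-cong (2 ℕ.^ n) (λ y → ≡⇒≡ᵐ (ind-yes (hyp s ⊛ pair x y ≈ zeroV ⟦ + 1 ⟧?) (λ i → (hyp s ⊛ pair x y) i by lem ((hyp s ⊛ pair x y) i)))))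
    (≡⇒≡ᵐ (trans (range-const (2 ℕ.^ n) (+ 1)) (ℤₚ.*-identityʳ (pow2ℕ n))))))
  (≡⇒≡ᵐ (range-const (2 ℕ.^ n) (pow2ℕ n)))
  where
  lem : ∀ z → z ≡ + 0 + z * + 1
  lem = solve-∀
count-II s (suc r) (suc n) (s≤s p) = transᵐ (≡⇒≡ᵐ (range-2^ n (λ x → range (2 ℕ.^ suc n) (f x))))
  (transᵐ (+0ʳᵐ (transᵐ (range-cong (2 ℕ.^ n) (λ x → transᵐ (range-cong (2 ℕ.^ suc n) (λ y → none (+ 2 * x + + 1) y (λ e → 2x+1-odd x (proj₁ (hyp-even s {r} (+ 2 * x + + 1) y e)))))
      (≡⇒≡ᵐ (range-zero (2 ℕ.^ suc n))))) (≡⇒≡ᵐ (range-zero (2 ℕ.^ n)))))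
  (transᵐ (range-cong (2 ℕ.^ n) (λ x → transᵐ (≡⇒≡ᵐ (range-2^ n (f (+ 2 * x))))
    (+0ʳᵐ (transᵐ (range-cong (2 ℕ.^ n) (λ y → none (+ 2 * x) (+ 2 * y + + 1) (λ e → 2x+1-odd y (proj₂ (hyp-even s {r} (+ 2 * x) (+ 2 * y + + 1) e))))) (≡⇒≡ᵐ (range-zero (2 ℕ.^ n)))))))
  (transᵐ (range-cong (2 ℕ.^ n) (λ x → range-cong (2 ℕ.^ n) (λ y → ≡⇒≡ᵐ (ind-⇔ (D? (suc r) (+ 2 * x) (+ 2 * y)) (D? r x y)
    (λ e i → cancel-2 {r} (transᵐ (≡⇒≡ᵐ (sym (hyp-double s x y i))) (e i))) (λ e i → transᵐ (≡⇒≡ᵐ (hyp-double s x y i)) (double-0 {r} (e i)))))))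
  (count-II s r n p))))
  where
  D? : ∀ r x y → Dec (hyp s ⊛ pair x y ≈ zeroV ⟦ pow2ℕ r ⟧)
  D? r x y = hyp s ⊛ pair x y ≈ zeroV ⟦ pow2ℕ r ⟧?
  f : ℤ → ℤ → ℤ
  f x y = ind (D? (suc r) x y)
  none : ∀ x y → ¬ (hyp s ⊛ pair x y ≈ zeroV ⟦ pow2ℕ (suc r) ⟧) → f x y ≡ + 0 ⟦ + 0 ⟧
  none x y ¬e = ≡⇒≡ᵐ (ind-no (D? (suc r) x y) ¬e)

kernelSize-block : ∀ k e s kd → kernelSize k (pow2ℕ e ∙ base s kd) ≡ pow2ℕ (rankK kd ℕ.* (k ℕ.∸ (k ℕ.∸ e))) ⟦ + 0 ⟧
kernelSize-block k e s II = transᵐ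
  (vectors-cong (2 ℕ.^ k) (𝟙 ⊕ 𝟙) (λ x → ≡⇒≡ᵐ (ind-⇔ ((pow2ℕ e ∙ hyp s) ⊛ x ≈ zeroV ⟦ pow2ℕ k ⟧?) (hyp s ⊛ x ≈ zeroV ⟦ pow2ℕ (k ℕ.∸ e) ⟧?)
    (proj₁ (scaled-kernel e k (hyp s) x)) (proj₂ (scaled-kernel e k (hyp s) x)))))
  (transᵐ (count-II s (k ℕ.∸ e) k (ℕₚ.m∸n≤m k e)) (≡⇒≡ᵐ (sym (trans (cong (λ n → pow2ℕ (c ℕ.+ n)) (ℕₚ.+-identityʳ c)) (pow2ℕ-+ c c)))))
  where c = k ℕ.∸ (k ℕ.∸ e)
kernelSize-block k e s (I l) = transᵐ
  (range-cong (2 ℕ.^ k) (λ x → ≡⇒≡ᵐ (ind-⇔ ((pow2ℕ e ∙ base s (I l)) ⊛ (λ _ → x) ≈ zeroV ⟦ pow2ℕ k ⟧?) (base s (I l) ⊛ (λ _ → x) ≈ zeroV ⟦ pow2ℕ (k ℕ.∸ e) ⟧?)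
    (proj₁ (scaled-kernel e k (base s (I l)) (λ _ → x))) (proj₂ (scaled-kernel e k (base s (I l)) (λ _ → x))))))
  (transᵐ (count-I s l (k ℕ.∸ e) k (ℕₚ.m∸n≤m k e)) (≡⇒≡ᵐ (cong pow2ℕ (sym (ℕₚ.+-identityʳ (k ℕ.∸ (k ℕ.∸ e)))))))

-- Invariants of symbols

-- The exponent h at the scale `2^j`; only its residue mod 8 has a meaning for the lattice.
expSum : ℤ → FineSymbol → ℕ
expSum j []      = 0
expSum j (t ∷ S) = contribution (j - scale t) t ℕ.+ expSum j S

typeT : Term → Type
typeT t = type (kind t)

SameShape : Term → Term → Set
SameShape t u = scale t ≡ scale u × typeT t ≡ typeT u

HasI : ℤ → FineSymbol → Set
HasI j = Any (λ t → typeT t ≡ type-I × scale t ≡ j)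

_≟ᵗ_ : (a b : Type) → Dec (a ≡ b)
type-I  ≟ᵗ type-I  = yes refl
type-I  ≟ᵗ type-II = no λ ()
type-II ≟ᵗ type-I  = no λ ()
type-II ≟ᵗ type-II = yes refl

hasI? : ∀ j S → Dec (HasI j S)
hasI? j = Any.any? (λ t → (typeT t ≟ᵗ type-I) ×-dec (scale t ℤ.≟ j))

-- Gauss sums of symbols

module _ {N : ℕ} where

  level-≡ : ∀ {t} → NonNeg N t → + level N t ≡ scale t + + N
  level-≡ (n , eq) = trans (cong (λ z → + ∣ z ∣) eq) (sym eq)

contribution-≤0 : ∀ d t → contribution (- + d) t ≡ 0
contribution-≤0 zero    t = refl
contribution-≤0 (suc d) t = refl

-- The equation `j≡` says that a term of scale `2^j` lies at level `k` after scaling by `2^N`, which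
-- ties the choice of character to the scale under investigation.
module SymbolGauss {κ : ℕ} (γ : GaussCharacter κ) (N : ℕ) (j : ℤ) (j≡ : j + + N ≡ + (2 ℕ.+ κ)) where
  open GaussCharacter γ
  open GaussSum γ

  gap : ∀ {t} → NonNeg N t → j - scale t ≡ + k - + level N t
  gap {t} p = trans (lem j (scale t) (+ N)) (cong₂ _-_ j≡ (sym (level-≡ {N} {t} p)))
    where
    lem : ∀ j s n → j - s ≡ j + n - (s + n)
    lem = solve-∀

  Uniform : Term → Set
  Uniform t = ∃[ c ] Invertible modulus c × (∀ s kd → type kd ≡ typeT t →
    gaussT (level N t) s kd ≡ c * θ ^ contribution (j - scale t) (term (scale t) s kd) ⟦ modulus ⟧)

  contribution-below : ∀ {t} → NonNeg N t → k ℕ.≤ level N t → ∀ s kd → contribution (j - scale t) (term (scale t) s kd) ≡ 0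
  contribution-below {t} p k≤e s kd = trans (cong (λ z → contribution z (term (scale t) s kd)) (trans (gap {t} p) (lem k (level N t) k≤e)))
    (contribution-≤0 (level N t ℕ.∸ k) (term (scale t) s kd))
    where
    lem′ : ∀ a b → a - (a + b) ≡ - b
    lem′ = solve-∀
    lem : ∀ a b → a ℕ.≤ b → + a - + b ≡ - + (b ℕ.∸ a)
    lem a b a≤b = trans (cong (λ z → + a - + z) (sym (ℕₚ.m+[n∸m]≡n a≤b))) (lem′ (+ a) (+ (b ℕ.∸ a)))

  uniform₀ : ∀ {t} → NonNeg N t → k ℕ.≤ level N t → TermValue₀ (typeT t) (level N t) → Uniform t
  uniform₀ {t} p k≤e (c , c⁻¹ , v) = c , c⁻¹ , λ s kd eq → transᵐ (v s kd eq)
    (≡⇒≡ᵐ (sym (trans (cong (λ n → c * θ ^ n) (contribution-below {t} p k≤e s kd)) (ℤₚ.*-identityʳ c))))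

  at-level-k : ∀ {t} → NonNeg N t → level N t ≡ k → scale t ≡ j
  at-level-k {t} p e≡k = trans (lem (scale t) (+ N)) (trans (cong (_- + N) (trans (sym (level-≡ {N} {t} p)) (trans (cong +_ e≡k) (sym j≡)))) (sym (lem j (+ N))))
    where
    lem : ∀ s n → s ≡ s + n - n
    lem = solve-∀

  uniform : ∀ t → NonNeg N t → ¬ (typeT t ≡ type-I × scale t ≡ j) → Uniform t
  uniform t p ¬I with ℕₚ.<-cmp (level N t) k
  ... | tri< e<k _ _ = let (c , c⁻¹ , v) = termValue (typeT t) d (level N t) e+d in
    c , c⁻¹ , λ s kd eq → transᵐ (v s kd eq) (≡⇒≡ᵐ (cong (λ z → c * θ ^ contribution z (term (scale t) s kd)) (sym d≡)))
    where
    d = k ℕ.∸ suc (level N t)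
    e+d : level N t ℕ.+ suc d ≡ k
    e+d = trans (ℕₚ.+-suc (level N t) d) (ℕₚ.m+[n∸m]≡n e<k)
    lem : ∀ a b → a + b - a ≡ b
    lem = solve-∀
    d≡ : j - scale t ≡ + suc d
    d≡ = trans (gap {t} p) (trans (cong (λ n → + n - + level N t) (sym e+d)) (lem (+ level N t) (+ suc d)))
  ... | tri≈ _ e≡k _ = uniform₀ {t} p (ℕₚ.≤-reflexive (sym e≡k)) (only-II (typeT t) (λ eq → ¬I (eq , at-level-k {t} p e≡k)))
    where
    only-II : ∀ τ → ¬ (τ ≡ type-I) → TermValue₀ τ (level N t)
    only-II type-I  ¬I = ⊥-elim (¬I refl)
    only-II type-II _  = termValue₀-II (level N t) (ℕₚ.≤-reflexive (sym e≡k))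
  ... | tri> _ _ e>k = uniform₀ {t} p (ℕₚ.<⇒≤ e>k) (either (typeT t))
    where
    either : ∀ τ → TermValue₀ τ (level N t)
    either type-I  = termValue₀-I (level N t) e>k
    either type-II = termValue₀-II (level N t) (ℕₚ.<⇒≤ e>k)

  GaussValue : ℤ → FineSymbol → Set
  GaussValue c S = gauss (gramS N S) ≡ c * θ ^ expSum j S ⟦ modulus ⟧

  combine : ∀ {c d g₁ g₂ a b} → g₁ ≡ c * θ ^ a ⟦ modulus ⟧ → g₂ ≡ d * θ ^ b ⟦ modulus ⟧ → g₁ * g₂ ≡ c * d * θ ^ (a ℕ.+ b) ⟦ modulus ⟧
  combine {c} {d} {a = a} {b} p q = transᵐ (*-congᵐ p q) (≡⇒≡ᵐ (trans (lem c d (θ ^ a) (θ ^ b)) (cong (c * d *_) (sym (ℤₚ.^-distribˡ-+-* θ a b)))))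
    where
    lem : ∀ c d x y → c * x * (d * y) ≡ c * d * (x * y)
    lem = solve-∀

  gaussValues : ∀ {S T} → Pointwise SameShape S T → All (NonNeg N) S → ¬ HasI j S →
    ∃[ c ] Invertible modulus c × GaussValue c S × GaussValue c T
  gaussValues [] [] _ = + 1 , invertible-1 , Character.ψ-zero χ-character , Character.ψ-zero χ-character
  gaussValues {term e s kd ∷ S} {term .e s' kd' ∷ T} ((refl , τ) ∷ sh) (p ∷ ps) ¬I =
    let (c , c⁻¹ , v) = uniform (term e s kd) p (¬I ∘ here)
        (d , d⁻¹ , vS , vT) = gaussValues sh ps (¬I ∘ there)
    in c * d , invertible-* {c = c} {d} c⁻¹ d⁻¹ ,
       transᵐ (gauss-⊞ (gramT N (term e s kd)) (gramS N S)) (combine {c} {d} {a = contribution (j - e) (term e s kd)} {expSum j S} (v s kd refl) vS) ,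
       transᵐ (gauss-⊞ (gramT N (term e s' kd')) (gramS N T)) (combine {c} {d} {a = contribution (j - e) (term e s' kd')} {expSum j T} (v s' kd' (sym τ)) vT)

  gauss-vanishes : ∀ {S} → All (NonNeg N) S → HasI j S → gauss (gramS N S) ≡ + 0 ⟦ modulus ⟧
  gauss-vanishes {t ∷ S} (p ∷ ps) (there h) = transᵐ (gauss-⊞ (gramT N t) (gramS N S))
    (transᵐ (*-congˡᵐ (gauss (gramT N t)) (gauss-vanishes ps h)) (≡⇒≡ᵐ (ℤₚ.*-zeroʳ (gauss (gramT N t)))))
  gauss-vanishes {term e s (I l) ∷ S} (p ∷ ps) (here (_ , e≡j)) = transᵐ (gauss-⊞ (gramT N (term e s (I l))) (gramS N S))
    (*-congʳᵐ (subst (λ n → gauss (pow2ℕ n ∙ ⟨ value s l ⟩) ≡ + 0 ⟦ modulus ⟧) (sym level≡k) (gauss-I-vanish s l)) (gauss (gramS N S)))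
    where
    level≡k : level N (term e s (I l)) ≡ k
    level≡k = ℤₚ.+-injective (trans (level-≡ {N} {term e s (I l)} p) (trans (cong (_+ + N) e≡j) j≡))

  expSum-invariant : ∀ {S T} → S ≅ˢ T ⟦ N ⟧ → All (NonNeg N) S → Pointwise SameShape S T → ¬ HasI j S →
    + expSum j S ≡ + expSum j T ⟦ + 8 ⟧
  expSum-invariant {S} {T} φ ps sh ¬I =
    let (c , c⁻¹ , vS , vT) = gaussValues sh ps ¬I
    in θ-injective (expSum j S) (expSum j T) (invertible-cancel {c = c} c⁻¹ (transᵐ (symᵐ vS) (transᵐ (gauss-isometry φ) vT)))

  -- Without a type I term at `2^j` the Gauss sum of `S` would be invertible, while that of `T`
  -- vanishes.
  hasI-invariant : ∀ {S T} → S ≅ˢ T ⟦ N ⟧ → All (NonNeg N) S → All (NonNeg N) T → HasI j T → HasI j S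
  hasI-invariant {S} {T} φ ps qs h with hasI? j S
  ... | yes h' = h'
  ... | no ¬h =
    let (c , c⁻¹ , vS , _) = gaussValues (PW.refl (refl , refl)) ps ¬h
        c·θ = invertible-* {c = c} {θ ^ expSum j S} c⁻¹ (θ-invertible (expSum j S))
        zero≡ : c * θ ^ expSum j S * + 1 ≡ c * θ ^ expSum j S * + 0 ⟦ modulus ⟧
        zero≡ = transᵐ (≡⇒≡ᵐ (ℤₚ.*-identityʳ (c * θ ^ expSum j S))) (transᵐ (symᵐ vS) (transᵐ (gauss-isometry φ)
          (transᵐ (gauss-vanishes qs h) (≡⇒≡ᵐ (sym (ℤₚ.*-zeroʳ (c * θ ^ expSum j S)))))))
    in ⊥-elim (1≢0 (invertible-cancel {c = c * θ ^ expSum j S} c·θ {+ 1} {+ 0} zero≡))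

-- The Gauss character has level at least 2; two extra powers of 2 bring every scale into its range.
NonNeg₂ : ℕ → Term → Set
NonNeg₂ N t = ∃[ n ] scale t + + N ≡ + (2 ℕ.+ n)

raise : ∀ {N t} → NonNeg N t → NonNeg₂ (2 ℕ.+ N) t
raise {N} {t} (n , eq) = n , trans (lem (scale t) (+ N)) (cong (λ z → + 2 + z) eq)
  where
  lem : ∀ s n → s + (+ 2 + n) ≡ + 2 + (s + n)
  lem = solve-∀

lower : ∀ {N t} → NonNeg₂ N t → NonNeg N t
lower (n , eq) = 2 ℕ.+ n , eq

gramS-raise : ∀ N S → All (NonNeg N) S → + 4 ∙ gramS N S ≐ gramS (2 ℕ.+ N) S
gramS-raise N (t ∷ S) (p ∷ ps) (inj₁ i) (inj₂ j) = refl
gramS-raise N (t ∷ S) (p ∷ ps) (inj₂ i) (inj₁ j) = refl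
gramS-raise N (t ∷ S) (p ∷ ps) (inj₂ i) (inj₂ j) = gramS-raise N S ps i j
gramS-raise N (t ∷ S) (p ∷ ps) (inj₁ i) (inj₁ j) = trans (sym (ℤₚ.*-assoc (+ 4) (pow2ℕ (level N t)) (base (sign t) (kind t) i j)))
  (cong (_* base (sign t) (kind t) i j) (trans (sym (pow2ℕ-+ 2 (level N t))) (cong pow2ℕ (sym level-raise))))
  where
  level-raise : level (2 ℕ.+ N) t ≡ 2 ℕ.+ level N t
  level-raise = ℤₚ.+-injective (trans (level-≡ {2 ℕ.+ N} {t} (lower {2 ℕ.+ N} {t} (raise {N} {t} p))) (trans (lem (scale t) (+ N)) (cong (λ z → + 2 + z) (sym (level-≡ {N} {t} p)))))
    where
    lem : ∀ s n → s + (+ 2 + n) ≡ + 2 + (s + n)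
    lem = solve-∀

raise-≅ : ∀ {N S T} → All (NonNeg N) S → All (NonNeg N) T → S ≅ˢ T ⟦ N ⟧ → S ≅ˢ T ⟦ 2 ℕ.+ N ⟧
raise-≅ {N} {S} {T} ps qs φ = ≅-trans (≅-sym (≅-≡ (gramS-raise N S ps))) (≅-trans (≅-scale (+ 4) φ) (≅-≡ (gramS-raise N T qs)))

-- expSum j is an invariant only at the scales 2^j without type I terms, where the Gauss sum does not vanish.
Invariant : FineSymbol → FineSymbol → Set
Invariant S T = ∀ j → ¬ HasI j S → + expSum j S ≡ + expSum j T ⟦ + 8 ⟧

-- Such a `j` lies below every scale of `S`. This settles the exponents that are too small to be
-- reached by a Gauss character.
above-zero : ∀ {N j S} → (∃[ n ] j + + N ≡ -[1+ n ]) → All (NonNeg N) S → expSum j S ≡ 0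
above-zero _ [] = refl
above-zero {N} {j} {t ∷ S} q@(n , eq) ((e , eq') ∷ ps) = cong₂ ℕ._+_
  (trans (cong (λ z → contribution z t) (trans (lem₁ j (scale t) (+ N)) (trans (cong₂ _-_ eq eq') (lem₂ (+ n) (+ e))))) (contribution-≤0 (suc n ℕ.+ e) t))
  (above-zero {N} {j} q ps)
  where
  lem₁ : ∀ j s n → j - s ≡ j + n - (s + n)
  lem₁ = solve-∀
  lem₂ : ∀ n e → - (+ 1 + n) - e ≡ - (+ 1 + n + e)
  lem₂ = solve-∀

≅⇒Invariant : ∀ {N S T} → All (NonNeg N) S → All (NonNeg N) T → S ≅ˢ T ⟦ N ⟧ → Pointwise SameShape S T → Invariant S T
≅⇒Invariant {N} {S} {T} ps qs φ sh j ¬I with j + + N in eq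
... | -[1+ n ] = ≡⇒≡ᵐ (cong +_ (trans (above-zero {N} {j} {S} (n , eq) ps) (sym (above-zero {N} {j} {T} (n , eq) qs))))
... | + κ = SymbolGauss.expSum-invariant (gaussCharacter κ) (2 ℕ.+ N) j (trans (lem j (+ N)) (cong (λ z → + 2 + z) eq))
    (raise-≅ ps qs φ) (All.map (λ {t} p → lower {2 ℕ.+ N} {t} (raise {N} {t} p)) ps) sh ¬I
  where
  lem : ∀ s n → s + (+ 2 + n) ≡ + 2 + (s + n)
  lem = solve-∀

HasI-NonNeg : ∀ {N j S} → All (NonNeg N) S → HasI j S → ∃[ n ] j + + N ≡ + n
HasI-NonNeg {N} {S = t ∷ S} ((n , eq) ∷ ps) (here (_ , e)) = n , trans (cong (_+ + N) (sym e)) eq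
HasI-NonNeg (p ∷ ps) (there h) = HasI-NonNeg ps h

≅⇒HasI : ∀ {N S T} → All (NonNeg N) S → All (NonNeg N) T → S ≅ˢ T ⟦ N ⟧ → ∀ j → HasI j T → HasI j S
≅⇒HasI {N} {S} {T} ps qs φ j h with HasI-NonNeg qs h
... | κ , eq = SymbolGauss.hasI-invariant (gaussCharacter κ) (2 ℕ.+ N) j (trans (lem j (+ N)) (cong (λ z → + 2 + z) eq))
    (raise-≅ ps qs φ) (All.map (λ {t} p → lower {2 ℕ.+ N} {t} (raise {N} {t} p)) ps) (All.map (λ {t} p → lower {2 ℕ.+ N} {t} (raise {N} {t} p)) qs) h
  where
  lem : ∀ s n → s + (+ 2 + n) ≡ + 2 + (s + n)
  lem = solve-∀

-- Ranks at each scale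

weight : (Term → ℕ) → FineSymbol → ℕ
weight f []      = 0
weight f (t ∷ S) = f t ℕ.+ weight f S

weight-+ : ∀ f g h S → (∀ t → f t ≡ g t ℕ.+ h t) → weight f S ≡ weight g S ℕ.+ weight h S
weight-+ f g h []      e = refl
weight-+ f g h (t ∷ S) e = trans (cong₂ ℕ._+_ (e t) (weight-+ f g h S e)) (lem (g t) (h t) (weight g S) (weight h S))
  where
  lem : ∀ a b c d → (a ℕ.+ b) ℕ.+ (c ℕ.+ d) ≡ (a ℕ.+ c) ℕ.+ (b ℕ.+ d)
  lem a b c d = trans (ℕₚ.+-assoc a b (c ℕ.+ d)) (trans (cong (a ℕ.+_) (trans (sym (ℕₚ.+-assoc b c d)) (trans (cong (ℕ._+ d) (ℕₚ.+-comm b c)) (ℕₚ.+-assoc c b d)))) (sym (ℕₚ.+-assoc a c (b ℕ.+ d))))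

weight-difference : ∀ {f g h} S T → (∀ t → f t ≡ g t ℕ.+ h t) → weight f S ≡ weight f T → weight g S ≡ weight g T → weight h S ≡ weight h T
weight-difference {f} {g} {h} S T e ef eg = ℕₚ.+-cancelˡ-≡ (weight g S) (weight h S) (weight h T)
  (trans (sym (weight-+ f g h S e)) (trans ef (trans (weight-+ f g h T e) (cong (ℕ._+ weight h T) (sym eg)))))

weight-↭ : ∀ f {S T} → S ↭ T → weight f S ≡ weight f T
weight-↭ f Perm.refl         = refl
weight-↭ f (Perm.prep t p)   = cong (f t ℕ.+_) (weight-↭ f p)
weight-↭ f (Perm.swap {xs = xs} {ys = ys} t u p) = trans (sym (ℕₚ.+-assoc (f t) (f u) (weight f xs))) (trans (cong₂ ℕ._+_ (ℕₚ.+-comm (f t) (f u)) (weight-↭ f p)) (ℕₚ.+-assoc (f u) (f t) (weight f ys)))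
weight-↭ f (Perm.trans p q)  = trans (weight-↭ f p) (weight-↭ f q)

bit : {P : Set} → Dec P → ℕ
bit d = if does d then 1 else 0

bit-yes : {P : Set} (d : Dec P) → P → bit d ≡ 1
bit-yes (yes _) p = refl
bit-yes (no ¬p) p = ⊥-elim (¬p p)

bit-no : {P : Set} (d : Dec P) → ¬ P → bit d ≡ 0
bit-no (yes p) ¬p = ⊥-elim (¬p p)
bit-no (no _)  ¬p = refl

module _ (N : ℕ) where

  -- k ∸ (k ∸ e) is the minimum of k and e; the other two weights are its first and second differences in k.
  kernelWeight aboveWeight atWeight : ℕ → Term → ℕ
  kernelWeight k t = rankK (kind t) ℕ.* (k ℕ.∸ (k ℕ.∸ level N t))
  aboveWeight  k t = rankK (kind t) ℕ.* bit (k ℕ.<? level N t)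
  atWeight     k t = rankK (kind t) ℕ.* bit (k ℕ.≟ level N t)

  kernelWeight-suc : ∀ k t → kernelWeight (suc k) t ≡ kernelWeight k t ℕ.+ aboveWeight k t
  kernelWeight-suc k t = trans (cong (rankK (kind t) ℕ.*_) (lem k (level N t))) (ℕₚ.*-distribˡ-+ (rankK (kind t)) (k ℕ.∸ (k ℕ.∸ level N t)) (bit (k ℕ.<? level N t)))
    where
    lem : ∀ k e → suc k ℕ.∸ (suc k ℕ.∸ e) ≡ (k ℕ.∸ (k ℕ.∸ e)) ℕ.+ bit (k ℕ.<? e)
    lem k e with ℕₚ.≤-<-connex e k
    ... | inj₂ k<e = trans (cong (suc k ℕ.∸_) (ℕₚ.m≤n⇒m∸n≡0 k<e)) (sym (trans
      (cong₂ (λ a b → k ℕ.∸ a ℕ.+ b) (ℕₚ.m≤n⇒m∸n≡0 (ℕₚ.<⇒≤ k<e)) (bit-yes (k ℕ.<? e) k<e)) (ℕₚ.+-comm k 1)))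
    ... | inj₁ e≤k = trans (ℕₚ.m∸[m∸n]≡n (ℕₚ.≤-trans e≤k (ℕₚ.n≤1+n k)))
      (sym (trans (cong₂ ℕ._+_ (ℕₚ.m∸[m∸n]≡n e≤k) (bit-no (k ℕ.<? e) (ℕₚ.≤⇒≯ e≤k))) (ℕₚ.+-identityʳ e)))

  aboveWeight-suc : ∀ k t → aboveWeight k t ≡ aboveWeight (suc k) t ℕ.+ atWeight (suc k) t
  aboveWeight-suc k t = trans (cong (rankK (kind t) ℕ.*_) (lem k (level N t))) (ℕₚ.*-distribˡ-+ (rankK (kind t)) (bit (suc k ℕ.<? level N t)) (bit (suc k ℕ.≟ level N t)))
    where
    lem : ∀ k e → bit (k ℕ.<? e) ≡ bit (suc k ℕ.<? e) ℕ.+ bit (suc k ℕ.≟ e)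
    lem k e with ℕₚ.<-cmp (suc k) e
    ... | tri< k<e k≢e _ = trans (bit-yes (k ℕ.<? e) (ℕₚ.<-trans (ℕₚ.n<1+n k) k<e))
      (sym (cong₂ ℕ._+_ (bit-yes (suc k ℕ.<? e) k<e) (bit-no (suc k ℕ.≟ e) k≢e)))
    ... | tri≈ k≮e k≡e _ = trans (bit-yes (k ℕ.<? e) (ℕₚ.≤-reflexive k≡e))
      (sym (cong₂ ℕ._+_ (bit-no (suc k ℕ.<? e) k≮e) (bit-yes (suc k ℕ.≟ e) k≡e)))
    ... | tri> k≮e k≢e e<k = trans (bit-no (k ℕ.<? e) (ℕₚ.≤⇒≯ (ℕₚ.≤-pred e<k)))
      (sym (cong₂ ℕ._+_ (bit-no (suc k ℕ.<? e) k≮e) (bit-no (suc k ℕ.≟ e) k≢e)))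

  kernelSize-gramS : ∀ k S → kernelSize k (gramS N S) ≡ pow2ℕ (weight (kernelWeight k) S) ⟦ + 0 ⟧
  kernelSize-gramS k []      = reflᵐ
  kernelSize-gramS k (t ∷ S) = transᵐ (kernelSize-⊞ k (gramT N t) (gramS N S))
    (transᵐ (*-congᵐ (kernelSize-block k (level N t) (sign t) (kind t)) (kernelSize-gramS k S))
    (≡⇒≡ᵐ (sym (pow2ℕ-+ (kernelWeight k t) (weight (kernelWeight k) S)))))

  pow2ℕ-injective : ∀ a b → pow2ℕ a ≡ pow2ℕ b → a ≡ b
  pow2ℕ-injective a b e with ℕₚ.<-cmp a b
  ... | tri< a<b _ _ = ⊥-elim (ℕₚ.<⇒≢ (ℕₚ.^-monoʳ-< 2 (s≤s (s≤s z≤n)) a<b) (ℤₚ.+-injective e))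
  ... | tri≈ _ a≡b _ = a≡b
  ... | tri> _ _ b<a = ⊥-elim (ℕₚ.<⇒≢ (ℕₚ.^-monoʳ-< 2 (s≤s (s≤s z≤n)) b<a) (sym (ℤₚ.+-injective e)))

  -- Differencing twice reaches only the levels `suc k`. This is enough once all terms have been
  -- raised to level at least 2.
  ≅⇒atWeight : ∀ {S T} → S ≅ˢ T ⟦ N ⟧ → ∀ k → weight (atWeight (suc k)) S ≡ weight (atWeight (suc k)) T
  ≅⇒atWeight {S} {T} φ k = weight-difference S T (aboveWeight-suc k) (above k) (above (suc k))
    where
    kernel : ∀ k → weight (kernelWeight k) S ≡ weight (kernelWeight k) T
    kernel k = pow2ℕ-injective _ _ (mod0 (transᵐ (symᵐ (kernelSize-gramS k S)) (transᵐ (kernelSize-isometry k φ) (kernelSize-gramS k T))))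
    above : ∀ k → weight (aboveWeight k) S ≡ weight (aboveWeight k) T
    above k = weight-difference S T (kernelWeight-suc k) (kernel (suc k)) (kernel k)

  rankK>0 : ∀ kd → 0 ℕ.< rankK kd
  rankK>0 II    = s≤s z≤n
  rankK>0 (I _) = s≤s z≤n

  atWeight-self : ∀ t → atWeight (level N t) t ≡ rankK (kind t)
  atWeight-self t = trans (cong (rankK (kind t) ℕ.*_) (bit-yes (level N t ℕ.≟ level N t) refl)) (ℕₚ.*-identityʳ (rankK (kind t)))

  weight-pos : ∀ k S → 0 ℕ.< weight (atWeight k) S → ∃[ u ] u ∈ S × k ≡ level N u
  weight-pos k (t ∷ S) p with toSum (k ℕ.≟ level N t)
  ... | inj₁ e = t , here refl , e
  ... | inj₂ ¬e =
      let (u , u∈S , e) = weight-pos k S (subst (λ n → 0 ℕ.< n ℕ.+ weight (atWeight k) S)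
            (trans (cong (rankK (kind t) ℕ.*_) (bit-no (k ℕ.≟ level N t) ¬e)) (ℕₚ.*-zeroʳ (rankK (kind t)))) p)
      in u , there u∈S , e

  Compatible : FineSymbol → FineSymbol → Set
  Compatible S T = ∀ {t u} → t ∈ S → u ∈ T → scale t ≡ scale u → typeT t ≡ typeT u

  level-suc : ∀ {t} → NonNeg₂ N t → ∃[ n ] level N t ≡ suc n
  level-suc (n , eq) = suc n , cong ∣_∣ eq

  scale-level : ∀ {t u} → NonNeg N t → NonNeg N u → level N t ≡ level N u → scale t ≡ scale u
  scale-level {t} {u} p q e = trans (lem (scale t) (+ N)) (trans (cong (_- + N) (trans (sym (level-≡ {N} {t} p)) (trans (cong +_ e) (level-≡ {N} {u} q)))) (sym (lem (scale u) (+ N))))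
    where
    lem : ∀ s n → s ≡ s + n - n
    lem = solve-∀

  -- Terms of `S` and `T` at one scale have the same type, hence the same rank, so removing one from
  -- each side keeps the total ranks equal and the pairing can continue.
  match-shapes : ∀ S T → All (NonNeg₂ N) S → All (NonNeg₂ N) T → Compatible S T →
    (∀ k → weight (atWeight (suc k)) S ≡ weight (atWeight (suc k)) T) → ∃[ T' ] T ↭ T' × Pointwise SameShape S T'
  match-shapes [] [] _ _ _ _ = [] , ↭-refl , []
  match-shapes [] (u ∷ T) _ (q ∷ qs) _ e with level-suc {u} q
  ... | n , l≡ = ⊥-elim (ℕₚ.<⇒≢ (ℕₚ.≤-trans (rankK>0 (kind u)) (subst (ℕ._≤ weight (atWeight (suc n)) (u ∷ T))
      (trans (cong (λ k → atWeight k u) (sym l≡)) (atWeight-self u)) (ℕₚ.m≤m+n _ _))) (e n))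
  match-shapes (t ∷ S) T (p ∷ ps) qs c e with level-suc {t} p
  ... | n , l≡ with weight-pos (suc n) T (subst (0 ℕ.<_) (e n) (ℕₚ.≤-trans (rankK>0 (kind t)) (subst (ℕ._≤ weight (atWeight (suc n)) (t ∷ S))
      (trans (cong (λ k → atWeight k t) (sym l≡)) (atWeight-self t)) (ℕₚ.m≤m+n _ _))))
  ... | u , u∈T , l'≡ with Memₚ.∈-∃++ u∈T
  ... | xs , ys , refl =
    let r : xs ++ u ∷ ys ↭ u ∷ xs ++ ys
        r = Permₚ.shift u xs ys
        u-nonneg = All.lookup qs u∈T
        s≡ = scale-level {t} {u} (lower {N} {t} p) (lower {N} {u} u-nonneg) (trans l≡ l'≡)
        τ≡ = c (here refl) u∈T s≡
        (T' , r' , sh) = match-shapes S (xs ++ ys) ps (All.tail (Permₚ.All-resp-↭ r qs))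
          (λ a b → c (there a) (Permₚ.∈-resp-↭ (↭-sym r) (there b)))
          (λ k → ℕₚ.+-cancelˡ-≡ (atWeight (suc k) t) _ _ (trans (e k) (trans (weight-↭ (atWeight (suc k)) r)
            (cong (ℕ._+ weight (atWeight (suc k)) (xs ++ ys)) (same-weight k u s≡ τ≡)))))
    in u ∷ T' , ↭-trans r (Perm.prep u r') , (s≡ , τ≡) ∷ sh
    where
    rank-type : ∀ a b → type a ≡ type b → rankK a ≡ rankK b
    rank-type II    II    _ = refl
    rank-type (I _) (I _) _ = refl
    same-weight : ∀ k u → scale t ≡ scale u → typeT t ≡ typeT u → atWeight (suc k) u ≡ atWeight (suc k) t
    same-weight k u s≡ τ≡ = sym (cong₂ (λ r z → r ℕ.* bit (suc k ℕ.≟ ∣ z + + N ∣)) (rank-type (kind t) (kind u) τ≡) s≡)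

hasI-∈ : ∀ {S t} → t ∈ S → typeT t ≡ type-I → HasI (scale t) S
hasI-∈ (here refl)  τ = here (τ , refl)
hasI-∈ (there t∈S) τ = there (hasI-∈ t∈S τ)

∈-hasI : ∀ {j S} → HasI j S → ∃[ t ] t ∈ S × typeT t ≡ type-I × scale t ≡ j
∈-hasI (here {x = t} (τ , e)) = t , here refl , τ , e
∈-hasI (there h) with ∈-hasI h
... | t , t∈S , τ , e = t , there t∈S , τ , e

type-II⇒II : ∀ {k} → type k ≡ type-II → k ≡ II
type-II⇒II {II} _ = refl

fine-type : ∀ {S} → IsFine S → ∀ {j t} → HasI j S → t ∈ S → scale t ≡ j → typeT t ≡ type-I
fine-type fine {j} {t} h t∈S e with typeT t in eq
... | type-I  = refl
... | type-II with ∈-hasI h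
...   | w , w∈S , τ , e' with fine t∈S w∈S (type-II⇒II eq) (trans e' (sym e))
...     | w-II with () ← trans (sym τ) (cong type w-II)

-- The vanishing of Gauss sums determines the type at each scale, and given the type, the rank
-- determines the number of terms.
≅⇒sameShape : ∀ {N S T} → IsFine S → IsFine T → All (NonNeg N) S → All (NonNeg N) T → S ≅ˢ T ⟦ N ⟧ →
  ∃[ T' ] T ↭ T' × Pointwise SameShape S T'
≅⇒sameShape {N} {S} {T} fS fT ps qs φ = match-shapes (2 ℕ.+ N) S T
  (All.map (λ {t} → raise {N} {t}) ps) (All.map (λ {t} → raise {N} {t}) qs) compatible (≅⇒atWeight (2 ℕ.+ N) (raise-≅ ps qs φ))
  where
  compatible : Compatible (2 ℕ.+ N) S T
  compatible {t} {u} t∈S u∈T e with typeT t in eqt | typeT u in equ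
  ... | type-I  | type-I  = refl
  ... | type-II | type-II = refl
  ... | type-I  | type-II = trans (sym (fine-type fT (≅⇒HasI {N} {T} {S} qs ps (≅-sym φ) (scale t) (hasI-∈ t∈S eqt)) u∈T (sym e))) equ
  ... | type-II | type-I  = trans (sym eqt) (fine-type fS (≅⇒HasI {N} {S} {T} ps qs φ (scale u) (hasI-∈ u∈T equ)) t∈S e)

-- Consequences of the local moves

∼-refl : ∀ {S} → S ∼ S
∼-refl = perm ↭-refl

∼-cons : ∀ t {S T} → S ∼ T → t ∷ S ∼ t ∷ T
∼-cons t (perm p) = perm (Perm.prep t p)
∼-cons t (move {C} {C'} m S) = ∼-trans (perm (↭-sym (Permₚ.shift t C S))) (∼-trans (move m (t ∷ S)) (perm (Permₚ.shift t C' S)))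
∼-cons t (∼-sym p) = ∼-sym (∼-cons t p)
∼-cons t (∼-trans p q) = ∼-trans (∼-cons t p) (∼-cons t q)

∼-swap : ∀ t u S → t ∷ u ∷ S ∼ u ∷ t ∷ S
∼-swap t u S = perm (Perm.swap t u ↭-refl)

-- Reordering exchanges the labels together with the signs; if the signs differ, a walk between the
-- two terms restores them.
exchange-same : ∀ e s l s' l' S → term e s (I l) ∷ term e s' (I l') ∷ S ∼ term e s (I l') ∷ term e s' (I l) ∷ S
exchange-same e plus  l plus  l' S = ∼-swap _ _ S
exchange-same e minus l minus l' S = ∼-swap _ _ S
exchange-same e plus  l minus l' S = ∼-trans (∼-swap _ _ S) (move (walk-I e minus l' plus l) S)
exchange-same e minus l plus  l' S = ∼-trans (∼-swap _ _ S) (move (walk-I e plus l' minus l) S)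

exchange-next : ∀ e s l s' l' S → term e s (I l) ∷ term (e + + 1) s' (I l') ∷ S ∼ term e s (I l') ∷ term (e + + 1) s' (I l) ∷ S
exchange-next e s G s' G S = ∼-refl
exchange-next e s R s' R S = ∼-refl
exchange-next e s G s' R S = move (exchange e s s' G) S
exchange-next e s R s' G S = move (exchange e s s' R) S

-- Permutation and conversion of labels along a chain

Slot : Set
Slot = ℤ × Sign

labelled : List Slot → List Label → FineSymbol
labelled = zipWith (λ (e , s) l → term e s (I l))

-- Neighbours have equal or adjacent scales, so exchanging the labels of neighbours is always a
-- composite of moves. A compartment takes this form when sorted.
data Chain : List Slot → Set where
  []   : Chain []
  [-]  : ∀ {x} → Chain (x ∷ [])
  same : ∀ {e s s' xs} → Chain ((e , s') ∷ xs) → Chain ((e , s) ∷ (e , s') ∷ xs)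
  next : ∀ {e s s' xs} → Chain ((e + + 1 , s') ∷ xs) → Chain ((e , s) ∷ (e + + 1 , s') ∷ xs)

chain-tail : ∀ {x xs} → Chain (x ∷ xs) → Chain xs
chain-tail [-]      = []
chain-tail (same c) = c
chain-tail (next c) = c

-- Transpositions of neighbours generate all permutations. The condition on lengths keeps `labelled`
-- from dropping slots or labels.
permute-labels : ∀ {xs} → Chain xs → ∀ {ls ls'} → length xs ≡ length ls → ls ↭ ls' → ∀ S →
  labelled xs ls ++ S ∼ labelled xs ls' ++ S
permute-labels c n Perm.refl S = ∼-refl
permute-labels {x ∷ xs} c n (Perm.prep l p) S = ∼-cons _ (permute-labels (chain-tail c) (ℕₚ.suc-injective n) p S)
permute-labels c n (Perm.trans p q) S = ∼-trans (permute-labels c n p S) (permute-labels c (trans n (Permₚ.↭-length p)) q S)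
permute-labels {_ ∷ _ ∷ xs} c n (Perm.swap l l' p) S = ∼-trans
  (∼-cons _ (∼-cons _ (permute-labels (chain-tail (chain-tail c)) (ℕₚ.suc-injective (ℕₚ.suc-injective n)) p S))) (first c)
  where
  first : ∀ {x y ls} → Chain (x ∷ y ∷ xs) → labelled (x ∷ y ∷ xs) (l ∷ l' ∷ ls) ++ S ∼ labelled (x ∷ y ∷ xs) (l' ∷ l ∷ ls) ++ S
  first (same c) = exchange-same _ _ l _ l' _
  first (next c) = exchange-next _ _ l _ l' _

_·ˢ_ : Sign → Sign → Sign
plus  ·ˢ s = s
minus ·ˢ s = flipS s

collect-sign : ∀ e s l s' l' S → term e s (I l) ∷ term e s' (I l') ∷ S ∼ term e plus (I l) ∷ term e (s ·ˢ s') (I l') ∷ S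
collect-sign e plus  l s' l' S = ∼-refl
collect-sign e minus l s' l' S = move (walk-I e minus l s' l') S

quadruple : ℤ → Sign → Sign → Sign → Sign → Label → FineSymbol → FineSymbol
quadruple e s₁ s₂ s₃ s₄ l S = term e s₁ (I l) ∷ term e s₂ (I l) ∷ term e s₃ (I l) ∷ term e s₄ (I l) ∷ S

collect-signs : ∀ e s₁ s₂ s₃ s₄ l S → quadruple e s₁ s₂ s₃ s₄ l S ∼ quadruple e plus plus plus (((s₁ ·ˢ s₂) ·ˢ s₃) ·ˢ s₄) l S
collect-signs e s₁ s₂ s₃ s₄ l S = ∼-trans (collect-sign e s₁ l s₂ l _)
  (∼-trans (∼-cons _ (collect-sign e (s₁ ·ˢ s₂) l s₃ l _)) (∼-cons _ (∼-cons _ (collect-sign e ((s₁ ·ˢ s₂) ·ˢ s₃) l s₄ l S))))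

convert-collected : ∀ e s S → quadruple e plus plus plus s G S ∼ quadruple e plus plus plus s R S
convert-collected e plus  S = move (convert+ e) S
convert-collected e minus S = ∼-trans (move (convert- e) S) (collect-signs e plus minus minus minus R S)

convert-same : ∀ e s₁ s₂ s₃ s₄ l S → quadruple e s₁ s₂ s₃ s₄ l S ∼ quadruple e s₁ s₂ s₃ s₄ (flipL l) S
convert-same e s₁ s₂ s₃ s₄ G S = ∼-trans (collect-signs e s₁ s₂ s₃ s₄ G S) (∼-trans (convert-collected e _ S) (∼-sym (collect-signs e s₁ s₂ s₃ s₄ R S)))
convert-same e s₁ s₂ s₃ s₄ R S = ∼-sym (convert-same e s₁ s₂ s₃ s₄ G S)

walk-next : ∀ e s s' l S → term e s (I l) ∷ term (e + + 1) s' (I l) ∷ S ∼ term e (flipS s) (I (flipL l)) ∷ term (e + + 1) (flipS s') (I (flipL l)) ∷ S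
walk-next e s s' l S = move (walk-≡ e s s' l) S

walk-back : ∀ e s s' l S → term e (flipS s) (I l) ∷ term (e + + 1) (flipS s') (I l) ∷ S ∼ term e s (I (flipL l)) ∷ term (e + + 1) s' (I (flipL l)) ∷ S
walk-back e s s' l S = subst₂ (λ a b → term e (flipS s) (I l) ∷ term (e + + 1) (flipS s') (I l) ∷ S ∼ term e a (I (flipL l)) ∷ term (e + + 1) b (I (flipL l)) ∷ S)
  (flipS-involutive s) (flipS-involutive s') (walk-next e (flipS s) (flipS s') l S)

resign : ∀ {e s s' xs} → Chain ((e , s) ∷ xs) → Chain ((e , s') ∷ xs)
resign [-]      = [-]
resign (same c) = same c
resign (next c) = next c

-- Walking twice between two adjacent scales restores the signs; permuting labels in between makes four labels change.
convert-chain : ∀ {x₁ x₂ x₃ x₄} → Chain (x₁ ∷ x₂ ∷ x₃ ∷ x₄ ∷ []) → ∀ l S →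
  labelled (x₁ ∷ x₂ ∷ x₃ ∷ x₄ ∷ []) (l ∷ l ∷ l ∷ l ∷ []) ++ S ∼
  labelled (x₁ ∷ x₂ ∷ x₃ ∷ x₄ ∷ []) (flipL l ∷ flipL l ∷ flipL l ∷ flipL l ∷ []) ++ S
convert-chain (same (same (same c))) l S = convert-same _ _ _ _ _ l S
convert-chain (next {e} {s} {s'} c) l S = ∼-trans (walk-next e s s' l _)
  (∼-trans (permute-labels (next {s = flipS s} (resign c)) {k ∷ k ∷ l ∷ l ∷ []} {l ∷ l ∷ k ∷ k ∷ []} refl (Permₚ.++-comm (k ∷ k ∷ []) (l ∷ l ∷ [])) S)
  (walk-back e s s' l _))
  where k = flipL l
convert-chain (same {s = s₀} (next {e} {s} {s'} c)) l S = ∼-trans (∼-cons _ (walk-next e s s' l _))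
  (∼-trans (permute-labels (same {s = s₀} (next {s = flipS s} (resign c))) {l ∷ k ∷ k ∷ l ∷ []} {k ∷ l ∷ l ∷ k ∷ []} refl (Perm.swap l k (Perm.swap k l ↭-refl)) S)
  (∼-cons _ (walk-back e s s' l _)))
  where k = flipL l
convert-chain (same {s = s₀} (same {s = s₁} (next {e} {s} {s'} [-]))) l S = ∼-trans (∼-cons _ (∼-cons _ (walk-next e s s' l _)))
  (∼-trans (permute-labels (same {s = s₀} (same {s = s₁} (next {s = flipS s} [-]))) {l ∷ l ∷ k ∷ k ∷ []} {k ∷ k ∷ l ∷ l ∷ []} refl (Permₚ.++-comm (l ∷ l ∷ []) (k ∷ k ∷ [])) S)
  (∼-cons _ (∼-cons _ (walk-back e s s' l _))))
  where k = flipL l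

-- Completeness of the invariants

After : Term → Term → Set
After t u = ∃[ d ] scale u ≡ scale t + + d × (d ≡ 0 → typeT u ≡ typeT t)

data Ordered : FineSymbol → Set where
  []  : Ordered []
  _∷_ : ∀ {t S} → All (After t) S → Ordered S → Ordered (t ∷ S)

ordered-tail : ∀ {t S} → Ordered (t ∷ S) → Ordered S
ordered-tail (_ ∷ o) = o

-- S does not contribute to the Gauss sum at the scale 2^(e+m), and does not make it vanish.
Clear : ℕ → ℤ → FineSymbol → Set
Clear m e = All (λ u → ∃[ d ] scale u ≡ e + + (m ℕ.+ d) × (d ≡ 0 → typeT u ≡ type-II))

sameShape-refl : ∀ {S} → Pointwise SameShape S S
sameShape-refl = PW.refl (refl , refl)

sameShape-sym : ∀ {S T} → Pointwise SameShape S T → Pointwise SameShape T S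
sameShape-sym = PW.symmetric (λ (e , τ) → sym e , sym τ)

sameShape-trans : ∀ {S T W} → Pointwise SameShape S T → Pointwise SameShape T W → Pointwise SameShape S W
sameShape-trans = PW.transitive (λ (e , τ) (e' , τ') → trans e e' , trans τ τ')

all-sameShape : ∀ {P : Term → Set} → (∀ {t u} → SameShape t u → P t → P u) → ∀ {S T} → Pointwise SameShape S T → All P S → All P T
all-sameShape f [] [] = []
all-sameShape f (s ∷ sh) (p ∷ ps) = f s p ∷ all-sameShape f sh ps

clear-sameShape : ∀ {m e S T} → Pointwise SameShape S T → Clear m e S → Clear m e T
clear-sameShape = all-sameShape λ (s , τ) (d , eq , ii) → d , trans (sym s) eq , λ d≡0 → trans (sym τ) (ii d≡0)

ordered-sameShape : ∀ {S T} → Pointwise SameShape S T → Ordered S → Ordered T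
ordered-sameShape [] [] = []
ordered-sameShape {t ∷ S} {u ∷ T} ((s , τ) ∷ sh) (a ∷ o) =
  all-sameShape {After u} (λ (s' , τ') (d , eq , k) → d , trans (sym s') eq , λ d≡0 → trans (sym τ') (k d≡0)) sh
    (All.map (λ (d , eq , k) → d , trans eq (cong (_+ + d) s) , λ d≡0 → trans (k d≡0) τ) a) ∷ ordered-sameShape sh o

hasI-sameShape : ∀ {j S T} → Pointwise SameShape S T → HasI j S → HasI j T
hasI-sameShape ((s , τ) ∷ sh) (here (i , e)) = here (trans (sym τ) i , trans (sym s) e)
hasI-sameShape (_ ∷ sh) (there h) = there (hasI-sameShape sh h)

+-+ : ∀ e a b → e + + a + + b ≡ e + + (a ℕ.+ b)
+-+ e a b = ℤₚ.+-assoc e (+ a) (+ b)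

clear-from : ∀ {m e d u S} → Ordered (u ∷ S) → scale u ≡ e + + (m ℕ.+ d) → (d ≡ 0 → typeT u ≡ type-II) → Clear m e (u ∷ S)
clear-from {m} {e} {d} {u} (a ∷ o) eq ii = (d , eq , ii) ∷ All.map
  (λ (d' , eq' , k) → d ℕ.+ d' ,
    trans eq' (trans (cong (_+ + d') eq) (trans (+-+ e (m ℕ.+ d) d') (cong (λ n → e + + n) (ℕₚ.+-assoc m d d')))) ,
    λ z → trans (k (ℕₚ.m+n≡0⇒n≡0 d z)) (ii (ℕₚ.m+n≡0⇒m≡0 d z))) a

clear-suc : ∀ {e S} → Clear 1 (e + + 1) S → Clear 2 e S
clear-suc {e} = All.map λ (d , eq , ii) → d , trans eq (+-+ e 1 (1 ℕ.+ d)) , ii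

expSum-++ : ∀ j S T → expSum j (S ++ T) ≡ expSum j S ℕ.+ expSum j T
expSum-++ j []      T = refl
expSum-++ j (t ∷ S) T = trans (cong (contribution (j - scale t) t ℕ.+_) (expSum-++ j S T)) (sym (ℕₚ.+-assoc (contribution (j - scale t) t) (expSum j S) (expSum j T)))

expSum-clear : ∀ {m e S} → Clear m e S → expSum (e + + m) S ≡ 0
expSum-clear [] = refl
expSum-clear {m} {e} {u ∷ S} ((d , eq , _) ∷ c) = cong₂ ℕ._+_
  (trans (cong (λ z → contribution (e + + m - z) u) eq) (trans (cong (λ z → contribution z u) (lem e (+ m) (+ d))) (contribution-≤0 d u)))
  (expSum-clear {m} {e} c)
  where
  lem : ∀ e m d → e + m - (e + (m + d)) ≡ - d
  lem = solve-∀

+-injectiveʳ : ∀ e {a b} → e + + a ≡ e + + b → a ≡ b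
+-injectiveʳ e {a} {b} eq = ℤₚ.+-injective (trans (lem e (+ a)) (trans (cong (_- e) eq) (sym (lem e (+ b)))))
  where
  lem : ∀ e a → a ≡ e + a - e
  lem = solve-∀

¬hasI-clear : ∀ {m e S} → Clear m e S → ¬ HasI (e + + m) S
¬hasI-clear {m} {e} ((d , eq , ii) ∷ c) (here (τ , e')) with ii (ℕₚ.+-cancelˡ-≡ m d 0 (trans (+-injectiveʳ e (trans (sym eq) e')) (sym (ℕₚ.+-identityʳ m))))
... | τ' with () ← trans (sym τ) τ'
¬hasI-clear {m} {e} (_ ∷ c) (there h) = ¬hasI-clear {m} {e} c h

-- The clear remainders contribute nothing at `2^(e+m)` and do not hide the invariant there, so it
-- compares the two prefixes alone.
cut : ∀ {m e S T} P P' → Invariant (P ++ S) (P' ++ T) → Clear m e S → Clear m e T → ¬ HasI (e + + m) P →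
  + expSum (e + + m) P ≡ + expSum (e + + m) P' ⟦ + 8 ⟧
cut {m} {e} {S} {T} P P' inv cS cT ¬I = transᵐ (≡⇒≡ᵐ (cong +_ (sym (total P cS)))) (transᵐ (inv (e + + m) ¬I') (≡⇒≡ᵐ (cong +_ (total P' cT))))
  where
  total : ∀ P {S} → Clear m e S → expSum (e + + m) (P ++ S) ≡ expSum (e + + m) P
  total P {S} c = trans (expSum-++ (e + + m) P S) (trans (cong (expSum (e + + m) P ℕ.+_) (expSum-clear {m} {e} c)) (ℕₚ.+-identityʳ _))
  ¬I' : ¬ HasI (e + + m) (P ++ S)
  ¬I' h = [ ¬I , ¬hasI-clear {m} {e} cS ] (Anyₚ.++⁻ P h)

contribution-1 : ∀ e t → scale t ≡ e → contribution (e + + 1 - scale t) t ≡ contribution₊ 0 (sign t) (kind t)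
contribution-1 e t refl = cong (λ z → contribution z t) (lem e)
  where
  lem : ∀ e → e + + 1 - e ≡ + 1
  lem = solve-∀

contribution-2 : ∀ e t → scale t ≡ e → contribution (e + + 2 - scale t) t ≡ contribution₊ 1 (sign t) (kind t)
contribution-2 e t refl = cong (λ z → contribution z t) (lem e)
  where
  lem : ∀ e → e + + 2 - e ≡ + 2
  lem = solve-∀

contribution-2-1 : ∀ e t → scale t ≡ e + + 1 → contribution (e + + 2 - scale t) t ≡ contribution₊ 0 (sign t) (kind t)
contribution-2-1 e t refl = cong (λ z → contribution z t) (lem e)
  where
  lem : ∀ e → e + + 2 - (e + + 1) ≡ + 1
  lem = solve-∀

infix 4 _⇝_
-- The relation `∼` may reorder terms; preserving shapes position by position keeps the symbol
-- sorted and paired with its partner.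
_⇝_ : FineSymbol → FineSymbol → Set
S ⇝ T = S ∼ T × Pointwise SameShape S T

⇝-refl : ∀ {S} → S ⇝ S
⇝-refl = ∼-refl , sameShape-refl

⇝-trans : ∀ {S T W} → S ⇝ T → T ⇝ W → S ⇝ W
⇝-trans (p , sh) (q , sh') = ∼-trans p q , sameShape-trans sh sh'

⇝-cons : ∀ t {S T} → S ⇝ T → t ∷ S ⇝ t ∷ T
⇝-cons t (p , sh) = ∼-cons t p , (refl , refl) ∷ sh

record State (N : ℕ) (S T : FineSymbol) : Set where
  constructor state
  field
    nonnegˡ   : All (NonNeg N) S
    nonnegʳ   : All (NonNeg N) T
    shape     : Pointwise SameShape S T
    ordered   : Ordered S
    invariant : Invariant S T
open State

invariant-sym : ∀ {S T} → Pointwise SameShape S T → Invariant S T → Invariant T S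
invariant-sym sh inv j ¬I = symᵐ (inv j (¬I ∘ hasI-sameShape sh))

invariant-trans : ∀ {S T W} → Pointwise SameShape S T → Invariant S T → Invariant T W → Invariant S W
invariant-trans sh inv inv' j ¬I = transᵐ (inv j ¬I) (inv' j (¬I ∘ hasI-sameShape (sameShape-sym sh)))

-- Obtained by way of the lattices: moves are isometries and isometries preserve the invariants, so
-- no move has to be checked against `expSum`.
⇝-invariant : ∀ {N S T} → All (NonNeg N) S → S ⇝ T → Invariant S T
⇝-invariant ps (p , sh) = ≅⇒Invariant ps (proj₁ (∼-NonNeg p) ps) (∼⇒≅ p ps) sh

state-sym : ∀ {N S T} → State N S T → State N T S
state-sym (state ps qs sh o inv) = state qs ps (sameShape-sym sh) (ordered-sameShape sh o) (invariant-sym sh inv)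

state-⇝ : ∀ {N S S' T} → S ⇝ S' → State N S T → State N S' T
state-⇝ {T = T} r@(p , sh') (state ps qs sh o inv) = state (proj₁ (∼-NonNeg p) ps) qs (sameShape-trans (sameShape-sym sh') sh) (ordered-sameShape sh' o)
  (invariant-trans {W = T} (sameShape-sym sh') (invariant-sym sh' (⇝-invariant ps r)) inv)

-- In the first two cases for a type I first term, the second term may take part in a label
-- exchange. In the last one the invariant at `2^(e+1)` sees only the terms preceding `u`.
data Head₁ (e : ℤ) (τ : Type) (u : Term) (S : FineSymbol) : Set where
  here   : scale u ≡ e → typeT u ≡ τ → Head₁ e τ u S
  next-I : scale u ≡ e + + 1 → typeT u ≡ type-I → Head₁ e τ u S
  clear  : Clear 1 e (u ∷ S) → Head₁ e τ u S

head₁ : ∀ {t u S} → Ordered (t ∷ u ∷ S) → Head₁ (scale t) (typeT t) u S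
head₁ {t} {u} (((zero , eq , k) ∷ _) ∷ _) = here (trans eq (ℤₚ.+-identityʳ (scale t))) (k refl)
head₁ {t} {u} (((suc zero , eq , _) ∷ _) ∷ o) with typeT u in τ
... | type-I  = next-I eq τ
... | type-II = clear (clear-from {1} {scale t} {0} o eq (λ _ → τ))
head₁ {t} (((suc (suc d) , eq , _) ∷ _) ∷ o) = clear (clear-from {1} {scale t} {suc d} o eq λ ())

-- The first two cases offer a partner for a sign walk from a type I term of scale `2^e`; the last
-- makes the invariant at `2^(e+2)` available.
data Head₂ (e : ℤ) (u : Term) (S : FineSymbol) : Set where
  next-II : scale u ≡ e + + 1 → typeT u ≡ type-II → Head₂ e u S
  two-I   : scale u ≡ e + + 2 → typeT u ≡ type-I → Head₂ e u S
  clear   : Clear 2 e (u ∷ S) → Head₂ e u S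

head₂ : ∀ {e u S} → Ordered (u ∷ S) → Clear 1 e (u ∷ S) → Head₂ e u S
head₂ o ((zero , eq , ii) ∷ _) = next-II eq (ii refl)
head₂ {e} {u} o ((suc zero , eq , _) ∷ _) with typeT u in τ
... | type-I  = two-I eq τ
... | type-II = clear (clear-from {2} {e} {0} o eq (λ _ → τ))
head₂ {e} o ((suc (suc d) , eq , _) ∷ _) = clear (clear-from {2} {e} {suc d} o eq λ ())

data SameOrFlipped (l : Label) : Label → Set where
  same    : SameOrFlipped l l
  flipped : SameOrFlipped l (flipL l)

compareL : ∀ l l' → SameOrFlipped l l'
compareL G G = same
compareL G R = flipped
compareL R G = flipped
compareL R R = same

data SameOrFlippedS (s : Sign) : Sign → Set where
  same    : SameOrFlippedS s s
  flipped : SameOrFlippedS s (flipS s)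

compareS : ∀ s s' → SameOrFlippedS s s'
compareS plus  plus  = same
compareS plus  minus = flipped
compareS minus plus  = flipped
compareS minus minus = same

-- Matching the labels of the first terms

run : ℤ → Label → List Sign → FineSymbol
run e l = map (λ s → term e s (I l))

FlippedLabel : ℤ → Sign → Label → FineSymbol → Set
FlippedLabel e s l S = ∃[ s' ] ∃[ S' ] term e s (I l) ∷ S ⇝ term e s' (I (flipL l)) ∷ S'

-- The label of the first term can be changed unless its scale is a whole compartment with constant label.
flip-label : ∀ e s l S → Ordered (term e s (I l) ∷ S) →
  FlippedLabel e s l S ⊎ (∃[ ss ] ∃[ W ] S ≡ run e l ss ++ W × Clear 1 e W)
flip-label e s l [] o = inj₂ ([] , [] , refl , [])
flip-label e s l (term e′ s₁ k₁ ∷ S) o with head₁ o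
... | clear c = inj₂ ([] , _ , refl , c)
flip-label e s l (term _ s₁ (I l₁) ∷ S) o | next-I refl _ with compareL l l₁
... | same    = inj₁ (flipS s , _ , walk-next e s s₁ l S , (refl , refl) ∷ (refl , refl) ∷ sameShape-refl)
... | flipped = inj₁ (s , _ , exchange-next e s l s₁ (flipL l) S , (refl , refl) ∷ (refl , refl) ∷ sameShape-refl)
flip-label e s l (term _ s₁ (I l₁) ∷ S) o | here refl _ with compareL l l₁
... | flipped = inj₁ (s , _ , exchange-same e s l s₁ (flipL l) S , (refl , refl) ∷ (refl , refl) ∷ sameShape-refl)
... | same with flip-label e s₁ l S (ordered-tail o)
...   | inj₁ (s' , S' , r) = inj₁ (s , _ , ⇝-trans (⇝-cons (term e s (I l)) r)
          (exchange-same e s l s' (flipL l) S' , (refl , refl) ∷ (refl , refl) ∷ sameShape-refl))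
...   | inj₂ (ss , W , refl , c) = inj₂ (s₁ ∷ ss , W , refl , c)

expSum-run : ∀ e l ss → expSum (e + + 1) (run e l ss) ≡ length ss ℕ.* contribution₊ 0 plus (I l)
expSum-run e l []       = refl
expSum-run e l (s ∷ ss) = cong₂ ℕ._+_ (trans (contribution-1 e (term e s (I l)) refl) (independent l)) (expSum-run e l ss)
  where
  independent : ∀ l → contribution₊ 0 s (I l) ≡ contribution₊ 0 plus (I l)
  independent G = refl
  independent R = refl

e≢e+suc : ∀ e n → e ≢ e + + suc n
e≢e+suc e n eq with () ← +-injectiveʳ e {0} {suc n} (trans (ℤₚ.+-identityʳ e) eq)

¬hasI-run : ∀ e n l ss → ¬ HasI (e + + suc n) (run e l ss)
¬hasI-run e n l (s ∷ ss) (here (_ , eq)) = e≢e+suc e n eq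
¬hasI-run e n l (s ∷ ss) (there h) = ¬hasI-run e n l ss h

run-lengths : ∀ {e l l'} ss ss' {W W'} → Pointwise SameShape (run e l ss ++ W) (run e l' ss' ++ W') → Clear 1 e W → Clear 1 e W' → length ss ≡ length ss'
run-lengths [] [] _ _ _ = refl
run-lengths (s ∷ ss) (s' ∷ ss') (_ ∷ sh) c c' = cong suc (run-lengths ss ss' sh c c')
run-lengths {e} [] (s' ∷ ss') ((eq , _) ∷ _) ((d , eq' , _) ∷ _) _ = ⊥-elim (e≢e+suc e d (trans (sym eq) eq'))
run-lengths {e} (s ∷ ss) [] ((eq , _) ∷ _) _ ((d , eq' , _) ∷ _) = ⊥-elim (e≢e+suc e d (trans eq eq'))

SameLabels : ℤ → FineSymbol → FineSymbol → Set
SameLabels e S T = ∃[ l ] ∃[ s ] ∃[ S' ] ∃[ s' ] ∃[ T' ] S ⇝ term e s (I l) ∷ S' × T ⇝ term e s' (I l) ∷ T'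

flipL-involutive : ∀ l → flipL (flipL l) ≡ l
flipL-involutive G = refl
flipL-involutive R = refl

run-1 : ∀ l → ¬ (+ (1 ℕ.* contribution₊ 0 plus (I l)) ≡ + (1 ℕ.* contribution₊ 0 plus (I (flipL l))) ⟦ + 8 ⟧)
run-1 = from-yes (all-Label? λ l → ¬? (+ (1 ℕ.* contribution₊ 0 plus (I l)) ≡ + (1 ℕ.* contribution₊ 0 plus (I (flipL l))) ⟦8⟧?))

run-2 : ∀ l → ¬ (+ (2 ℕ.* contribution₊ 0 plus (I l)) ≡ + (2 ℕ.* contribution₊ 0 plus (I (flipL l))) ⟦ + 8 ⟧)
run-2 = from-yes (all-Label? λ l → ¬? (+ (2 ℕ.* contribution₊ 0 plus (I l)) ≡ + (2 ℕ.* contribution₊ 0 plus (I (flipL l))) ⟦8⟧?))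

run-3 : ∀ l → ¬ (+ (3 ℕ.* contribution₊ 0 plus (I l)) ≡ + (3 ℕ.* contribution₊ 0 plus (I (flipL l))) ⟦ + 8 ⟧)
run-3 = from-yes (all-Label? λ l → ¬? (+ (3 ℕ.* contribution₊ 0 plus (I l)) ≡ + (3 ℕ.* contribution₊ 0 plus (I (flipL l))) ⟦8⟧?))

-- If neither label can be changed, n equal givers face n receivers; then 6 n ≡ 0 mod 8, so conversion applies.
match-labels : ∀ {N} e s l S s' l' T → State N (term e s (I l) ∷ S) (term e s' (I l') ∷ T) →
  SameLabels e (term e s (I l) ∷ S) (term e s' (I l') ∷ T)
match-labels e s l S s' l' T st with compareL l l'
... | same = l , s , S , s' , T , ⇝-refl , ⇝-refl
... | flipped with flip-label e s l S (ordered st) | flip-label e s' (flipL l) T (ordered (state-sym st))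
...   | inj₁ (s₁ , S₁ , r) | _ = flipL l , s₁ , S₁ , s' , T , r , ⇝-refl
...   | inj₂ _ | inj₁ (s₁ , T₁ , r) = l , s , S , s₁ , T₁ , ⇝-refl , subst (λ k → term e s' (I (flipL l)) ∷ T ⇝ term e s₁ (I k) ∷ T₁) (flipL-involutive l) r
...   | inj₂ (ss , W , refl , c) | inj₂ (ss' , W' , refl , c') = cases ss c count
  where
  lengths : length ss ≡ length ss'
  lengths with _ ∷ sh ← shape st = run-lengths ss ss' sh c c'
  count : + (suc (length ss) ℕ.* contribution₊ 0 plus (I l)) ≡ + (suc (length ss) ℕ.* contribution₊ 0 plus (I (flipL l))) ⟦ + 8 ⟧
  count = transᵐ (≡⇒≡ᵐ (cong +_ (sym (expSum-run e l (s ∷ ss)))))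
    (transᵐ (cut {1} {e} (run e l (s ∷ ss)) (run e (flipL l) (s' ∷ ss')) (invariant st) c c' (¬hasI-run e 0 l (s ∷ ss)))
    (≡⇒≡ᵐ (cong +_ (trans (expSum-run e (flipL l) (s' ∷ ss')) (cong (λ n → suc n ℕ.* contribution₊ 0 plus (I (flipL l))) (sym lengths))))))
  cases : ∀ ss → Clear 1 e W → + (suc (length ss) ℕ.* contribution₊ 0 plus (I l)) ≡ + (suc (length ss) ℕ.* contribution₊ 0 plus (I (flipL l))) ⟦ + 8 ⟧ →
    SameLabels e (term e s (I l) ∷ run e l ss ++ W) (term e s' (I (flipL l)) ∷ run e (flipL l) ss' ++ W')
  cases [] _ n = ⊥-elim (run-1 l n)
  cases (_ ∷ []) _ n = ⊥-elim (run-2 l n)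
  cases (_ ∷ _ ∷ []) _ n = ⊥-elim (run-3 l n)
  cases (s₂ ∷ s₃ ∷ s₄ ∷ ss) _ _ = flipL l , s , _ , s' , _ ,
    (convert-same e s s₂ s₃ s₄ l (run e l ss ++ W) , (refl , refl) ∷ (refl , refl) ∷ (refl , refl) ∷ (refl , refl) ∷ sameShape-refl) , ⇝-refl

-- Matching the signs of the first terms

FlippedSign : ℤ → Sign → Label → FineSymbol → Set
FlippedSign e s l S = ∃[ S' ] term e s (I l) ∷ S ⇝ term e (flipS s) (I l) ∷ S'

walk-far : ∀ e s l xs s₂ l₂ S → FlippedSign e s l (xs ++ term (e + + 2) s₂ (I l₂) ∷ S)
walk-far e s l xs s₂ l₂ S = _ , ∼-trans (∼-cons _ (perm (Permₚ.shift _ xs S)))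
  (∼-trans (move (walk-4 e s l s₂ l₂) (xs ++ S)) (∼-cons _ (perm (↭-sym (Permₚ.shift (term (e + + 2) (flipS s₂) (I l₂)) xs S))))) ,
  (refl , refl) ∷ PW.++⁺ sameShape-refl ((refl , refl) ∷ sameShape-refl)

-- A walk to the next scale requires equal labels and changes both. With two equal labels at the
-- next scale, a permutation before or after the walk gives the first term its old label, so only
-- its sign has changed.
flip-sign-triple : ∀ e s l s₁ s₂ l₁ S → FlippedSign e s l (term (e + + 1) s₁ (I l₁) ∷ term (e + + 1) s₂ (I l₁) ∷ S)
flip-sign-triple e s l s₁ s₂ l₁ S with compareL l l₁
... | same = _ , ∼-trans (walk-next e s s₁ l _)
    (permute-labels {(e , flipS s) ∷ (e + + 1 , flipS s₁) ∷ (e + + 1 , s₂) ∷ []} (next (same [-])) {k ∷ k ∷ l ∷ []} {l ∷ k ∷ k ∷ []} refl (Permₚ.++-comm (k ∷ k ∷ []) (l ∷ [])) S) ,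
    (refl , refl) ∷ (refl , refl) ∷ (refl , refl) ∷ sameShape-refl
  where k = flipL l
... | flipped = _ , ∼-trans
    (permute-labels {(e , s) ∷ (e + + 1 , s₁) ∷ (e + + 1 , s₂) ∷ []} (next (same [-])) {l ∷ k ∷ k ∷ []} {k ∷ k ∷ l ∷ []} refl (Permₚ.++-comm (l ∷ []) (k ∷ k ∷ [])) S)
    (subst (λ h → term e s (I k) ∷ term (e + + 1) s₁ (I k) ∷ term (e + + 1) s₂ (I l) ∷ S ∼ term e (flipS s) (I h) ∷ term (e + + 1) (flipS s₁) (I h) ∷ term (e + + 1) s₂ (I l) ∷ S)
      (flipL-involutive l) (walk-next e s s₁ k _)) ,
    (refl , refl) ∷ (refl , refl) ∷ (refl , refl) ∷ sameShape-refl
  where k = flipL l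

flipped-sign-perm : ∀ {e s l S T} → S ↭ T → Pointwise SameShape S T → FlippedSign e s l T → FlippedSign e s l S
flipped-sign-perm p sh (T' , r) = T' , ⇝-trans (⇝-cons _ (perm p , sh)) r

SameHead : FineSymbol → FineSymbol → Set
SameHead S T = ∃[ v ] ∃[ S' ] ∃[ T' ] S ⇝ v ∷ S' × T ⇝ v ∷ T'

flip-left : ∀ {e s l S T} → FlippedSign e s l S → SameHead (term e s (I l) ∷ S) (term e (flipS s) (I l) ∷ T)
flip-left (S' , r) = _ , S' , _ , r , ⇝-refl

flip-right : ∀ {e s l S T} → FlippedSign e (flipS s) l T → SameHead (term e s (I l) ∷ S) (term e (flipS s) (I l) ∷ T)
flip-right {e} {s} {l} {S} {T} (T' , r) = _ , S , T' , ⇝-refl ,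
  subst (λ h → term e (flipS s) (I l) ∷ T ⇝ term e h (I l) ∷ T') (flipS-involutive s) r

alone : ∀ s l → ¬ (+ (ExpI s l ℕ.+ 0) ≡ + (ExpI (flipS s) l ℕ.+ 0) ⟦ + 8 ⟧)
alone = from-yes (all-Sign? λ s → all-Label? λ l → ¬? (+ (ExpI s l ℕ.+ 0) ≡ + (ExpI (flipS s) l ℕ.+ 0) ⟦8⟧?))

-- Flipping the sign changes `ExpI` by 4 mod 8, whereas changing the label of one term at the next
-- scale changes its contribution only by 2 or 6 mod 8.
with-one : ∀ s l s₁ l₁ s₁' l₁' → ¬ (+ (ExpI s l ℕ.+ (contribution₊ 0 s₁ (I l₁) ℕ.+ 0)) ≡ + (ExpI (flipS s) l ℕ.+ (contribution₊ 0 s₁' (I l₁') ℕ.+ 0)) ⟦ + 8 ⟧)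
with-one = from-yes (all-Sign? λ s → all-Label? λ l → all-Sign? λ s₁ → all-Label? λ l₁ → all-Sign? λ s₁' → all-Label? λ l₁' →
  ¬? (+ (ExpI s l ℕ.+ (contribution₊ 0 s₁ (I l₁) ℕ.+ 0)) ≡ + (ExpI (flipS s) l ℕ.+ (contribution₊ 0 s₁' (I l₁') ℕ.+ 0)) ⟦8⟧?))

-- Two opposite labels contribute 6 on either side, which leaves the difference 4. Equal labels
-- could compensate it, since 12 is 4 mod 8; that case is settled by `flip-sign-triple`.
with-two : ∀ s l s₁ s₂ l₁ s₁' s₂' l₁' →
  ¬ (+ (ExpI s l ℕ.+ (contribution₊ 0 s₁ (I l₁) ℕ.+ (contribution₊ 0 s₂ (I (flipL l₁)) ℕ.+ 0))) ≡
     + (ExpI (flipS s) l ℕ.+ (contribution₊ 0 s₁' (I l₁') ℕ.+ (contribution₊ 0 s₂' (I (flipL l₁')) ℕ.+ 0))) ⟦ + 8 ⟧)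
with-two = from-yes (all-Sign? λ s → all-Label? λ l → all-Sign? λ s₁ → all-Sign? λ s₂ → all-Label? λ l₁ → all-Sign? λ s₁' → all-Sign? λ s₂' → all-Label? λ l₁' →
  ¬? (+ (ExpI s l ℕ.+ (contribution₊ 0 s₁ (I l₁) ℕ.+ (contribution₊ 0 s₂ (I (flipL l₁)) ℕ.+ 0))) ≡
     + (ExpI (flipS s) l ℕ.+ (contribution₊ 0 s₁' (I l₁') ℕ.+ (contribution₊ 0 s₂' (I (flipL l₁')) ℕ.+ 0))) ⟦8⟧?))

≡ᵐ-ℕ : ∀ {a b c d} → a ≡ b → c ≡ d → + a ≡ + c ⟦ + 8 ⟧ → + b ≡ + d ⟦ + 8 ⟧
≡ᵐ-ℕ refl refl e = e

e+1≢e+2 : ∀ e → e + + 1 ≢ e + + 2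
e+1≢e+2 e eq with () ← +-injectiveʳ e {1} {2} eq

head-2 : ∀ e s l → contribution (e + + 2 - e) (term e s (I l)) ≡ ExpI s l
head-2 e s l = contribution-2 e (term e s (I l)) refl

next-2 : ∀ e s l → contribution (e + + 2 - (e + + 1)) (term (e + + 1) s (I l)) ≡ contribution₊ 0 s (I l)
next-2 e s l = contribution-2-1 e (term (e + + 1) s (I l)) refl

absurd-alone : ∀ {e s l S T} → Invariant (term e s (I l) ∷ S) (term e (flipS s) (I l) ∷ T) → Clear 2 e S → Clear 2 e T → ⊥
absurd-alone {e} {s} {l} inv c c' = alone s l (≡ᵐ-ℕ (cong (ℕ._+ 0) (head-2 e s l)) (cong (ℕ._+ 0) (head-2 e (flipS s) l))
  (cut {2} {e} (term e s (I l) ∷ []) (term e (flipS s) (I l) ∷ []) inv c c' (λ { (here (_ , eq)) → e≢e+suc e 1 eq })))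

absurd-one : ∀ {e s l s₁ l₁ s₁' l₁' S T} →
  Invariant (term e s (I l) ∷ term (e + + 1) s₁ (I l₁) ∷ S) (term e (flipS s) (I l) ∷ term (e + + 1) s₁' (I l₁') ∷ T) →
  Clear 2 e S → Clear 2 e T → ⊥
absurd-one {e} {s} {l} {s₁} {l₁} {s₁'} {l₁'} inv c c' = with-one s l s₁ l₁ s₁' l₁' (≡ᵐ-ℕ
  (cong₂ (λ a b → a ℕ.+ (b ℕ.+ 0)) (head-2 e s l) (next-2 e s₁ l₁))
  (cong₂ (λ a b → a ℕ.+ (b ℕ.+ 0)) (head-2 e (flipS s) l) (next-2 e s₁' l₁'))
  (cut {2} {e} (term e s (I l) ∷ term (e + + 1) s₁ (I l₁) ∷ []) (term e (flipS s) (I l) ∷ term (e + + 1) s₁' (I l₁') ∷ []) inv c c'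
    (λ { (here (_ , eq)) → e≢e+suc e 1 eq ; (there (here (_ , eq))) → e+1≢e+2 e eq })))

absurd-two : ∀ {e s l s₁ s₂ l₁ s₁' s₂' l₁' S T} →
  Invariant (term e s (I l) ∷ term (e + + 1) s₁ (I l₁) ∷ term (e + + 1) s₂ (I (flipL l₁)) ∷ S)
            (term e (flipS s) (I l) ∷ term (e + + 1) s₁' (I l₁') ∷ term (e + + 1) s₂' (I (flipL l₁')) ∷ T) →
  Clear 2 e S → Clear 2 e T → ⊥
absurd-two {e} {s} {l} {s₁} {s₂} {l₁} {s₁'} {s₂'} {l₁'} inv c c' = with-two s l s₁ s₂ l₁ s₁' s₂' l₁' (≡ᵐ-ℕ
  (trans (cong₂ (λ a b → a ℕ.+ (b ℕ.+ _)) (head-2 e s l) (next-2 e s₁ l₁)) (cong (λ b → ExpI s l ℕ.+ (contribution₊ 0 s₁ (I l₁) ℕ.+ (b ℕ.+ 0))) (next-2 e s₂ (flipL l₁))))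
  (trans (cong₂ (λ a b → a ℕ.+ (b ℕ.+ _)) (head-2 e (flipS s) l) (next-2 e s₁' l₁')) (cong (λ b → ExpI (flipS s) l ℕ.+ (contribution₊ 0 s₁' (I l₁') ℕ.+ (b ℕ.+ 0))) (next-2 e s₂' (flipL l₁'))))
  (cut {2} {e} (term e s (I l) ∷ term (e + + 1) s₁ (I l₁) ∷ term (e + + 1) s₂ (I (flipL l₁)) ∷ [])
    (term e (flipS s) (I l) ∷ term (e + + 1) s₁' (I l₁') ∷ term (e + + 1) s₂' (I (flipL l₁')) ∷ []) inv c c'
    (λ { (here (_ , eq)) → e≢e+suc e 1 eq ; (there (here (_ , eq))) → e+1≢e+2 e eq ; (there (there (here (_ , eq)))) → e+1≢e+2 e eq })))

-- If two of the labels at scale 2^(e+1) agree, or if scale 2^(e+2) has type I, the first sign can be changed.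
match-signs-3 : ∀ {N} e s l s₁ s₂ l₁ S s₁' s₂' l₁' T →
  State N (term e s (I l) ∷ term (e + + 1) s₁ (I l₁) ∷ term (e + + 1) s₂ (I (flipL l₁)) ∷ S)
          (term e (flipS s) (I l) ∷ term (e + + 1) s₁' (I l₁') ∷ term (e + + 1) s₂' (I (flipL l₁')) ∷ T) →
  SameHead (term e s (I l) ∷ term (e + + 1) s₁ (I l₁) ∷ term (e + + 1) s₂ (I (flipL l₁)) ∷ S)
           (term e (flipS s) (I l) ∷ term (e + + 1) s₁' (I l₁') ∷ term (e + + 1) s₂' (I (flipL l₁')) ∷ T)
match-signs-3 e s l s₁ s₂ l₁ [] s₁' s₂' l₁' [] st = ⊥-elim (absurd-two {e} {s} {l} {s₁} {s₂} {l₁} {s₁'} {s₂'} {l₁'} (invariant st) [] [])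
match-signs-3 e s l s₁ s₂ l₁ [] s₁' s₂' l₁' (_ ∷ _) st with _ ∷ _ ∷ _ ∷ () ← shape st
match-signs-3 e s l s₁ s₂ l₁ (term e′ s₃ k₃ ∷ S) s₁' s₂' l₁' T st with head₁ (ordered-tail (ordered-tail (ordered st)))
... | clear c with _ ∷ _ ∷ _ ∷ sh ← shape st = ⊥-elim (absurd-two {e} {s} {l} {s₁} {s₂} {l₁} {s₁'} {s₂'} {l₁'} (invariant st) (clear-suc {e} c) (clear-sameShape {2} {e} sh (clear-suc {e} c)))
match-signs-3 e s l s₁ s₂ l₁ (term _ s₃ (I l₃) ∷ S) s₁' s₂' l₁' T st | next-I refl _ = flip-left
  (subst (λ x → FlippedSign e s l (term (e + + 1) s₁ (I l₁) ∷ term (e + + 1) s₂ (I (flipL l₁)) ∷ term x s₃ (I l₃) ∷ S)) (sym (+-+ e 1 1))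
    (walk-far e s l (term (e + + 1) s₁ (I l₁) ∷ term (e + + 1) s₂ (I (flipL l₁)) ∷ []) s₃ l₃ S))
match-signs-3 e s l s₁ s₂ l₁ (term _ s₃ (I l₃) ∷ S) s₁' s₂' l₁' T st | here refl _ with compareL l₁ l₃
... | same = flip-left (flipped-sign-perm (Perm.prep _ (Perm.swap _ _ ↭-refl)) ((refl , refl) ∷ (refl , refl) ∷ (refl , refl) ∷ sameShape-refl)
    (flip-sign-triple e s l s₁ s₃ l₁ (term (e + + 1) s₂ (I (flipL l₁)) ∷ S)))
... | flipped = flip-left (flipped-sign-perm (Perm.trans (Perm.swap _ _ ↭-refl) (Perm.prep _ (Perm.swap _ _ ↭-refl))) ((refl , refl) ∷ (refl , refl) ∷ (refl , refl) ∷ sameShape-refl)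
    (flip-sign-triple e s l s₂ s₃ (flipL l₁) (term (e + + 1) s₁ (I l₁) ∷ S)))

match-signs-2 : ∀ {N} e s l s₁ l₁ S s₁' l₁' T →
  State N (term e s (I l) ∷ term (e + + 1) s₁ (I l₁) ∷ S) (term e (flipS s) (I l) ∷ term (e + + 1) s₁' (I l₁') ∷ T) →
  SameHead (term e s (I l) ∷ term (e + + 1) s₁ (I l₁) ∷ S) (term e (flipS s) (I l) ∷ term (e + + 1) s₁' (I l₁') ∷ T)
match-signs-2 e s l s₁ l₁ [] s₁' l₁' [] st = ⊥-elim (absurd-one {e} {s} {l} {s₁} {l₁} {s₁'} {l₁'} (invariant st) [] [])
match-signs-2 e s l s₁ l₁ [] s₁' l₁' (_ ∷ _) st with _ ∷ _ ∷ () ← shape st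
match-signs-2 e s l s₁ l₁ (term e′ s₂ k₂ ∷ S) s₁' l₁' T st with head₁ (ordered-tail (ordered st))
... | clear c with _ ∷ _ ∷ sh ← shape st = ⊥-elim (absurd-one {e} {s} {l} {s₁} {l₁} {s₁'} {l₁'} (invariant st) (clear-suc {e} c) (clear-sameShape {2} {e} sh (clear-suc {e} c)))
match-signs-2 e s l s₁ l₁ (term _ s₂ (I l₂) ∷ S) s₁' l₁' T st | next-I refl _ = flip-left
  (subst (λ x → FlippedSign e s l (term (e + + 1) s₁ (I l₁) ∷ term x s₂ (I l₂) ∷ S)) (sym (+-+ e 1 1))
    (walk-far e s l (term (e + + 1) s₁ (I l₁) ∷ []) s₂ l₂ S))
match-signs-2 e s l s₁ l₁ (term _ s₂ (I l₂) ∷ S) s₁' l₁' [] st | here refl _ with _ ∷ _ ∷ () ← shape st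
match-signs-2 e s l s₁ l₁ (term _ s₂ (I l₂) ∷ S) s₁' l₁' (term _ s₂' II ∷ T) st | here refl _ with _ ∷ _ ∷ (_ , ()) ∷ _ ← shape st
match-signs-2 e s l s₁ l₁ (term _ s₂ (I l₂) ∷ S) s₁' l₁' (term _ s₂' (I l₂') ∷ T) st | here refl _ with _ ∷ _ ∷ (refl , _) ∷ _ ← shape st
  with compareL l₁ l₂ | compareL l₁' l₂'
-- Two equal labels in either symbol suffice, because it is enough to change the first sign on one
-- side.
... | same | _ = flip-left (flip-sign-triple e s l s₁ s₂ l₁ S)
... | flipped | same = flip-right (flip-sign-triple e (flipS s) l s₁' s₂' l₁' T)
... | flipped | flipped = match-signs-3 e s l s₁ s₂ l₁ S s₁' s₂' l₁' T st

match-signs : ∀ {N} e s l S s' T → State N (term e s (I l) ∷ S) (term e s' (I l) ∷ T) →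
  SameHead (term e s (I l) ∷ S) (term e s' (I l) ∷ T)
match-signs e s l S s' T st with compareS s s'
... | same = _ , S , T , ⇝-refl , ⇝-refl
match-signs e s l [] _ [] st | flipped = ⊥-elim (absurd-alone {e} {s} {l} (invariant st) [] [])
match-signs e s l [] _ (_ ∷ _) st | flipped with _ ∷ () ← shape st
match-signs e s l (term e′ s₁ k₁ ∷ S) _ T st | flipped with head₁ (ordered st)
match-signs e s l (term _ s₁ (I l₁) ∷ S) _ T st | flipped | here refl _ = flip-left (_ , move (walk-I e s l s₁ l₁) S , (refl , refl) ∷ (refl , refl) ∷ sameShape-refl)
match-signs e s l (term _ s₁ (I l₁) ∷ S) _ [] st | flipped | next-I refl _ with _ ∷ () ← shape st
match-signs e s l (term _ s₁ (I l₁) ∷ S) _ (term _ s₁' II ∷ T) st | flipped | next-I refl _ with _ ∷ (_ , ()) ∷ _ ← shape st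
match-signs e s l (term _ s₁ (I l₁) ∷ S) _ (term _ s₁' (I l₁') ∷ T) st | flipped | next-I refl _ with _ ∷ (refl , _) ∷ _ ← shape st =
  match-signs-2 e s l s₁ l₁ S s₁' l₁' T st
match-signs e s l (term e′ s₁ k₁ ∷ S) _ T st | flipped | clear c with head₂ {e} (ordered-tail (ordered st)) c
... | clear c₂ with _ ∷ sh ← shape st = ⊥-elim (absurd-alone {e} {s} {l} (invariant st) c₂ (clear-sameShape {2} {e} sh c₂))
match-signs e s l (term _ s₁ II ∷ S) _ T st | flipped | clear c | next-II refl _ = flip-left (_ , move (walk-I,II e s l s₁) S , (refl , refl) ∷ (refl , refl) ∷ sameShape-refl)
match-signs e s l (term _ s₁ (I l₁) ∷ S) _ T st | flipped | clear c | two-I refl _ = flip-left (walk-far e s l [] s₁ l₁ S)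

-- Matching first terms of type II

II-alone : ∀ s → ¬ (+ (contribution₊ 0 s II ℕ.+ 0) ≡ + (contribution₊ 0 (flipS s) II ℕ.+ 0) ⟦ + 8 ⟧)
II-alone = from-yes (all-Sign? λ s → ¬? (+ (contribution₊ 0 s II ℕ.+ 0) ≡ + (contribution₊ 0 (flipS s) II ℕ.+ 0) ⟦8⟧?))

absurd-II : ∀ {e s S T} → Invariant (term e s II ∷ S) (term e (flipS s) II ∷ T) → Clear 1 e S → Clear 1 e T → ⊥
absurd-II {e} {s} inv c c' = II-alone s (≡ᵐ-ℕ (cong (ℕ._+ 0) (contribution-1 e (term e s II) refl)) (cong (ℕ._+ 0) (contribution-1 e (term e (flipS s) II) refl))
  (cut {1} {e} (term e s II ∷ []) (term e (flipS s) II ∷ []) inv c c' (λ { (here (() , _)) })))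

-- A type II sign shows one scale up, where `minus` contributes 4, so the invariant at `2^(e+1)`
-- decides here, in contrast to `2^(e+2)` for type I.
match-II : ∀ {N} e s S s' T → State N (term e s II ∷ S) (term e s' II ∷ T) → SameHead (term e s II ∷ S) (term e s' II ∷ T)
match-II e s S s' T st with compareS s s'
... | same = _ , S , T , ⇝-refl , ⇝-refl
match-II e s [] _ [] st | flipped = ⊥-elim (absurd-II {e} {s} (invariant st) [] [])
match-II e s [] _ (_ ∷ _) st | flipped with _ ∷ () ← shape st
match-II e s (term e′ s₁ k₁ ∷ S) _ T st | flipped with head₁ (ordered st)
... | clear c with _ ∷ sh ← shape st = ⊥-elim (absurd-II {e} {s} (invariant st) c (clear-sameShape {1} {e} sh c))
match-II e s (term _ s₁ II ∷ S) _ T st | flipped | here refl _ = _ , _ , _ , (move (walk-II e s s₁) S , (refl , refl) ∷ (refl , refl) ∷ sameShape-refl) , ⇝-refl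
match-II e s (term _ s₁ (I l) ∷ S) _ T st | flipped | next-I refl _ = _ , _ , _ , (move (walk-II,I e s s₁ l) S , (refl , refl) ∷ (refl , refl) ∷ sameShape-refl) , ⇝-refl

-- Induction on the lowest term

match-heads : ∀ {N t S u T} → State N (t ∷ S) (u ∷ T) → SameHead (t ∷ S) (u ∷ T)
match-heads {t = term e s II} {S} {term _ s' II} {T} st with (refl , _) ∷ _ ← shape st = match-II e s S s' T st
match-heads {t = term e s II} {u = term _ s' (I l)} st with (_ , ()) ∷ _ ← shape st
match-heads {t = term e s (I l)} {u = term _ s' II} st with (_ , ()) ∷ _ ← shape st
match-heads {t = term e s (I l)} {S} {term _ s' (I l')} {T} st with (refl , _) ∷ _ ← shape st
  with k , s₁ , S₁ , s₂ , T₁ , r , q ← match-labels e s l S s' l' T st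
  -- `state-⇝` rewrites the left symbol; conjugating it by `state-sym` rewrites the right one.
  with v , S₂ , T₂ , r' , q' ← match-signs e s₁ k S₁ s₂ T₁ (state-⇝ r (state-sym (state-⇝ q (state-sym st))))
  = v , S₂ , T₂ , ⇝-trans r r' , ⇝-trans q q'

-- Dropping the lowest term creates a cut at its scale, but nothing below contributes there.
expSum-tail : ∀ {t S} → All (After t) S → expSum (scale t) S ≡ 0
expSum-tail [] = refl
expSum-tail {t} {u ∷ S} ((d , eq , _) ∷ a) = cong₂ ℕ._+_
  (trans (cong (λ z → contribution (scale t - z) u) eq) (trans (cong (λ z → contribution z u) (lem (scale t) (+ d))) (contribution-≤0 d u))) (expSum-tail {t} a)
  where
  lem : ∀ e d → e - (e + d) ≡ - d
  lem = solve-∀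

state-tail : ∀ {N v S T} → State N (v ∷ S) (v ∷ T) → State N S T
state-tail {v = v} {S} {T} (state (_ ∷ ps) (_ ∷ qs) (_ ∷ sh) (a ∷ o) inv) = state ps qs sh o inv'
  where
  aT : All (After v) T
  aT with ordered-sameShape {v ∷ S} {v ∷ T} ((refl , refl) ∷ sh) (a ∷ o)
  ... | a' ∷ _ = a'
  inv' : Invariant S T
  inv' j ¬I with (typeT v ≟ᵗ type-I) ×-dec (scale v ℤ.≟ j)
  ... | yes (_ , refl) = ≡⇒≡ᵐ (cong +_ (trans (expSum-tail {v} a) (sym (expSum-tail {v} aT))))
  ... | no ¬v = cancel (+ contribution (j - scale v) v) (inv j λ { (here h) → ¬v h ; (there h) → ¬I h })
    where
    lem : ∀ c a → (c + a) - c ≡ a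
    lem = solve-∀
    cancel : ∀ c {a b} → c + a ≡ c + b ⟦ + 8 ⟧ → a ≡ b ⟦ + 8 ⟧
    cancel c {a} {b} e = transᵐ (≡⇒≡ᵐ (sym (lem c a))) (transᵐ (+-shiftᵐ (- c) e) (≡⇒≡ᵐ (lem c b)))

-- The matched tail is a new symbol and not a sublist of `S`, so the recursion runs on the length,
-- which moves of the same shape preserve.
complete : ∀ n {N S T} → length S ≡ n → State N S T → S ∼ T
complete n {S = []} {[]} _ st = ∼-refl
complete n {S = []} {_ ∷ _} _ st with () ← shape st
complete n {S = _ ∷ _} {[]} _ st with () ← shape st
complete (suc n) {S = t ∷ S} {u ∷ T} len st
  with v , S' , T' , r , q ← match-heads st =
  ∼-trans (proj₁ r) (∼-trans (∼-cons v (complete n (trans (sym (ℕₚ.suc-injective (PW.Pointwise-length (proj₂ r)))) (ℕₚ.suc-injective len))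
    (state-tail (state-⇝ r (state-sym (state-⇝ q (state-sym st))))))) (∼-sym (proj₁ q)))

-- Fine symbols sorted by scale

Coherent : FineSymbol → Set
Coherent S = ∀ {t u} → t ∈ S → u ∈ S → scale t ≡ scale u → typeT t ≡ typeT u

fine⇒coherent : ∀ {S} → IsFine S → Coherent S
fine⇒coherent fine {t} {u} t∈S u∈S e with typeT t in τ | typeT u in τ'
... | type-I  | type-I  = refl
... | type-II | type-II = refl
... | type-I  | type-II = trans (sym τ) (cong type (fine u∈S t∈S (type-II⇒II τ') e))
... | type-II | type-I  = trans (sym (cong type (fine t∈S u∈S (type-II⇒II τ) (sym e)))) τ'

coherent⇒fine : ∀ {S} → Coherent S → IsFine S
coherent⇒fine c {t} {t'} t∈S t'∈S II≡ e = type-II⇒II (trans (c t'∈S t∈S e) (cong type II≡))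

coherent-↭ : ∀ {S T} → S ↭ T → Coherent S → Coherent T
coherent-↭ p c t∈T u∈T = c (Permₚ.∈-resp-↭ (↭-sym p) t∈T) (Permₚ.∈-resp-↭ (↭-sym p) u∈T)

≤⇒+ : ∀ {x y} → x ℤ.≤ y → ∃[ d ] y ≡ x + + d
≤⇒+ {x} {y} x≤y = ∣ y - x ∣ , trans (lem x y) (cong (λ z → x + z) (sym (ℤₚ.0≤i⇒+∣i∣≡i (ℤₚ.i≤j⇒0≤j-i x≤y))))
  where
  lem : ∀ x y → y ≡ x + (y - x)
  lem = solve-∀

+-≤ : ∀ {x y} d → y ≡ x + + d → x ℤ.≤ y
+-≤ {x} d refl = ℤₚ.i≤i+j x (+ d)

insert-ordered : ∀ t S → Ordered S → (∀ {u} → u ∈ S → scale t ≡ scale u → typeT t ≡ typeT u) → ∃[ S' ] t ∷ S ↭ S' × Ordered S'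
insert-ordered t [] [] c = t ∷ [] , ↭-refl , [] ∷ []
insert-ordered t (u ∷ S) (a ∷ o) c with scale t ℤ.≤? scale u
... | yes t≤u with ≤⇒+ t≤u
...   | d , eq = t ∷ u ∷ S , ↭-refl , ((d , eq , λ { refl → sym (c (here refl) (sym (trans eq (ℤₚ.+-identityʳ _)))) }) ∷ All.tabulate after) ∷ a ∷ o
  where
  after : ∀ {w} → w ∈ S → After t w
  after {w} w∈S with All.lookup a w∈S
  ... | d' , eq' , _ = d ℕ.+ d' , e , λ z → sym (c (there w∈S) (sym (trans e (trans (cong (λ n → scale t + + n) z) (ℤₚ.+-identityʳ _)))))
    where
    e : scale w ≡ scale t + + (d ℕ.+ d')
    e = trans eq' (trans (cong (_+ + d') eq) (+-+ (scale t) d d'))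
insert-ordered t (u ∷ S) (a ∷ o) c | no t≰u with insert-ordered t S o (c ∘ there) | ≤⇒+ (ℤₚ.<⇒≤ (ℤₚ.≰⇒> t≰u))
... | S' , p , o' | d , eq = u ∷ S' , Perm.trans (Perm.swap t u ↭-refl) (Perm.prep u p) ,
  Permₚ.All-resp-↭ p ((d , eq , λ { refl → c (here refl) (trans eq (ℤₚ.+-identityʳ _)) }) ∷ a) ∷ o'

order : ∀ S → Coherent S → ∃[ S' ] S ↭ S' × Ordered S'
order [] c = [] , ↭-refl , []
order (t ∷ S) c with order S (λ p q → c (there p) (there q))
... | S' , p , o with insert-ordered t S' o (λ u∈S' → c (here refl) (there (Permₚ.∈-resp-↭ (↭-sym p) u∈S')))
...   | S″ , p' , o' = S″ , Perm.trans (Perm.prep t p) p' , o'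

≅⇒∼ : ∀ {N S T} → IsFine S → IsFine T → All (NonNeg N) S → All (NonNeg N) T → S ≅ˢ T ⟦ N ⟧ → S ∼ T
≅⇒∼ {N} {S} {T} fS fT ps qs φ =
  let (S' , p , o) = order S (fine⇒coherent fS)
      ps' = Permₚ.All-resp-↭ p ps
      φ' = ≅-trans (≅-sym (gram-↭ N p)) φ
      (T' , q , sh) = ≅⇒sameShape (coherent⇒fine (coherent-↭ p (fine⇒coherent fS))) fT ps' qs φ'
      qs' = Permₚ.All-resp-↭ q qs
  in ∼-trans (perm p) (∼-trans (complete (length S') refl (state ps' qs' sh o (≅⇒Invariant ps' qs' (≅-trans φ' (gram-↭ N q)) sh))) (perm (↭-sym q)))

-- Local moves as steps

AtScale : ℤ → FineSymbol → Set
AtScale e = Any (λ t → IsTypeI t × scale t ≡ e)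

isTypeI? : ∀ t → Dec (IsTypeI t)
isTypeI? (term e s II)    = no λ ()
isTypeI? (term e s (I l)) = yes (l , refl)

atScale? : ∀ e S → Dec (AtScale e S)
atScale? e = Any.any? (λ t → isTypeI? t ×-dec (scale t ℤ.≟ e))

inRange? : ∀ a b t → Dec (InRange a b t)
inRange? a b t = isTypeI? t ×-dec ((a ℤ.≤? scale t) ×-dec (scale t ℤ.≤? b))

last-before : ∀ (P : ℕ → Set) → (∀ n → Dec (P n)) → ∀ B → P 0 → ¬ P B → ∃[ n ] (∀ d → d ℕ.≤ n → P d) × ¬ P (suc n)
last-before P P? zero    p ¬p = ⊥-elim (¬p p)
last-before P P? (suc B) p ¬p with P? 1
... | no ¬p₁ = 0 , (λ { zero _ → p }) , ¬p₁
... | yes p₁ with last-before (P ∘ suc) (P? ∘ suc) B p₁ ¬p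
...   | n , ps , ¬q = suc n , (λ { zero _ → p ; (suc d) (s≤s d≤n) → ps d d≤n }) , ¬q

-- The sum of all distances bounds each of them, so the search for the ends of a compartment has a
-- place to stop.
distance : ℤ → FineSymbol → ℕ
distance e = weight (λ t → ∣ scale t - e ∣)

atScale-distance : ∀ e x S → AtScale x S → ∣ x - e ∣ ℕ.≤ distance e S
atScale-distance e x (t ∷ S) (here (_ , refl)) = ℕₚ.m≤m+n ∣ scale t - e ∣ (distance e S)
atScale-distance e x (t ∷ S) (there h) = ℕₚ.≤-trans (atScale-distance e x S h) (ℕₚ.m≤n+m (distance e S) ∣ scale t - e ∣)

compartment : ∀ {S e} → AtScale e S → ∃[ m ] ∃[ n ] CompartmentRange S (e - + m) (e + + n)
compartment {S} {e} h with
    last-before (λ d → AtScale (e - + d) S) (λ d → atScale? _ S) (suc (distance e S)) (subst (λ x → AtScale x S) (sym (ℤₚ.+-identityʳ e)) h)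
      (λ h → ℕₚ.<-irrefl refl (subst (ℕ._≤ distance e S) (trans (cong ∣_∣ (lem₋ e (+ suc (distance e S)))) (ℤₚ.∣-i∣≡∣i∣ (+ suc (distance e S)))) (atScale-distance e _ S h)))
  | last-before (λ d → AtScale (e + + d) S) (λ d → atScale? _ S) (suc (distance e S)) (subst (λ x → AtScale x S) (sym (ℤₚ.+-identityʳ e)) h)
      (λ h → ℕₚ.<-irrefl refl (subst (ℕ._≤ distance e S) (cong ∣_∣ (lem₊ e (+ suc (distance e S)))) (atScale-distance e _ S h)))
  where
  lem₋ : ∀ e d → e - d - e ≡ - d
  lem₋ = solve-∀
  lem₊ : ∀ e d → e + d - e ≡ d
  lem₊ = solve-∀
... | m , below , ¬below | n , above , ¬above = m , n ,
  ℤₚ.≤-trans (ℤₚ.i-j≤i e (+ m)) (ℤₚ.i≤i+j e (+ n)) , hit ,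
  (λ h → ¬below (Any.map (λ (τ , eq) → τ , trans (lem₁ _) (trans (cong (_- + 1) eq) (lem₂ e (+ m)))) h)) ,
  (λ h → ¬above (Any.map (λ (τ , eq) → τ , trans eq (lem₃ e (+ n))) h))
  where
  lem₁ : ∀ s → s ≡ s + + 1 - + 1
  lem₁ = solve-∀
  lem₂ : ∀ e m → e - m - + 1 ≡ e - (+ 1 + m)
  lem₂ = solve-∀
  lem₃ : ∀ e n → e + n + + 1 ≡ e + (+ 1 + n)
  lem₃ = solve-∀
  lem₄ : ∀ x d → x ≡ x + d - d
  lem₄ = solve-∀
  lem₅ : ∀ e d c m → d + c ≡ d + (e - m + c - (e - m))
  lem₅ = solve-∀
  lem₆ : ∀ e d m → d + (e - d - (e - m)) ≡ m
  lem₆ = solve-∀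
  ≤-+ : ∀ {d k} → e + + d ℤ.≤ e + + k → d ℕ.≤ k
  ≤-+ {d} {k} p with ≤⇒+ p
  ... | c , eq = subst (d ℕ.≤_) (sym (+-injectiveʳ e (trans eq (+-+ e d c)))) (ℕₚ.m≤m+n d c)
  hit : ∀ x → e - + m ℤ.≤ x → x ℤ.≤ e + + n → AtScale x S
  hit x a≤x x≤b with ℤₚ.≤-total e x
  ... | inj₁ e≤x with ≤⇒+ e≤x
  ...   | d , refl = above d (≤-+ x≤b)
  hit x a≤x x≤b | inj₂ x≤e with ≤⇒+ x≤e
  ...   | d , eq = subst (λ z → AtScale z S) (sym x≡) (below d d≤m)
    where
    x≡ : x ≡ e - + d
    x≡ = trans (lem₄ x (+ d)) (cong (_- + d) (sym eq))
    d≤m : d ℕ.≤ m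
    d≤m with ≤⇒+ (subst (e - + m ℤ.≤_) x≡ a≤x)
    ... | c , eq' = subst (d ℕ.≤_) (ℤₚ.+-injective (trans (lem₅ e (+ d) (+ c) (+ m)) (trans (cong (λ z → + d + (z - (e - + m))) (sym eq')) (lem₆ e (+ d) (+ m))))) (ℕₚ.m≤m+n d c)

split-range : ∀ a b S → ∃[ C ] ∃[ O ] S ↭ C ++ O × All (InRange a b) C × All (λ t → ¬ InRange a b t) O
split-range a b [] = [] , [] , ↭-refl , [] , []
split-range a b (t ∷ S) with split-range a b S | inRange? a b t
... | C , O , p , c , o | yes r = t ∷ C , O , Perm.prep t p , r ∷ c , o
... | C , O , p , c , o | no ¬r = C , t ∷ O , Perm.trans (Perm.prep t p) (↭-sym (Permₚ.shift t C O)) , c , ¬r ∷ o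

compartment-↭ : ∀ {S T a b} → S ↭ T → CompartmentRange S a b → CompartmentRange T a b
compartment-↭ p (a≤b , hit , ¬a , ¬b) = a≤b , (λ e x y → Permₚ.Any-resp-↭ p (hit e x y)) , ¬a ∘ Permₚ.Any-resp-↭ (↭-sym p) , ¬b ∘ Permₚ.Any-resp-↭ (↭-sym p)

sameButLabel-refl : ∀ {a b C} → All (InRange a b) C → Pointwise SameButLabel C C
sameButLabel-refl [] = []
sameButLabel-refl ((τ , _) ∷ c) = (refl , refl , τ , τ) ∷ sameButLabel-refl c

one : ∀ {S T} → Step S T → Star Step S T
one s = s ◅ ε

-- `giverPerm` acts on a whole compartment, so the other members are gathered next to `t` and `u`
-- and keep their labels.
exchange-steps : ∀ e s l s' l' S → Star Step (term e s (I l) ∷ term (e + + 1) s' (I l') ∷ S) (term e s (I l') ∷ term (e + + 1) s' (I l) ∷ S)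
exchange-steps e s l s' l' S = by-compartment (compartment (here ((l , refl) , refl)))
  where
  t u t' u' : Term
  t = term e s (I l)
  u = term (e + + 1) s' (I l')
  t' = term e s (I l')
  u' = term (e + + 1) s' (I l)
  by-compartment : ∃[ m ] ∃[ n ] CompartmentRange (t ∷ u ∷ S) (e - + m) (e + + n) → Star Step (t ∷ u ∷ S) (t' ∷ u' ∷ S)
  -- The compartment cannot end at `e`, because `u` has type I and scale exponent `e + 1`.
  by-compartment (m , zero , _ , _ , _ , ¬b) = ⊥-elim (¬b (there (here ((l' , refl) , cong (_+ + 1) (sym (ℤₚ.+-identityʳ e))))))
  by-compartment (m , suc n , r) = by-split (split-range a b S)
    where
    a b : ℤ
    a = e - + m
    b = e + + suc n
    t∈ : InRange a b t
    t∈ = (l , refl) , ℤₚ.i-j≤i e (+ m) , ℤₚ.i≤i+j e (+ suc n)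
    u∈ : InRange a b u
    u∈ = (l' , refl) , ℤₚ.≤-trans (ℤₚ.i-j≤i e (+ m)) (ℤₚ.i≤i+j e (+ 1)) , ℤₚ.+-monoʳ-≤ e (ℤ.+≤+ (s≤s z≤n))
    by-split : ∃[ C ] ∃[ O ] S ↭ C ++ O × All (InRange a b) C × All (λ t → ¬ InRange a b t) O → Star Step (t ∷ u ∷ S) (t' ∷ u' ∷ S)
    by-split (C , O , p , c , o) = _◅_ {j = t ∷ u ∷ C ++ O} (reorder (Perm.prep t (Perm.prep u p)))
      (_◅_ {j = t' ∷ u' ∷ C ++ O} (giverPerm {C = t ∷ u ∷ C} {C' = t' ∷ u' ∷ C} {rest = O} {a = a} {b = b}
        (compartment-↭ (Perm.prep t (Perm.prep u p)) r) (t∈ ∷ u∈ ∷ c) o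
        ((refl , refl , (l , refl) , (l' , refl)) ∷ (refl , refl , (l' , refl) , (l , refl)) ∷ sameButLabel-refl c)
        (Perm.swap (I l') (I l) ↭-refl))
      (one (reorder (Perm.prep t' (Perm.prep u' (↭-sym p))))))

convert-steps : ∀ e s₁ s₂ s₃ s₄ l S → Star Step (quadruple e s₁ s₂ s₃ s₄ l S) (quadruple e s₁ s₂ s₃ s₄ (flipL l) S)
convert-steps e s₁ s₂ s₃ s₄ l S = by-compartment (compartment (here ((l , refl) , refl)))
  where
  by-compartment : ∃[ m ] ∃[ n ] CompartmentRange (quadruple e s₁ s₂ s₃ s₄ l S) (e - + m) (e + + n) → Star Step (quadruple e s₁ s₂ s₃ s₄ l S) (quadruple e s₁ s₂ s₃ s₄ (flipL l) S)
  by-compartment (m , n , r) = one (giverConv {a = e - + m} {b = e + + n} r (member {s₁}) (member {s₂}) (member {s₃}) (member {s₄}) refl refl refl refl)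
    where
    member : ∀ {s} → InRange (e - + m) (e + + n) (term e s (I l))
    member = (l , refl) , ℤₚ.i-j≤i e (+ m) , ℤₚ.i≤i+j e (+ n)

negT-involutive : ∀ t → negT (negT t) ≡ t
negT-involutive (term e s k) = cong (λ s → term e s k) (flipS-involutive s)

negT-swapT-involutive : ∀ t {l} → kind t ≡ I l → negT (swapT (negT (swapT t))) ≡ t
negT-swapT-involutive (term e s (I l)) _ = cong₂ (λ s l → term e s (I l)) (flipS-involutive s) (flipL-involutive l)

walk-sym : ∀ {t u t' u'} → Walk t u t' u' → Walk t' u' t u
walk-sym (walk0 {t} {u} e) = subst₂ (Walk (negT t) (negT u)) (negT-involutive t) (negT-involutive u) (walk0 e)
walk-sym (walk1 {t} {u} d τ) = subst₂ (Walk (negT t) (negT u)) (negT-involutive t) (negT-involutive u) (walk1 d τ)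
walk-sym (walk3 {t} {u} d τ τ') = subst₂ (Walk (negT t) (negT u)) (negT-involutive t) (negT-involutive u) (walk3 d τ τ')
walk-sym (walk2 {term e s (I l)} {term e' s' (I .l)} d refl refl) =
  subst₂ (Walk (term e (flipS s) (I (flipL l))) (term e' (flipS s') (I (flipL l)))) (negT-swapT-involutive _ {l} refl) (negT-swapT-involutive _ {l} refl) (walk2 d refl refl)

walk-steps : ∀ {t u t' u'} → Walk t u t' u' → ∀ S → Star Step (t ∷ u ∷ S) (t' ∷ u' ∷ S) × Star Step (t' ∷ u' ∷ S) (t ∷ u ∷ S)
walk-steps w S = one (signWalk w) , one (signWalk (walk-sym w))

move-steps : ∀ {C C'} → Move C C' → ∀ S → Star Step (C ++ S) (C' ++ S) × Star Step (C' ++ S) (C ++ S)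
move-steps (walk-I e s l s' l') S = walk-steps (walk0 refl) S
move-steps (walk-II e s s') S = walk-steps (walk0 refl) S
move-steps (walk-I,II e s l s') S = walk-steps (walk1 (inj₁ refl) (inj₁ ((l , refl) , refl))) S
move-steps (walk-II,I e s s' l) S = walk-steps (walk1 (inj₁ refl) (inj₂ (refl , (l , refl)))) S
move-steps (walk-≡ e s s' l) S = walk-steps (walk2 (inj₁ refl) refl refl) S
move-steps (walk-4 e s l s' l') S = walk-steps (walk3 (inj₁ refl) (l , refl) (l' , refl)) S
move-steps (exchange e s s' l) S = exchange-steps e s l s' (flipL l) S , exchange-steps e s (flipL l) s' l S
move-steps (convert+ e) S = convert-steps e plus plus plus plus G S , convert-steps e plus plus plus plus R S
-- `giverConv` keeps the signs and leaves three plus receivers and a minus one; a walk between the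
-- second and third terms produces the signs of the move.
move-steps (convert- e) S = convert-steps e plus plus plus minus G S ◅◅ proj₁ (signs plus plus) , proj₂ (signs plus plus) ◅◅ convert-steps e plus plus plus minus R S
  where
  rotation : ∀ {t u v w} → t ∷ u ∷ v ∷ w ∷ S ↭ u ∷ v ∷ t ∷ w ∷ S
  rotation = Perm.trans (Perm.swap _ _ ↭-refl) (Perm.prep _ (Perm.swap _ _ ↭-refl))
  signs : ∀ s₂ s₃ → Star Step (quadruple e plus s₂ s₃ minus R S) (quadruple e plus (flipS s₂) (flipS s₃) minus R S) ×
                    Star Step (quadruple e plus (flipS s₂) (flipS s₃) minus R S) (quadruple e plus s₂ s₃ minus R S)
  signs s₂ s₃ = let (p , q) = walk-steps (walk0 {term e s₂ (I R)} {term e s₃ (I R)} refl) (term e plus (I R) ∷ term e minus (I R) ∷ S) in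
    reorder rotation ◅ p ◅◅ one (reorder (↭-sym rotation)) ,
    reorder rotation ◅ q ◅◅ one (reorder (↭-sym rotation))

∼⇒steps : ∀ {S T} → S ∼ T → Star Step S T × Star Step T S
∼⇒steps (perm p) = one (reorder p) , one (reorder (↭-sym p))
∼⇒steps (move m S) = move-steps m S
∼⇒steps (∼-sym p) = proj₂ (∼⇒steps p) , proj₁ (∼⇒steps p)
∼⇒steps (∼-trans p q) = proj₁ (∼⇒steps p) ◅◅ proj₁ (∼⇒steps q) , proj₂ (∼⇒steps q) ◅◅ proj₂ (∼⇒steps p)

-- Steps as local moves

-- The condition on types rules out a walk between type I and type II at one scale, a configuration
-- absent from fine symbols.
∼-walk : ∀ {t u t' u'} S → Walk t u t' u' → (scale t ≡ scale u → typeT t ≡ typeT u) → t ∷ u ∷ S ∼ t' ∷ u' ∷ S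
∼-walk S (walk0 {term e s (I l)} {term .e s' (I l')} refl) _ = move (walk-I e s l s' l') S
∼-walk S (walk0 {term e s II} {term .e s' II} refl) _ = move (walk-II e s s') S
∼-walk S (walk0 {term e s (I l)} {term .e s' II} refl) c with () ← c refl
∼-walk S (walk0 {term e s II} {term .e s' (I l)} refl) c with () ← c refl
∼-walk S (walk1 {term e s (I l)} {term _ s' II} (inj₁ refl) _) _ = move (walk-I,II e s l s') S
∼-walk S (walk1 {term e s II} {term _ s' (I l)} (inj₁ refl) _) _ = move (walk-II,I e s s' l) S
∼-walk S (walk1 {term _ s (I l)} {term e s' II} (inj₂ refl) _) _ = ∼-trans (∼-swap _ _ S) (∼-trans (move (walk-II,I e s' s l) S) (∼-swap _ _ S))
∼-walk S (walk1 {term _ s II} {term e s' (I l)} (inj₂ refl) _) _ = ∼-trans (∼-swap _ _ S) (∼-trans (move (walk-I,II e s' l s) S) (∼-swap _ _ S))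
∼-walk S (walk1 {term _ s (I l)} {term e s' (I l')} _ (inj₁ (_ , ()))) _
∼-walk S (walk1 {term _ s (I l)} {term e s' (I l')} _ (inj₂ (() , _))) _
∼-walk S (walk1 {term _ s II} {term e s' II} _ (inj₁ ((_ , ()) , _))) _
∼-walk S (walk1 {term _ s II} {term e s' II} _ (inj₂ (_ , (_ , ())))) _
∼-walk S (walk2 {term e s (I l)} {term _ s' (I .l)} (inj₁ refl) refl refl) _ = move (walk-≡ e s s' l) S
∼-walk S (walk2 {term _ s (I l)} {term e s' (I .l)} (inj₂ refl) refl refl) _ = ∼-trans (∼-swap _ _ S) (∼-trans (move (walk-≡ e s' s l) S) (∼-swap _ _ S))
∼-walk S (walk3 {term e s (I l)} {term _ s' (I l')} (inj₁ refl) _ _) _ = move (walk-4 e s l s' l') S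
∼-walk S (walk3 {term _ s (I l)} {term e s' (I l')} (inj₂ refl) _ _) _ = ∼-trans (∼-swap _ _ S) (∼-trans (move (walk-4 e s' l' s l) S) (∼-swap _ _ S))
∼-walk S (walk3 {term _ s II} _ (_ , ()) _) _
∼-walk S (walk3 {term _ s (I l)} {term _ s' II} _ _ (_ , ())) _

-- Labels of a sorted compartment

labelK : Kind → Label
labelK II    = G
labelK (I l) = l

slots : FineSymbol → List Slot
slots = map (λ t → scale t , sign t)

labels : FineSymbol → List Label
labels = map (labelK ∘ kind)

labelled-self : ∀ {D} → All IsTypeI D → labelled (slots D) (labels D) ≡ D
labelled-self [] = refl
labelled-self {term e s (I l) ∷ D} (_ ∷ τ) = cong (term e s (I l) ∷_) (labelled-self τ)
labelled-self {term e s II ∷ D} ((_ , ()) ∷ τ)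

sameButLabel-slots : ∀ {D D'} → Pointwise SameButLabel D D' → slots D ≡ slots D'
sameButLabel-slots [] = refl
sameButLabel-slots ((e , s , _) ∷ p) = cong₂ _∷_ (cong₂ _,_ e s) (sameButLabel-slots p)

sameButLabel-typeIˡ : ∀ {D D'} → Pointwise SameButLabel D D' → All IsTypeI D
sameButLabel-typeIˡ [] = []
sameButLabel-typeIˡ ((_ , _ , τ , _) ∷ p) = τ ∷ sameButLabel-typeIˡ p

sameButLabel-typeIʳ : ∀ {D D'} → Pointwise SameButLabel D D' → All IsTypeI D'
sameButLabel-typeIʳ [] = []
sameButLabel-typeIʳ ((_ , _ , _ , τ) ∷ p) = τ ∷ sameButLabel-typeIʳ p

transport-↭ : ∀ {R : Term → Term → Set} {C C' D} → C ↭ D → Pointwise R C C' → ∃[ D' ] C' ↭ D' × Pointwise R D D'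
transport-↭ Perm.refl p = _ , ↭-refl , p
transport-↭ (Perm.prep t q) (r ∷ p) = let (D' , q' , p') = transport-↭ q p in _ , Perm.prep _ q' , r ∷ p'
transport-↭ (Perm.swap t u q) (r ∷ r' ∷ p) = let (D' , q' , p') = transport-↭ q p in _ , Perm.swap _ _ q' , r' ∷ r ∷ p'
transport-↭ (Perm.trans q₁ q₂) p = let (D' , q₁' , p') = transport-↭ q₁ p ; (D″ , q₂' , p″) = transport-↭ q₂ p' in D″ , Perm.trans q₁' q₂' , p″

NoGaps : ℤ → FineSymbol → Set
NoGaps b D = ∀ {t x} → t ∈ D → scale t ℤ.≤ x → x ℤ.≤ b → ∃[ u ] u ∈ D × scale u ≡ x

ordered-head : ∀ {t D} → Ordered (t ∷ D) → ∀ {u} → u ∈ t ∷ D → scale t ℤ.≤ scale u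
ordered-head (a ∷ o) (here refl) = ℤₚ.≤-refl
ordered-head (a ∷ o) (there u∈D) = +-≤ _ (proj₁ (proj₂ (All.lookup a u∈D)))

-- If the only term found at `x` is the removed first one, then `x` is the lowest scale and `u`,
-- lying between the two, has it as well.
noGaps-tail : ∀ {b t D} → Ordered (t ∷ D) → NoGaps b (t ∷ D) → NoGaps b D
noGaps-tail {b} {t} o g {u} {x} u∈D u≤x x≤b with g (there u∈D) u≤x x≤b
... | w , there w∈D , eq = w , w∈D , eq
... | _ , here refl , eq = u , u∈D , ℤₚ.≤-antisym u≤x (subst (ℤ._≤ scale u) eq (ordered-head o (there u∈D)))

-- A jump of two or more would leave the scale just above `t` empty, although it lies within the
-- range.
ordered-chain : ∀ {b D} → Ordered D → NoGaps b D → All (λ t → scale t ℤ.≤ b) D → Chain (slots D)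
ordered-chain [] _ _ = []
ordered-chain (_ ∷ []) _ _ = [-]
ordered-chain {b} {t ∷ u ∷ D} o@(((d , eq , _) ∷ _) ∷ o') g (_ ∷ u≤b ∷ bs) = link d eq (ordered-chain o' (noGaps-tail o g) (u≤b ∷ bs))
  where
  link : ∀ d → scale u ≡ scale t + + d → Chain (slots (u ∷ D)) → Chain (slots (t ∷ u ∷ D))
  link zero eq c = subst (λ e → Chain ((e , sign t) ∷ slots (u ∷ D))) (trans eq (ℤₚ.+-identityʳ (scale t))) (same c)
  link (suc zero) eq c = subst (λ e → Chain ((e , sign u) ∷ slots D) → Chain ((scale t , sign t) ∷ (e , sign u) ∷ slots D)) (sym eq) next c
  link (suc (suc d)) eq c with g {x = scale t + + 1} (here refl) (+-≤ 1 refl) (ℤₚ.≤-trans (+-≤ (suc d) (trans eq (sym (+-+ (scale t) 1 (suc d))))) u≤b)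
  ... | _ , here refl , eq' = ⊥-elim (e≢e+suc (scale t) 0 eq')
  ... | w , there w∈D , eq' with ≤⇒+ (ordered-head o' w∈D)
  ...   | c' , eq″ with () ← ℕₚ.suc-injective (+-injectiveʳ (scale t) {1} {2 ℕ.+ d ℕ.+ c'} (trans (sym eq') (trans eq″ (trans (cong (_+ + c') eq) (+-+ (scale t) (2 ℕ.+ d) c')))))

-- A conversion may affect any four terms of a compartment; permutations before and after it move
-- the affected labels to the first four slots of the sorted chain.
data LabelStep : List Label → List Label → Set where
  permuted  : ∀ {ls ls'} → ls ↭ ls' → LabelStep ls ls'
  converted : ∀ {l ls ls' ks} → ls ↭ l ∷ l ∷ l ∷ l ∷ ks → flipL l ∷ flipL l ∷ flipL l ∷ flipL l ∷ ks ↭ ls' → LabelStep ls ls'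

labelStep-↭ : ∀ {ls ls' ms ms'} → ms ↭ ls → ls' ↭ ms' → LabelStep ls ls' → LabelStep ms ms'
labelStep-↭ p q (permuted r) = permuted (↭-trans p (↭-trans r q))
labelStep-↭ p q (converted r r') = converted (↭-trans p r) (↭-trans r' q)

chain-take-4 : ∀ {x₁ x₂ x₃ x₄ xs} → Chain (x₁ ∷ x₂ ∷ x₃ ∷ x₄ ∷ xs) → Chain (x₁ ∷ x₂ ∷ x₃ ∷ x₄ ∷ [])
chain-take-4 c = snoc c (λ c → snoc c (λ c → snoc c (λ _ → [-])))
  where
  snoc : ∀ {x y xs ys} → Chain (x ∷ y ∷ xs) → (Chain (y ∷ xs) → Chain (y ∷ ys)) → Chain (x ∷ y ∷ ys)
  snoc (same c) f = same (f c)
  snoc (next c) f = next (f c)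

change-labels : ∀ {xs ls ls'} → Chain xs → length xs ≡ length ls → LabelStep ls ls' → ∀ S → labelled xs ls ++ S ∼ labelled xs ls' ++ S
change-labels c n (permuted p) S = permute-labels c n p S
change-labels {xs} {ls} c n (converted {l} {ks = ks} p q) S = ∼-trans (permute-labels c n p S)
  (∼-trans (first-four xs c n') (permute-labels c n' q S))
  where
  n' : length xs ≡ length (l ∷ l ∷ l ∷ l ∷ ks)
  n' = trans n (Permₚ.↭-length p)
  first-four : ∀ xs → Chain xs → length xs ≡ 4 ℕ.+ length ks → labelled xs (l ∷ l ∷ l ∷ l ∷ ks) ++ S ∼ labelled xs (flipL l ∷ flipL l ∷ flipL l ∷ flipL l ∷ ks) ++ S
  first-four (x₁ ∷ x₂ ∷ x₃ ∷ x₄ ∷ xs) c _ = convert-chain (chain-take-4 c) l (labelled xs ks ++ S)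
  first-four [] _ ()
  first-four (_ ∷ []) _ ()
  first-four (_ ∷ _ ∷ []) _ ()
  first-four (_ ∷ _ ∷ _ ∷ []) _ ()

-- Sorted by scale, the terms of a compartment form a chain.
compartment-labels : ∀ {C C' O a b} → CompartmentRange (C ++ O) a b → All (InRange a b) C → All (λ t → ¬ InRange a b t) O →
  Pointwise SameButLabel C C' → LabelStep (labels C) (labels C') → C ++ O ∼ C' ++ O
compartment-labels {C} {C'} {O} {a} {b} (_ , hit , _) inC outO relabel st
  with order C (λ {t} {u} t∈C u∈C _ → trans (isI {t} (proj₁ (All.lookup inC t∈C))) (sym (isI {u} (proj₁ (All.lookup inC u∈C)))))
  where
  isI : ∀ {t} → IsTypeI t → typeT t ≡ type-I
  isI {term _ _ (I l)} _ = refl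
  isI {term _ _ II} (_ , ())
... | D , p , o with transport-↭ p relabel
...   | D' , p' , relabel' = ∼-trans (perm (Permₚ.++⁺ʳ O p)) (∼-trans
    (subst₂ (λ X Y → X ++ O ∼ Y ++ O) (labelled-self (sameButLabel-typeIˡ relabel'))
      (trans (cong (λ xs → labelled xs (labels D')) (sameButLabel-slots relabel')) (labelled-self (sameButLabel-typeIʳ relabel')))
      (change-labels (ordered-chain {b} o gaps (All.map (proj₂ ∘ proj₂) inD)) (trans (Lₚ.length-map _ D) (sym (Lₚ.length-map _ D)))
        (labelStep-↭ (Permₚ.map⁺ _ (↭-sym p)) (Permₚ.map⁺ _ p') st) O))
    (perm (Permₚ.++⁺ʳ O (↭-sym p'))))
  where
  inD : All (InRange a b) D
  inD = Permₚ.All-resp-↭ p inC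
  find : ∀ {x} X → Any (λ t → IsTypeI t × scale t ≡ x) X → ∃[ t ] t ∈ X × IsTypeI t × scale t ≡ x
  find (t ∷ X) (here (τ , e)) = t , here refl , τ , e
  find (t ∷ X) (there h) = let (u , u∈X , r) = find X h in u , there u∈X , r
  gaps : NoGaps b D
  gaps {t} {x} t∈D t≤x x≤b with a≤x ← ℤₚ.≤-trans (proj₁ (proj₂ (All.lookup inD t∈D))) t≤x
    with Anyₚ.++⁻ C (hit x a≤x x≤b)
  ... | inj₁ h = let (u , u∈C , _ , e) = find C h in u , Permₚ.∈-resp-↭ p u∈C , e
  ... | inj₂ h = let (u , u∈O , τ , e) = find O h in ⊥-elim (All.lookup outO u∈O (τ , subst (a ℤ.≤_) (sym e) a≤x , subst (ℤ._≤ b) (sym e) x≤b))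

step⇒∼ : ∀ {S T} → Coherent S → Step S T → S ∼ T
step⇒∼ c (reorder p) = perm p
step⇒∼ c (signWalk {rest = S} w) = ∼-walk S w (c (here refl) (there (here refl)))
step⇒∼ c (giverPerm {C} {C'} {rest} r inC outO relabel p) = compartment-labels r inC outO relabel
  (permuted (subst₂ _↭_ (sym (Lₚ.map-∘ C)) (sym (Lₚ.map-∘ C')) (Permₚ.map⁺ labelK (↭-sym p))))
step⇒∼ c (giverConv {term e₁′ s₁ _} {term e₂′ s₂ _} {term e₃ s₃ _} {term e₄ s₄ _} {rest} {a} {b} {l} r i₁ i₂ i₃ i₄ refl refl refl refl)
  with split-range a b rest
... | C , O , p , inC , outO = ∼-trans (perm (under p)) (∼-trans
  (compartment-labels {term e₁′ s₁ (I l) ∷ term e₂′ s₂ (I l) ∷ term e₃ s₃ (I l) ∷ term e₄ s₄ (I l) ∷ C}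
    (compartment-↭ (under p) r) (i₁ ∷ i₂ ∷ i₃ ∷ i₄ ∷ inC) outO
    ((refl , refl , (l , refl) , (flipL l , refl)) ∷ (refl , refl , (l , refl) , (flipL l , refl)) ∷
     (refl , refl , (l , refl) , (flipL l , refl)) ∷ (refl , refl , (l , refl) , (flipL l , refl)) ∷ sameButLabel-refl inC)
    (converted ↭-refl ↭-refl))
  (perm (↭-sym (under p))))
  where
  under : ∀ {w x y z X Y} → X ↭ Y → w ∷ x ∷ y ∷ z ∷ X ↭ w ∷ x ∷ y ∷ z ∷ Y
  under p = Perm.prep _ (Perm.prep _ (Perm.prep _ (Perm.prep _ p)))

-- Preservation of fineness

keys : FineSymbol → List (ℤ × Type)
keys = map (λ t → scale t , typeT t)

move-keys : ∀ {C C'} → Move C C' → keys C ≡ keys C'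
move-keys (walk-I e s l s' l') = refl
move-keys (walk-II e s s') = refl
move-keys (walk-I,II e s l s') = refl
move-keys (walk-II,I e s s' l) = refl
move-keys (walk-≡ e s s' l) = refl
move-keys (walk-4 e s l s' l') = refl
move-keys (exchange e s s' l) = refl
move-keys (convert+ e) = refl
move-keys (convert- e) = refl

∼-keys : ∀ {S T} → S ∼ T → keys S ↭ keys T
∼-keys (perm p) = Permₚ.map⁺ _ p
∼-keys (move {C} {C'} m S) = Perm.↭-reflexive (trans (Lₚ.map-++ _ C S) (trans (cong (_++ keys S) (move-keys m)) (sym (Lₚ.map-++ _ C' S))))
∼-keys (∼-sym p) = ↭-sym (∼-keys p)
∼-keys (∼-trans p q) = ↭-trans (∼-keys p) (∼-keys q)

∼-member : ∀ {S T t} → S ∼ T → t ∈ T → ∃[ t' ] t' ∈ S × (scale t , typeT t) ≡ (scale t' , typeT t')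
∼-member p t∈T = Memₚ.∈-map⁻ (λ t → scale t , typeT t) (Permₚ.∈-resp-↭ (↭-sym (∼-keys p)) (Memₚ.∈-map⁺ (λ t → scale t , typeT t) t∈T))

-- Coherence depends only on scales and types, which moves preserve, so it is available at every
-- symbol along a sequence of steps.
∼-coherent : ∀ {S T} → S ∼ T → Coherent S → Coherent T
∼-coherent p c t∈T u∈T e
  with t' , t'∈S , et ← ∼-member p t∈T | u' , u'∈S , eu ← ∼-member p u∈T
  = trans (cong proj₂ et) (trans (c t'∈S u'∈S (trans (sym (cong proj₁ et)) (trans e (cong proj₁ eu)))) (sym (cong proj₂ eu)))

steps⇒∼ : ∀ {S T} → Coherent S → Star Step S T → S ∼ T
steps⇒∼ c ε = ∼-refl
steps⇒∼ c (s ◅ ss) = let p = step⇒∼ c s in ∼-trans p (steps⇒∼ (∼-coherent p c) ss)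

theorem2p4 : (S T : FineSymbol) → IsFine S → IsFine T →
    (Isometric S T ⇔ Star Step S T)
theorem2p4 S T fS fT = mk⇔
  (λ φ → proj₁ (∼⇒steps (≅⇒∼ fS fT (proj₁ nonneg) (proj₂ nonneg) (Isometric⇒≅ S T φ))))
  (λ ss → ≅⇒Isometric S T (∼⇒≅ (steps⇒∼ (fine⇒coherent fS) ss) (proj₁ nonneg)))
  where nonneg = commonShift-NonNeg S T
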